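{- Let $\mathbf b\in\mathbb{Z}^{n}$ be an integer vector indexed by $V(G)$, and for a positive integer $q$ let $b=[\mathbf b]_q:V(G)\to\mathbb{Z}_q$. The following hold. (1) For every positive integer $q$, $$\#F^*(G,b;\mathbb{Z}_q)=\sum_{S\subseteq E(G)}(-1)^{|S|}\tilde{d}_S(q)\,q^{m(G-S)}.$$ Moreover, there exists a polynomial $\tau(G,b;t)$ (depending on $G$, its orientation and $\mathbf b$) such that $\#F^*(G,b;\mathbb{Z}_q)=\tau(G,b;q)$ for all integers $q>q_{\mathbf b}$, and $\tau(G,b;t)$ can be written as $$\tau(G,b;t)=\sum_{S\subseteq E(G),\ r(\bar{M}_S)=m-m(G-S)}(-1)^{|S|}t^{m(G-S)}.$$ (2) $\tau(G,b;t)=\chi\big(\mathcal{A}_{E(G)}^{(M_G,\mathbf b)},t\big)$. (3) For any positive integers $p,q$, with $b=[\mathbf b]_q$ and $b'=[\mathbf b]_{pq}$, if $G$ has a $(\mathbb{Z}_{pq},b')$-flow, then $$\#F^*(G,b;\mathbb{Z}_q)\le \#F^*(G,b';\mathbb{Z}_{pq}).$$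
   Context: $G$ is a finite graph, multiple edges and loops allowed, with vertex set $V(G)=\{1,\dots,n\}$ and $m=|E(G)|$ edges, equipped with a fixed orientation. For $S\subseteq E(G)$, $G-S$ is the spanning subgraph obtained by removing the edges in $S$; $c(\cdot)$ is the number of connected components; the nullity of a spanning subgraph with edge set $T$ is $|T|-|V(G)|+c$, and $m(G-S)$ denotes the nullity of $G-S$ (not to be confused with the integer $m=|E(G)|$). $\mathbb{Z}_q=\mathbb{Z}/q\mathbb{Z}$ and $[\cdot]_q$ denotes entrywise reduction modulo $q$. For $b:V(G)\to\mathbb{Z}_q$, a $(\mathbb{Z}_q,b)$-flow of $G$ is $f:E(G)\to\mathbb{Z}_q$ with $\sum_{e\in E^+(v)}f(e)-\sum_{e\in E^-(v)}f(e)=b(v)$ for all $v\in V(G)$, where $E^+(v)$ (resp. $E^-(v)$) is the set of edges with head (resp. tail) $v$. It is nowhere-zero if $f(e)\ne0$ for all $e\in E(G)$. $F^*(G,b;\mathbb{Z}_q)$ is the set of nowhere-zero $(\mathbb{Z}_q,b)$-flows. The incidence matrix $M_G=(m_{ve})$ is the $n\times m$ matrix with $m_{ve}=1$ if $e$ is a non-loop edge with head $v$, $-1$ if $e$ is a non-loop edge with tail $v$, and $0$ otherwise. Let $I$ be the $m\times m$ identity matrix with rows and columns indexed by $E(G)$, $I_S$ its submatrix of rows indexed by $S$, and $\bar M_S=\begin{bmatrix}M_G&\mathbf b\\ I_S&\mathbf 0\end{bmatrix}$. $r(\cdot)$ of a matrix is its rank, and for an integer matrix $N$ of positive rank, $d(N)$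 is its largest invariant factor (the last nonzero diagonal entry of its Smith normal form, taken positive). Put $$q_{\mathbf b}=\max\{d(\bar M_S): S\subseteq E(G),\ r(\bar M_S)\ne m-m(G-S)\}$$ (with $q_{\mathbf b}=0$ if there is no such $S$). Let $\tilde d_S(q)=1$ if $r(\bar M_S)=m-m(G-S)$; $\tilde d_S(q)=1$ if $r(\bar M_S)\ne m-m(G-S)$ and $d(\bar M_S)\equiv0\pmod q$; and $\tilde d_S(q)=0$ otherwise. $\mathcal{A}_{E(G)}^{(M_G,\mathbf b)}$ is the arrangement, in $V(M_G,\mathbf b)=\{\mathbf x\in\mathbb{R}^{E(G)}:M_G\mathbf x=\mathbf b\}$, of the subspaces $H_e=\{\mathbf x\in V(M_G,\mathbf b):x_e=0\}$, $e\in E(G)$. Its characteristic polynomial is $\chi\big(\mathcal{A}_{E(G)}^{(M_G,\mathbf b)},t\big)=\sum_S(-1)^{|S|}t^{\dim(\bigcap_{e\in S}H_e)}$, the sum over $S\subseteq E(G)$ with $\bigcap_{e\in S}H_e\neq\emptyset$ (the intersection for $S=\emptyset$ being $V(M_G,\mathbf b)$); it is the zero polynomial if $V(M_G,\mathbf b)=\emptyset$. -}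

module Defs where

open import Algebra.Bundles using (CommutativeRing)
import Algebra.Properties.Semiring.Sum
open import Data.Bool.Base using (if_then_else_)
open import Data.Fin.Base using (Fin; zero; suc; toℕ; fromℕ<; punchIn; punchOut)
import Data.Fin.Properties as Fin
open import Data.Fin.Properties
  using (all?; any?; punchOut-cong; punchOut-injective; punchOut-punchIn; punchInᵢ≢i)
open import Data.Fin.Subset using (Subset; inside; outside; ∣_∣; _∈_; ∁)
open import Data.Integer.Base as ℤ using (ℤ; +_; -[1+_]; 0ℤ; 1ℤ; -1ℤ)
import Data.Integer.Divisibility.Signed as ℤ∣
open import Data.Integer.DivMod using (a≡a%n+[a/n]*n; n%d<d; n%ℕd<d)
import Data.Integer.Properties as ℤ
import Data.Integer.Solver
open import Data.List.Base as List using (List; []; _∷_; length)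
open import Data.List.Extrema.Nat using (max)
open import Data.List.Relation.Unary.All using (All; []; _∷_)
open import Data.List.Relation.Unary.Linked using (Linked; []; [-]; _∷_)
open import Data.Maybe.Base using (Maybe; just; nothing; maybe; fromMaybe)
open import Data.Nat.Base as ℕ using (ℕ; zero; suc; z≤n; s≤s; _∸_; _⊔_; NonZero)
import Data.Nat.Divisibility as ℕ∣
open import Data.Nat.Induction using (<-wellFounded)
import Data.Nat.Properties as ℕ
open import Data.Product.Base using (Σ; ∃; ∃-syntax; _×_; _,_; proj₁; proj₂)
open import Data.Rational.Base as ℚ using (ℚ; 0ℚ; 1ℚ; ½)
import Data.Rational.Properties as ℚ
import Data.Rational.Solver
open import Data.Sum.Base using (_⊎_; inj₁; inj₂)
open import Data.Vec.Base as Vec using (Vec; []; _∷_; here; there)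
open import Data.Vec.Functional as Vector using (Vector; _++_)
open import Function.Bundles using (_⇔_; mk⇔; Equivalence)
open import Induction.WellFounded using (Acc; acc)
open import Level using (Level; 0ℓ) renaming (_⊔_ to _⊔ˡ_)
open import Relation.Binary.Construct.Closure.Equivalence as EqClosure using (EqClosure)
open import Relation.Binary.Construct.Closure.ReflexiveTransitive as Star using (_◅◅_)
import Relation.Binary.Reasoning.Setoid
open import Relation.Binary.PropositionalEquality
  using (_≡_; _≢_; refl; sym; trans; cong; cong₂; subst; isEquivalence; module ≡-Reasoning)
open import Relation.Nullary using (Dec; ¬_; yes; no; does; contradiction; ¬?; _×-dec_)
open import Relation.Nullary.Decidable using (decidable-stable)

module LinearAlgebra {a ℓ : Level} (R : CommutativeRing a ℓ) where

  open CommutativeRing R hiding (zero; refl; sym; trans; isEquivalence)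
  open CommutativeRing R using () renaming (refl to ≈-refl; sym to ≈-sym; trans to ≈-trans)
  open Algebra.Properties.Semiring.Sum semiring
  open Relation.Binary.Reasoning.Setoid setoid

  Matrix : ℕ → ℕ → Set a
  Matrix k l = Vector (Vector Carrier l) k

  infix 4 _≋_
  _≋_ : ∀ {k l} → Matrix k l → Matrix k l → Set ℓ
  A ≋ B = ∀ i j → A i j ≈ B i j

  infixl 7 _·_
  _·_ : ∀ {k l p} → Matrix k l → Matrix l p → Matrix k p
  _·_ {l = l} A B i j = ∑[ h < l ] (A i h * B h j)

  𝟙 : ∀ {k} → Matrix k k
  𝟙 i j = if does (i Fin.≟ j) then 1# else 0#

  _ᵀ : ∀ {k l} → Matrix k l → Matrix l k
  (A ᵀ) i j = A j i

  infixr 7 _∙_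
  _∙_ : ∀ {k l} → Matrix k l → Vector Carrier l → Vector Carrier k
  _∙_ {l = l} A x i = ∑[ j < l ] (A i j * x j)

  combination : ∀ {d k} → Vector Carrier d → Vector (Vector Carrier k) d → Vector Carrier k
  combination {d} c v i = ∑[ j < d ] (c j * v j i)

  Span : ∀ {d k} → Vector (Vector Carrier k) d → Vector Carrier k → Set (a ⊔ˡ ℓ)
  Span {d} v y = ∃[ c ] (∀ i → y i ≈ combination {d} c v i)

  LinearlyIndependent : ∀ {d k} → Vector (Vector Carrier k) d → Set (a ⊔ˡ ℓ)
  LinearlyIndependent v = ∀ c → (∀ i → combination c v i ≈ 0#) → ∀ j → c j ≈ 0#

  HasDimension : ∀ {p k} → (Vector Carrier k → Set p) → ℕ → Set (a ⊔ˡ ℓ ⊔ˡ p)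
  HasDimension {k = k} P d = Σ (Vector (Vector Carrier k) d) λ v →
    LinearlyIndependent v × (∀ y → P y ⇔ Span v y)

  -- The dimension of a nonempty affine subspace is that of its space of directions.
  HasAffineDimension : ∀ {p k} → (Vector Carrier k → Set p) → ℕ → Set (a ⊔ˡ ℓ ⊔ˡ p)
  HasAffineDimension P d =
    ∃[ x ] (P x × HasDimension (λ z → P (λ i → x i + z i)) d)

  sum-cong : ∀ {k} {f g : Vector Carrier k} → (∀ i → f i ≈ g i) → sum f ≈ sum g
  sum-cong = sum-cong-≋

  sum-zero : ∀ {k} {f : Vector Carrier k} → (∀ i → f i ≈ 0#) → sum f ≈ 0#
  sum-zero {k} h = ≈-trans (sum-cong h) (sum-replicate-zero k)

  sum-0* : ∀ {k} (f : Vector Carrier k) → ∑[ i < k ] (0# * f i) ≈ 0#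
  sum-0* f = sum-zero (λ i → zeroˡ (f i))

  sum-*0 : ∀ {k} (f : Vector Carrier k) → ∑[ i < k ] (f i * 0#) ≈ 0#
  sum-*0 f = sum-zero (λ i → zeroʳ (f i))

  sum-𝟙* : ∀ {k} (f : Vector Carrier k) i → ∑[ h < k ] (𝟙 i h * f h) ≈ f i
  sum-𝟙* {suc k} f zero    =
    ≈-trans (+-cong (*-identityˡ _) (sum-0* (λ h → f (suc h)))) (+-identityʳ _)
  sum-𝟙* {suc k} f (suc i) =
    ≈-trans (+-cong (zeroˡ _) (sum-𝟙* (λ h → f (suc h)) i)) (+-identityˡ _)

  sum-*𝟙 : ∀ {k} (f : Vector Carrier k) j → ∑[ h < k ] (f h * 𝟙 h j) ≈ f j
  sum-*𝟙 {suc k} f zero    =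
    ≈-trans (+-cong (*-identityʳ _) (sum-*0 (λ h → f (suc h)))) (+-identityʳ _)
  sum-*𝟙 {suc k} f (suc j) =
    ≈-trans (+-cong (zeroʳ _) (sum-*𝟙 (λ h → f (suc h)) j)) (+-identityˡ _)

  ≋-refl : ∀ {k l} {A : Matrix k l} → A ≋ A
  ≋-refl i j = ≈-refl

  ≋-sym : ∀ {k l} {A B : Matrix k l} → A ≋ B → B ≋ A
  ≋-sym p i j = ≈-sym (p i j)

  ≋-trans : ∀ {k l} {A B C : Matrix k l} → A ≋ B → B ≋ C → A ≋ C
  ≋-trans p q i j = ≈-trans (p i j) (q i j)

  ·-cong : ∀ {k l p} {A A′ : Matrix k l} {B B′ : Matrix l p} → A ≋ A′ → B ≋ B′ → A · B ≋ A′ · B′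
  ·-cong p q i j = sum-cong (λ h → *-cong (p i h) (q h j))

  ·-identityˡ : ∀ {k l} (A : Matrix k l) → 𝟙 · A ≋ A
  ·-identityˡ A i j = sum-𝟙* (λ h → A h j) i

  ·-identityʳ : ∀ {k l} (A : Matrix k l) → A · 𝟙 ≋ A
  ·-identityʳ A i j = sum-*𝟙 (A i) j

  ·-assoc : ∀ {k l p r} (A : Matrix k l) (B : Matrix l p) (C : Matrix p r) →
            A · B · C ≋ A · (B · C)
  ·-assoc {k} {l} {p} A B C i j = begin
    ∑[ h < p ] (∑[ g < l ] (A i g * B g h) * C h j)
      ≈⟨ sum-cong (λ h → *-distribʳ-sum (C h j) (λ g → A i g * B g h)) ⟩
    ∑[ h < p ] ∑[ g < l ] (A i g * B g h * C h j)
      ≈⟨ ∑-comm (λ h g → A i g * B g h * C h j) ⟩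
    ∑[ g < l ] ∑[ h < p ] (A i g * B g h * C h j)
      ≈⟨ sum-cong (λ g → sum-cong {p} (λ h → *-assoc (A i g) (B g h) (C h j))) ⟩
    ∑[ g < l ] ∑[ h < p ] (A i g * (B g h * C h j))
      ≈⟨ sum-cong (λ g → ≈-sym (*-distribˡ-sum (A i g) (λ h → B g h * C h j))) ⟩
    ∑[ g < l ] (A i g * ∑[ h < p ] (B g h * C h j)) ∎

  ·-ᵀ : ∀ {k l p} (A : Matrix k l) (B : Matrix l p) → (A · B) ᵀ ≋ (B ᵀ) · (A ᵀ)
  ·-ᵀ A B i j = sum-cong (λ h → *-comm (A j h) (B h i))

  𝟙-ᵀ : ∀ {k} → 𝟙 {k} ᵀ ≋ 𝟙
  𝟙-ᵀ zero    zero    = ≈-refl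
  𝟙-ᵀ zero    (suc j) = ≈-refl
  𝟙-ᵀ (suc i) zero    = ≈-refl
  𝟙-ᵀ (suc i) (suc j) = 𝟙-ᵀ i j

  record Invertible {k} (U : Matrix k k) : Set (a ⊔ˡ ℓ) where
    field
      inverse  : Matrix k k
      inverseˡ : inverse · U ≋ 𝟙
      inverseʳ : U · inverse ≋ 𝟙

  open Invertible

  𝟙-invertible : ∀ {k} → Invertible (𝟙 {k})
  𝟙-invertible .inverse  = 𝟙
  𝟙-invertible .inverseˡ = ·-identityˡ 𝟙
  𝟙-invertible .inverseʳ = ·-identityˡ 𝟙

  private
    cancel : ∀ {k} {U U′ W W′ : Matrix k k} → U · U′ ≋ 𝟙 → W · W′ ≋ 𝟙 → (U · W) · (W′ · U′) ≋ 𝟙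
    cancel {U = U} {U′} {W} {W′} p q =
      ≋-trans (·-assoc U W (W′ · U′))
      (≋-trans (·-cong (≋-refl {A = U})
        (≋-trans (≋-sym (·-assoc W W′ U′)) (≋-trans (·-cong q (≋-refl {A = U′})) (·-identityˡ U′)))) p)

  ·-invertible : ∀ {k} {U W : Matrix k k} → Invertible U → Invertible W → Invertible (U · W)
  ·-invertible u w .inverse  = inverse w · inverse u
  ·-invertible u w .inverseˡ = cancel (inverseˡ w) (inverseˡ u)
  ·-invertible u w .inverseʳ = cancel (inverseʳ u) (inverseʳ w)

  ᵀ-invertible : ∀ {k} {U : Matrix k k} → Invertible U → Invertible (U ᵀ)
  ᵀ-invertible u .inverse = inverse u ᵀ
  ᵀ-invertible {U = U} u .inverseˡ =
    ≋-trans (≋-sym (·-ᵀ U (inverse u))) (≋-trans (λ i j → inverseʳ u j i) 𝟙-ᵀ)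
  ᵀ-invertible {U = U} u .inverseʳ =
    ≋-trans (≋-sym (·-ᵀ (inverse u) U)) (≋-trans (λ i j → inverseˡ u j i) 𝟙-ᵀ)

  infix 4 _~_
  record _~_ {k l} (A B : Matrix k l) : Set (a ⊔ˡ ℓ) where
    constructor equivalence
    field
      {left}           : Matrix k k
      {right}          : Matrix l l
      left-invertible  : Invertible left
      right-invertible : Invertible right
      left·A·right     : left · A · right ≋ B

  ~-trans : ∀ {k l} {A B C : Matrix k l} → A ~ B → B ~ C → A ~ C
  ~-trans {A = A} {B} {C} (equivalence {U} {V} u v p) (equivalence {U′} {V′} u′ v′ q) =
    equivalence (·-invertible u′ u) (·-invertible v v′)
    (≋-trans (≋-sym (·-assoc (U′ · U · A) V V′))
    (≋-trans (·-cong (≋-trans (·-cong (·-assoc U′ U A) (≋-refl {A = V}))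
                     (≋-trans (·-assoc U′ (U · A) V) (·-cong (≋-refl {A = U′}) p)))
                     (≋-refl {A = V′})) q))

  ~-ᵀ : ∀ {k l} {A B : Matrix k l} → A ~ B → (A ᵀ) ~ (B ᵀ)
  ~-ᵀ {A = A} (equivalence {U} {V} u v p) =
    equivalence (ᵀ-invertible v) (ᵀ-invertible u)
    (≋-trans (·-assoc (V ᵀ) (A ᵀ) (U ᵀ))
    (≋-trans (·-cong (≋-refl {A = V ᵀ}) (≋-sym (·-ᵀ U A)))
    (≋-trans (≋-sym (·-ᵀ (U · A) V)) (λ i j → p j i))))

  ~-left : ∀ {k l} {U : Matrix k k} (A : Matrix k l) → Invertible U → A ~ U · A
  ~-left {U = U} A u = equivalence u 𝟙-invertible (·-identityʳ (U · A))

  ~-≋ : ∀ {k l} {A B : Matrix k l} → A ≋ B → A ~ B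
  ~-≋ {A = A} p = equivalence 𝟙-invertible 𝟙-invertible
    (≋-trans (·-identityʳ (𝟙 · A)) (≋-trans (·-identityˡ A) p))

  addToRows : ∀ {k} → Vector Carrier k → Matrix (suc k) (suc k)
  addToRows c zero    j       = 𝟙 zero j
  addToRows c (suc i) zero    = c i
  addToRows c (suc i) (suc j) = 𝟙 i j

  addToFirst : ∀ {k} → Vector Carrier k → Matrix (suc k) (suc k)
  addToFirst r = (addToRows r) ᵀ

  infixr 6 _⊞_
  _⊞_ : ∀ {k l} → Carrier → Matrix k l → Matrix (suc k) (suc l)
  (x ⊞ A) zero    zero    = x
  (x ⊞ A) zero    (suc j) = 0#
  (x ⊞ A) (suc i) zero    = 0#
  (x ⊞ A) (suc i) (suc j) = A i j

  addToRows-zero : ∀ {k l} c (A : Matrix (suc k) l) j → (addToRows c · A) zero j ≈ A zero j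
  addToRows-zero c A j = sum-𝟙* (λ h → A h j) zero

  addToRows-suc : ∀ {k l} c (A : Matrix (suc k) l) i j →
                  (addToRows c · A) (suc i) j ≈ c i * A zero j + A (suc i) j
  addToRows-suc c A i j = +-congˡ (sum-𝟙* (λ h → A (suc h) j) i)

  addToFirst-zero : ∀ {k l} r (A : Matrix (suc k) l) j →
                    (addToFirst r · A) zero j ≈ A zero j + ∑[ h < k ] (r h * A (suc h) j)
  addToFirst-zero r A j = +-congʳ (*-identityˡ _)

  addToRows-invertible : ∀ {k} (c : Vector Carrier k) → Invertible (addToRows c)
  addToRows-invertible c = record
    { inverse  = addToRows (λ i → - c i)
    ; inverseˡ = λ where
        zero    j       → addToRows-zero (λ h → - c h) (addToRows c) j
        (suc i) zero    → ≈-trans (addToRows-suc (λ h → - c h) (addToRows c) i zero)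
                            (≈-trans (+-congʳ (*-identityʳ _)) (-‿inverseˡ (c i)))
        (suc i) (suc j) → ≈-trans (addToRows-suc (λ h → - c h) (addToRows c) i (suc j))
                            (≈-trans (+-congʳ (zeroʳ _)) (+-identityˡ _))
    ; inverseʳ = λ where
        zero    j       → addToRows-zero c (addToRows (λ i → - c i)) j
        (suc i) zero    → ≈-trans (addToRows-suc c (addToRows (λ i → - c i)) i zero)
                            (≈-trans (+-congʳ (*-identityʳ _)) (-‿inverseʳ (c i)))
        (suc i) (suc j) → ≈-trans (addToRows-suc c (addToRows (λ i → - c i)) i (suc j))
                            (≈-trans (+-congʳ (zeroʳ _)) (+-identityˡ _))
    }

  ⊞-· : ∀ {k l p} x y (A : Matrix k l) (B : Matrix l p) → (x ⊞ A) · (y ⊞ B) ≋ (x * y ⊞ A · B)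
  ⊞-· x y A B zero    zero    = ≈-trans (+-congˡ (sum-0* (λ h → (y ⊞ B) (suc h) zero))) (+-identityʳ _)
  ⊞-· x y A B zero    (suc j) = ≈-trans (+-cong (zeroʳ x) (sum-0* (λ h → B h j))) (+-identityʳ _)
  ⊞-· x y A B (suc i) zero    = ≈-trans (+-cong (zeroˡ y) (sum-*0 (A i))) (+-identityʳ _)
  ⊞-· x y A B (suc i) (suc j) = ≈-trans (+-congʳ (zeroˡ _)) (+-identityˡ _)

  ⊞-cong : ∀ {k l} {x y} {A B : Matrix k l} → x ≈ y → A ≋ B → (x ⊞ A) ≋ (y ⊞ B)
  ⊞-cong p q zero    zero    = p
  ⊞-cong p q zero    (suc j) = ≈-refl
  ⊞-cong p q (suc i) zero    = ≈-refl
  ⊞-cong p q (suc i) (suc j) = q i j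

  ⊞-𝟙 : ∀ {k} → (1# ⊞ 𝟙 {k}) ≋ 𝟙
  ⊞-𝟙 zero    zero    = ≈-refl
  ⊞-𝟙 zero    (suc j) = ≈-refl
  ⊞-𝟙 (suc i) zero    = ≈-refl
  ⊞-𝟙 (suc i) (suc j) = ≈-refl

  ⊞-invertible : ∀ {k} {x} {U : Matrix k k} → x * x ≈ 1# → Invertible U → Invertible (x ⊞ U)
  ⊞-invertible {x = x} {U} p u = record
    { inverse  = x ⊞ inverse u
    ; inverseˡ = ≋-trans (⊞-· x x (inverse u) U) (≋-trans (⊞-cong p (inverseˡ u)) ⊞-𝟙)
    ; inverseʳ = ≋-trans (⊞-· x x U (inverse u)) (≋-trans (⊞-cong p (inverseʳ u)) ⊞-𝟙)
    }

private

    search : ∀ {k p} {P : Fin k → Set p} → (∀ i → Dec (P i)) → (∃ λ i → ¬ P i) ⊎ (∀ i → P i)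
    search P? with any? (λ i → ¬? (P? i))
    ... | yes w = inj₁ w
    ... | no ¬w = inj₂ (λ i → decidable-stable (P? i) (λ ¬p → ¬w (i , ¬p)))

    search₂ : ∀ {k l p} {P : Fin k → Fin l → Set p} → (∀ i j → Dec (P i j)) →
              (∃ λ i → ∃ λ j → ¬ P i j) ⊎ (∀ i j → P i j)
    search₂ P? with any? (λ i → any? (λ j → ¬? (P? i j)))
    ... | yes w = inj₁ w
    ... | no ¬w = inj₂ (λ i j → decidable-stable (P? i j) (λ ¬p → ¬w (i , j , ¬p)))

module Integral = LinearAlgebra ℤ.+-*-commutativeRing

module _ where

  open Integral

  -- Entries are indexed from the top left corner; those not on the diagonal, or past the end of
  -- the list, are zero.
  diagonal : ∀ {k l} → List ℕ → Matrix k l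
  diagonal []       i       j       = 0ℤ
  diagonal (d ∷ ds) zero    zero    = + d
  diagonal (d ∷ ds) zero    (suc j) = 0ℤ
  diagonal (d ∷ ds) (suc i) zero    = 0ℤ
  diagonal (d ∷ ds) (suc i) (suc j) = diagonal ds i j

  record SmithNormalForm {k l} (N : Matrix k l) : Set where
    field
      factors    : List ℕ
      positive   : All (0 ℕ.<_) factors
      chain      : Linked ℕ∣._∣_ factors
      ≤rows      : length factors ℕ.≤ k
      ≤columns   : length factors ℕ.≤ l
      equivalent : N ~ diagonal factors

  private

    Divides : ∀ {k l} → ℤ → Matrix k l → Set
    Divides p A = ∀ i j → p ℤ∣.∣ A i j

    ∣-sum : ∀ {p} k {f : Fin k → ℤ} → (∀ i → p ℤ∣.∣ f i) →
            p ℤ∣.∣ Algebra.Properties.Semiring.Sum.sum ℤ.+-*-semiring f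
    ∣-sum {p} zero    h = ℤ∣.divides 0ℤ (sym (ℤ.*-zeroˡ p))
    ∣-sum     (suc k) h = ℤ∣.∣m∣n⇒∣m+n (h zero) (∣-sum k (λ i → h (suc i)))

    Divides-~ : ∀ {k l p} {A B : Matrix k l} → A ~ B → Divides p A → Divides p B
    Divides-~ {k} {l} {p} {A} (equivalence {U} {V} _ _ e) h i j =
      subst (p ℤ∣.∣_) (e i j) (∣-sum l (λ g → ℤ∣.∣m⇒∣m*n (V g j) (∣-sum k (λ g′ → ℤ∣.∣n⇒∣m*n (U i g′) (h g′ g)))))

    Shrunk : ∀ {k l} → Matrix (suc k) (suc l) → Set
    Shrunk A = ∃[ B ] (A ~ B × B zero zero ≢ 0ℤ × ℤ.∣ B zero zero ∣ ℕ.< ℤ.∣ A zero zero ∣)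

    shrink-column : ∀ {k l} (A : Matrix (suc k) (suc l)) → A zero zero ≢ 0ℤ → ∀ i →
                    ¬ (A zero zero ℤ∣.∣ A (suc i) zero) → Shrunk A
    shrink-column {k} A a≢0 i ∤ =
      B , ~-trans (~-left A (addToRows-invertible c)) (~-left A′ (ᵀ-invertible (addToRows-invertible (𝟙 i)))) ,
      (λ B≡0 → ∤ (ℤ∣.divides q (trans x≡ (trans (cong (ℤ._+ q ℤ.* a) (trans (sym B≡s) B≡0)) (ℤ.+-identityˡ _))))) ,
      subst (λ z → ℤ.∣ z ∣ ℕ.< ℤ.∣ a ∣) (sym B≡s) (n%d<d x a)
      where
      a = A zero zero
      x = A (suc i) zero
      instance
        _ : ℤ.NonZero a
        _ = ℤ.≢-nonZero a≢0
      q = x ℤ./ a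
      s = + (x ℤ.% a)
      x≡ : x ≡ s ℤ.+ q ℤ.* a
      x≡ = a≡a%n+[a/n]*n x a
      c : Fin k → ℤ
      c _ = ℤ.- (ℤ.1ℤ ℤ.+ q)
      A′ = addToRows c · A
      B = addToFirst (𝟙 i) · A′
      B≡s : B zero zero ≡ s
      B≡s = begin
        B zero zero
          ≡⟨ addToFirst-zero (𝟙 i) A′ zero ⟩
        A′ zero zero ℤ.+ Algebra.Properties.Semiring.Sum.sum ℤ.+-*-semiring (λ h → 𝟙 i h ℤ.* A′ (suc h) zero)
          ≡⟨ cong₂ ℤ._+_ (addToRows-zero c A zero) (trans (sum-𝟙* (λ h → A′ (suc h) zero) i) (addToRows-suc c A i zero)) ⟩
        a ℤ.+ (ℤ.- (ℤ.1ℤ ℤ.+ q) ℤ.* a ℤ.+ x)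
          ≡⟨ cong (λ z → a ℤ.+ (ℤ.- (ℤ.1ℤ ℤ.+ q) ℤ.* a ℤ.+ z)) x≡ ⟩
        a ℤ.+ (ℤ.- (ℤ.1ℤ ℤ.+ q) ℤ.* a ℤ.+ (s ℤ.+ q ℤ.* a))
          ≡⟨ solve 3 (λ a q s → a :+ (:- (con ℤ.1ℤ :+ q) :* a :+ (s :+ q :* a)) := s) refl a q s ⟩
        s ∎
        where
        open ≡-Reasoning
        open Data.Integer.Solver.+-*-Solver

    shrink-row : ∀ {k l} (A : Matrix (suc k) (suc l)) → A zero zero ≢ 0ℤ → ∀ j →
                 ¬ (A zero zero ℤ∣.∣ A zero (suc j)) → Shrunk A
    shrink-row A a≢0 j ∤ =
      let B , A~B , r = shrink-column (A ᵀ) a≢0 j ∤ in B ᵀ , ~-ᵀ A~B , r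

    Pivoted : ∀ {k l} → Matrix (suc k) (suc l) → Set
    Pivoted {k} {l} A = Σ ℕ λ p → Σ (Matrix k l) λ A′ → 0 ℕ.< p × Divides (+ p) A′ × A ~ (+ p ⊞ A′)

    Pivoted-~ : ∀ {k l} {A B : Matrix (suc k) (suc l)} → A ~ B → Pivoted B → Pivoted A
    Pivoted-~ e (p , A′ , p>0 , h , e′) = p , A′ , p>0 , h , ~-trans e e′

    clear : ∀ {k l} (A : Matrix (suc k) (suc l)) →
            (∀ i → A zero zero ℤ∣.∣ A (suc i) zero) →
            ∃[ B ] (A ~ B × (∀ j → B zero j ≡ A zero j) × (∀ i → B (suc i) zero ≡ 0ℤ))
    clear A h = addToRows c · A , ~-left A (addToRows-invertible c) , addToRows-zero c A , λ i →
      trans (addToRows-suc c A i zero)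
      (trans (cong₂ ℤ._+_ (sym (ℤ.neg-distribˡ-* (ℤ∣.quotient (h i)) _)) (ℤ∣._∣_.equality (h i)))
             (ℤ.+-inverseˡ (ℤ∣.quotient (h i) ℤ.* A zero zero)))
      where
      c : Fin _ → ℤ
      c i = ℤ.- ℤ∣.quotient (h i)

    clear-all : ∀ {k l} (A : Matrix (suc k) (suc l)) →
                (∀ i → A zero zero ℤ∣.∣ A (suc i) zero) → (∀ j → A zero zero ℤ∣.∣ A zero (suc j)) →
                ∃[ A′ ] (A ~ (A zero zero ⊞ A′))
    clear-all A h h′ with clear A h
    ... | B , A~B , B0 , Bi with clear (B ᵀ) (λ j → subst₂ (sym (B0 zero)) (sym (B0 (suc j))) (h′ j))
      where
      subst₂ : ∀ {x x′ y y′} → x ≡ x′ → y ≡ y′ → x ℤ∣.∣ y → x′ ℤ∣.∣ y′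
      subst₂ refl refl d = d
    ... | C , B~C , C0 , Ci = (λ i j → C (suc j) (suc i)) , ~-trans A~B (~-trans (~-ᵀ B~C) (~-≋ λ where
      zero    zero    → trans (C0 zero) (B0 zero)
      zero    (suc j) → Ci j
      (suc i) zero    → trans (C0 (suc i)) (Bi i)
      (suc i) (suc j) → refl))

    normalise-sign : ∀ {k l} a (A : Matrix k l) → a ≢ 0ℤ → Divides a A → Pivoted (a ⊞ A)
    normalise-sign (+ zero)  A a≢0 h = contradiction refl a≢0
    normalise-sign (+ suc n) A a≢0 h = suc n , A , s≤s z≤n , h , ~-≋ ≋-refl
    normalise-sign -[1+ n ]  A a≢0 h = suc n , A , s≤s z≤n , (λ i j → ℤ∣.∣-trans (ℤ∣.∣m∣∣m { -[1+ n ]}) (h i j)) ,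
      ~-trans (~-left (-[1+ n ] ⊞ A) (⊞-invertible { x = -1ℤ} refl 𝟙-invertible))
      (~-≋ (≋-trans (⊞-· -1ℤ -[1+ n ] 𝟙 A)
        (⊞-cong (ℤ.-1*i≡-i -[1+ n ]) (·-identityˡ A))))

    shrink-inner : ∀ {k l} a (A : Matrix k l) → a ≢ 0ℤ → ∀ i j → ¬ (a ℤ∣.∣ A i j) → Shrunk (a ⊞ A)
    shrink-inner a A a≢0 i j ∤ =
      let B , E~B , B≢0 , lt = shrink-row E (λ e → a≢0 (trans (sym E00) e)) j
                                 (λ d → ∤ (subst (a ℤ∣.∣_) E0j (subst (ℤ∣._∣ E zero (suc j)) E00 d)))
      in B , ~-trans (~-left D (ᵀ-invertible (addToRows-invertible (𝟙 i)))) E~B , B≢0 ,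
         subst (λ z → ℤ.∣ B zero zero ∣ ℕ.< ℤ.∣ z ∣) E00 lt
      where
      D = a ⊞ A
      E = addToFirst (𝟙 i) · D
      E00 : E zero zero ≡ a
      E00 = trans (addToFirst-zero (𝟙 i) D zero)
            (trans (cong (ℤ._+_ a) (sum-𝟙* (λ h → D (suc h) zero) i)) (ℤ.+-identityʳ a))
      E0j : E zero (suc j) ≡ A i j
      E0j = trans (addToFirst-zero (𝟙 i) D (suc j))
            (trans (cong (ℤ._+_ 0ℤ) (sum-𝟙* (λ h → D (suc h) (suc j)) i)) (ℤ.+-identityˡ (A i j)))

    step-inner : ∀ {k l} (A : Matrix (suc k) (suc l)) → A zero zero ≢ 0ℤ →
                 ∃[ A′ ] (A ~ (A zero zero ⊞ A′)) → Shrunk A ⊎ Pivoted A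
    step-inner A a≢0 (A′ , A~) with search₂ (λ i j → A zero zero ℤ∣.∣? A′ i j)
    ... | inj₂ h = inj₂ (Pivoted-~ A~ (normalise-sign (A zero zero) A′ a≢0 h))
    ... | inj₁ (i , j , ∤) =
      let B , e , r = shrink-inner (A zero zero) A′ a≢0 i j ∤ in inj₁ (B , ~-trans A~ e , r)

    step : ∀ {k l} (A : Matrix (suc k) (suc l)) → A zero zero ≢ 0ℤ → Shrunk A ⊎ Pivoted A
    step A a≢0 with search (λ i → A zero zero ℤ∣.∣? A (suc i) zero) | search (λ j → A zero zero ℤ∣.∣? A zero (suc j))
    ... | inj₁ (i , ∤) | _            = inj₁ (shrink-column A a≢0 i ∤)
    ... | inj₂ _       | inj₁ (j , ∤) = inj₁ (shrink-row A a≢0 j ∤)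
    ... | inj₂ h       | inj₂ h′      = step-inner A a≢0 (clear-all A h h′)

    pivot : ∀ {k l} (A : Matrix (suc k) (suc l)) → A zero zero ≢ 0ℤ → Acc ℕ._<_ ℤ.∣ A zero zero ∣ → Pivoted A
    pivot A a≢0 (acc rec) with step A a≢0
    ... | inj₁ (B , A~B , B≢0 , lt) = Pivoted-~ A~B (pivot B B≢0 (rec lt))
    ... | inj₂ done                 = done

    pull-up : ∀ {k l} (A : Matrix (suc k) (suc l)) i → (A zero zero ≡ 0ℤ) → A (suc i) zero ≢ 0ℤ → Pivoted A
    pull-up A i a≡0 x≢0 = Pivoted-~ (~-left A (ᵀ-invertible (addToRows-invertible (𝟙 i))))
      (pivot B (λ e → x≢0 (trans (sym B≡x) e)) (<-wellFounded _))
      where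
      B = addToFirst (𝟙 i) · A
      B≡x : B zero zero ≡ A (suc i) zero
      B≡x = trans (addToFirst-zero (𝟙 i) A zero)
            (trans (cong₂ ℤ._+_ a≡0 (sum-𝟙* (λ h → A (suc h) zero) i)) (ℤ.+-identityˡ _))

    Pivoted-ᵀ : ∀ {k l} (A : Matrix (suc k) (suc l)) → Pivoted (A ᵀ) → Pivoted A
    Pivoted-ᵀ A (p , A′ , p>0 , h , e) = p , A′ ᵀ , p>0 , (λ i j → h j i) , ~-trans (~-ᵀ e) (~-≋ λ where
      zero    zero    → refl
      zero    (suc j) → refl
      (suc i) zero    → refl
      (suc i) (suc j) → refl)

    pull-up-inner : ∀ {k l} (A : Matrix (suc k) (suc l)) i j → A zero zero ≡ 0ℤ →
                    A (suc i) zero ≡ 0ℤ → A zero (suc j) ≡ 0ℤ → A (suc i) (suc j) ≢ 0ℤ → Pivoted A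
    pull-up-inner A i j a≡0 Ai0 A0j x≢0 = Pivoted-~ (~-left A (ᵀ-invertible (addToRows-invertible (𝟙 i))))
      (Pivoted-ᵀ B (pull-up (B ᵀ) j (trans (B0 zero) (cong₂ ℤ._+_ a≡0 Ai0))
        (λ e → x≢0 (trans (sym (trans (B0 (suc j)) (trans (cong (ℤ._+ A (suc i) (suc j)) A0j) (ℤ.+-identityˡ _)))) e))))
      where
      B = addToFirst (𝟙 i) · A
      B0 : ∀ g → B zero g ≡ A zero g ℤ.+ A (suc i) g
      B0 g = trans (addToFirst-zero (𝟙 i) A g) (cong (ℤ._+_ (A zero g)) (sum-𝟙* (λ h → A (suc h) g) i))

    pivot-or-zero : ∀ {k l} (A : Matrix (suc k) (suc l)) → (∀ i j → A i j ≡ 0ℤ) ⊎ Pivoted A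
    pivot-or-zero A with A zero zero ℤ.≟ 0ℤ | search (λ i → A (suc i) zero ℤ.≟ 0ℤ)
                       | search (λ j → A zero (suc j) ℤ.≟ 0ℤ) | search₂ (λ i j → A (suc i) (suc j) ℤ.≟ 0ℤ)
    ... | no a≢0  | _              | _              | _                  = inj₂ (pivot A a≢0 (<-wellFounded _))
    ... | yes a≡0 | inj₁ (i , x≢0) | _              | _                  = inj₂ (pull-up A i a≡0 x≢0)
    ... | yes a≡0 | inj₂ _         | inj₁ (j , x≢0) | _                  = inj₂ (Pivoted-ᵀ A (pull-up (A ᵀ) j a≡0 x≢0))
    ... | yes a≡0 | inj₂ h         | inj₂ h′        | inj₁ (i , j , x≢0) = inj₂ (pull-up-inner A i j a≡0 (h i) (h′ j) x≢0)
    ... | yes a≡0 | inj₂ h         | inj₂ h′        | inj₂ h″            = inj₁ λ where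
      zero    zero    → a≡0
      zero    (suc j) → h′ j
      (suc i) zero    → h i
      (suc i) (suc j) → h″ i j

    ⊞-~ : ∀ {k l} p {A B : Matrix k l} → A ~ B → (p ⊞ A) ~ (p ⊞ B)
    ⊞-~ p {A} (equivalence {U} {V} u v e) = equivalence (⊞-invertible refl u) (⊞-invertible refl v)
      (≋-trans (·-cong (⊞-· ℤ.1ℤ p U A) (≋-refl {A = ℤ.1ℤ ⊞ V}))
      (≋-trans (⊞-· (ℤ.1ℤ ℤ.* p) ℤ.1ℤ (U · A) V)
        (⊞-cong (trans (ℤ.*-identityʳ _) (ℤ.*-identityˡ p)) e)))

    zero-form : ∀ {k l} {A : Matrix k l} → (∀ i j → A i j ≡ 0ℤ) → SmithNormalForm A
    zero-form h = record { factors = [] ; positive = [] ; chain = [] ; ≤rows = z≤n ; ≤columns = z≤n ; equivalent = ~-≋ h }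

    prepend : ∀ {k l p ds} {A : Matrix k l} → Divides (+ p) A → length ds ℕ.≤ k → length ds ℕ.≤ l → A ~ diagonal ds →
              Linked ℕ∣._∣_ ds → Linked ℕ∣._∣_ (p ∷ ds)
    prepend {ds = []}     h _       _       e []    = [-]
    prepend {ds = d ∷ ds} h (s≤s _) (s≤s _) e chain = ℤ∣.∣⇒∣ᵤ (Divides-~ e h zero zero) ∷ chain

  abstract
    smithNormalForm : ∀ {k l} (N : Matrix k l) → SmithNormalForm N
    smithNormalForm {zero}          N = zero-form λ ()
    smithNormalForm {suc k} {zero}  N = zero-form λ _ ()
    smithNormalForm {suc k} {suc l} N with pivot-or-zero N
    ... | inj₁ h = zero-form h
    ... | inj₂ (p , A , p>0 , h , N~) = record
      { factors    = p ∷ factors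
      ; positive   = p>0 ∷ positive
      ; chain      = prepend h ≤rows ≤columns equivalent chain
      ; ≤rows      = s≤s ≤rows
      ; ≤columns   = s≤s ≤columns
      ; equivalent = ~-trans N~ (~-trans (⊞-~ (+ p) equivalent) (~-≋ λ where
          zero    zero    → refl
          zero    (suc j) → refl
          (suc i) zero    → refl
          (suc i) (suc j) → refl))
      }
      where open SmithNormalForm (smithNormalForm A)

  -- The value 0 is only taken on matrices of rank 0, which have no invariant factor.
  largestInvariantFactor : ∀ {k l} → Matrix k l → ℕ
  largestInvariantFactor N = fromMaybe 0 (List.last (SmithNormalForm.factors (smithNormalForm N)))

module Rational = LinearAlgebra ℚ.+-*-commutativeRing

module _ where

  open Rational

  private

    open Algebra.Properties.Semiring.Sum (CommutativeRing.semiring ℚ.+-*-commutativeRing)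
      using (sum; ∑-distrib-+; *-distribʳ-sum; *-distribˡ-sum)
    open Data.Rational.Solver.+-*-Solver
    open ≡-Reasoning

    pad : ∀ {d k} → Vector (Vector ℚ k) d → Vector (Vector ℚ (suc k)) d
    pad u j zero    = 0ℚ
    pad u j (suc i) = u j i

    span-pad : ∀ {l k d} (v : Vector (Vector ℚ (suc k)) l) → (∀ j → v j zero ≡ 0ℚ) →
               HasDimension (Span (λ j i → v j (suc i))) d → HasDimension (Span v) d
    span-pad v v0 (u , indep , span) = pad u , (λ c h → indep c (λ i → h (suc i))) , λ y → mk⇔
      (λ (c , e) → let c′ , e′ = Equivalence.to (span (λ i → y (suc i))) (c , λ i → e (suc i)) in c′ , λ where
        zero    → trans (e zero) (trans (sum-zero (vanish c)) (sym (sum-*0 c′)))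
        (suc i) → e′ i)
      (λ (c , e) → let c′ , e′ = Equivalence.from (span (λ i → y (suc i))) (c , λ i → e (suc i)) in c′ , λ where
        zero    → trans (e zero) (trans (sum-*0 c) (sym (sum-zero (vanish c′))))
        (suc i) → e′ i)
      where
      vanish : ∀ c j → c j ℚ.* v j zero ≡ 0ℚ
      vanish c j = trans (cong (c j ℚ.*_) (v0 j)) (ℚ.*-zeroʳ (c j))

    module Eliminate {l k} (v : Vector (Vector ℚ (suc k)) l) (p : Fin l) (h≢0 : v p zero ≢ 0ℚ) where

      instance
        _ : ℚ.NonZero (v p zero)
        _ = ℚ.≢-nonZero h≢0

      h = v p zero

      r : Vector ℚ l
      r j = v j zero ℚ.* ℚ.1/ h

      w : Vector (Vector ℚ k) l
      w j i = v j (suc i) ℚ.+ r j ℚ.* (ℚ.- v p (suc i))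

      head-combination : ∀ g → combination g v zero ≡ sum (λ j → g j ℚ.* r j) ℚ.* h
      head-combination g = begin
        sum (λ j → g j ℚ.* v j zero)   ≡⟨ sum-cong (λ j → trans (cong (g j ℚ.*_) (head j)) (sym (ℚ.*-assoc (g j) (r j) h))) ⟩
        sum (λ j → g j ℚ.* r j ℚ.* h)  ≡⟨ *-distribʳ-sum h (λ j → g j ℚ.* r j) ⟨
        sum (λ j → g j ℚ.* r j) ℚ.* h  ∎
        where
        head : ∀ j → v j zero ≡ r j ℚ.* h
        head j = sym (trans (ℚ.*-assoc (v j zero) (ℚ.1/ h) h)
                     (trans (cong (v j zero ℚ.*_) (ℚ.*-inverseˡ h)) (ℚ.*-identityʳ (v j zero))))

      tail-combination : ∀ g i → combination g w i ≡
                         combination g v (suc i) ℚ.+ sum (λ j → g j ℚ.* r j) ℚ.* (ℚ.- v p (suc i))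
      tail-combination g i = begin
        sum (λ j → g j ℚ.* w j i)
          ≡⟨ sum-cong (λ j → solve 4 (λ g a r b → g :* (a :+ r :* b) := g :* a :+ g :* r :* b)
                               refl (g j) (v j (suc i)) (r j) (ℚ.- v p (suc i))) ⟩
        sum (λ j → g j ℚ.* v j (suc i) ℚ.+ g j ℚ.* r j ℚ.* (ℚ.- v p (suc i)))
          ≡⟨ ∑-distrib-+ (λ j → g j ℚ.* v j (suc i)) (λ j → g j ℚ.* r j ℚ.* (ℚ.- v p (suc i))) ⟩
        combination g v (suc i) ℚ.+ sum (λ j → g j ℚ.* r j ℚ.* (ℚ.- v p (suc i)))
          ≡⟨ cong (combination g v (suc i) ℚ.+_) (*-distribʳ-sum (ℚ.- v p (suc i)) (λ j → g j ℚ.* r j)) ⟨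
        combination g v (suc i) ℚ.+ sum (λ j → g j ℚ.* r j) ℚ.* (ℚ.- v p (suc i)) ∎

      shift-combination : ∀ g t i → combination (λ j → g j ℚ.+ t ℚ.* 𝟙 p j) v i ≡
                          combination g v i ℚ.+ t ℚ.* v p i
      shift-combination g t i = begin
        sum (λ j → (g j ℚ.+ t ℚ.* 𝟙 p j) ℚ.* v j i)
          ≡⟨ sum-cong (λ j → solve 4 (λ g t δ a → (g :+ t :* δ) :* a := g :* a :+ t :* (δ :* a))
                               refl (g j) t (𝟙 p j) (v j i)) ⟩
        sum (λ j → g j ℚ.* v j i ℚ.+ t ℚ.* (𝟙 p j ℚ.* v j i))
          ≡⟨ ∑-distrib-+ (λ j → g j ℚ.* v j i) (λ j → t ℚ.* (𝟙 p j ℚ.* v j i)) ⟩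
        combination g v i ℚ.+ sum (λ j → t ℚ.* (𝟙 p j ℚ.* v j i))
          ≡⟨ cong (combination g v i ℚ.+_) (trans (sym (*-distribˡ-sum t (λ j → 𝟙 p j ℚ.* v j i)))
                                            (cong (t ℚ.*_) (sum-𝟙* (λ j → v j i) p))) ⟩
        combination g v i ℚ.+ t ℚ.* v p i ∎

      module _ {d} (u : Vector (Vector ℚ k) d) where

        basis : Vector (Vector ℚ (suc k)) (suc d)
        basis = v p Vector.∷ pad u

        basis-head : ∀ c → combination c basis zero ≡ c zero ℚ.* h
        basis-head c = trans (cong (c zero ℚ.* h ℚ.+_) (sum-*0 (λ j → c (suc j)))) (ℚ.+-identityʳ _)

        independent : LinearlyIndependent u → LinearlyIndependent basis
        independent indep c e = λ where
            zero    → c₀≡0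
            (suc j) → indep (λ j → c (suc j)) (λ i → trans (sym (drop i)) (e (suc i))) j
          where
          c₀≡0 : c zero ≡ 0ℚ
          c₀≡0 = begin
            c zero                       ≡⟨ ℚ.*-identityʳ (c zero) ⟨
            c zero ℚ.* 1ℚ                ≡⟨ cong (c zero ℚ.*_) (ℚ.*-inverseʳ h) ⟨
            c zero ℚ.* (h ℚ.* ℚ.1/ h)    ≡⟨ ℚ.*-assoc (c zero) h (ℚ.1/ h) ⟨
            c zero ℚ.* h ℚ.* ℚ.1/ h      ≡⟨ cong (ℚ._* ℚ.1/ h) (trans (sym (basis-head c)) (e zero)) ⟩
            0ℚ ℚ.* ℚ.1/ h                ≡⟨ ℚ.*-zeroˡ (ℚ.1/ h) ⟩
            0ℚ                           ∎
          drop : ∀ i → combination c basis (suc i) ≡ combination (λ j → c (suc j)) u i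
          drop i = trans (cong (ℚ._+ combination (λ j → c (suc j)) u i)
                           (trans (cong (ℚ._* v p (suc i)) c₀≡0) (ℚ.*-zeroˡ (v p (suc i)))))
                         (ℚ.+-identityˡ _)

        to : (∀ z → Span w z → Span u z) → ∀ y → Span v y → Span basis y
        to span y (g , e) with span (combination g w) (g , λ i → refl)
        ... | c , e′ = s Vector.∷ c , λ where
            zero    → trans (e zero) (trans (head-combination g) (sym (basis-head (s Vector.∷ c))))
            (suc i) → begin
              y (suc i)
                ≡⟨ e (suc i) ⟩
              combination g v (suc i)
                ≡⟨ solve 3 (λ x s b → x := s :* b :+ (x :+ s :* (:- b))) refl (combination g v (suc i)) s (v p (suc i)) ⟩
              s ℚ.* v p (suc i) ℚ.+ (combination g v (suc i) ℚ.+ s ℚ.* (ℚ.- v p (suc i)))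
                ≡⟨ cong (s ℚ.* v p (suc i) ℚ.+_) (trans (sym (tail-combination g i)) (e′ i)) ⟩
              s ℚ.* v p (suc i) ℚ.+ combination c u i ∎
          where s = sum (λ j → g j ℚ.* r j)

        from : (∀ z → Span u z → Span w z) → ∀ y → Span basis y → Span v y
        from span y (c , e) with span (combination (λ j → c (suc j)) u) ((λ j → c (suc j)) , λ i → refl)
        ... | g , e′ = (λ j → g j ℚ.+ t ℚ.* 𝟙 p j) , λ where
            zero    → begin
              y zero                        ≡⟨ trans (e zero) (basis-head c) ⟩
              c zero ℚ.* h                  ≡⟨ solve 3 (λ c s h → c :* h := s :* h :+ (c :+ :- s) :* h) refl (c zero) s h ⟩
              s ℚ.* h ℚ.+ t ℚ.* h           ≡⟨ cong (ℚ._+ t ℚ.* h) (head-combination g) ⟨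
              combination g v zero ℚ.+ t ℚ.* h ≡⟨ shift-combination g t zero ⟨
              combination (λ j → g j ℚ.+ t ℚ.* 𝟙 p j) v zero ∎
            (suc i) → begin
              y (suc i)
                ≡⟨ e (suc i) ⟩
              c zero ℚ.* v p (suc i) ℚ.+ combination (λ j → c (suc j)) u i
                ≡⟨ cong (c zero ℚ.* v p (suc i) ℚ.+_) (trans (e′ i) (tail-combination g i)) ⟩
              c zero ℚ.* v p (suc i) ℚ.+ (combination g v (suc i) ℚ.+ s ℚ.* (ℚ.- v p (suc i)))
                ≡⟨ solve 4 (λ c b x s → c :* b :+ (x :+ s :* (:- b)) := x :+ (c :+ :- s) :* b)
                     refl (c zero) (v p (suc i)) (combination g v (suc i)) s ⟩
              combination g v (suc i) ℚ.+ t ℚ.* v p (suc i)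
                ≡⟨ shift-combination g t (suc i) ⟨
              combination (λ j → g j ℚ.+ t ℚ.* 𝟙 p j) v (suc i) ∎
          where
          s = sum (λ j → g j ℚ.* r j)
          t = c zero ℚ.+ ℚ.- s

      result : ∀ {d} → HasDimension (Span w) d → HasDimension (Span v) (suc d)
      result (u , indep , span) = basis u , independent u indep , λ y → mk⇔
        (to u (λ z → Equivalence.to (span z)) y) (from u (λ z → Equivalence.from (span z)) y)

  abstract
    span-dimension : ∀ {l k} (v : Vector (Vector ℚ k) l) → ∃[ d ] HasDimension (Span v) d
    span-dimension {k = zero}  v = 0 , (λ ()) , (λ c h ()) , λ y → mk⇔
      (λ _ → (λ ()) , λ ()) (λ _ → (λ _ → 0ℚ) , λ ())
    span-dimension {k = suc k} v with search (λ j → v j zero ℚ.≟ 0ℚ)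
    ... | inj₂ v0 = let d , dim = span-dimension (λ j i → v j (suc i)) in d , span-pad v v0 dim
    ... | inj₁ (p , h≢0) = let d , dim = span-dimension (Eliminate.w v p h≢0) in suc d , Eliminate.result v p h≢0 dim

-- The dimension of the column space over ℚ.
rank : ∀ {k l} → Integral.Matrix k l → ℕ
rank N = proj₁ (span-dimension (λ j i → N i j ℚ./ 1))

record ℝ : Set where
  no-eta-equality
  field
    seq    : ℕ → ℚ
    cauchy : ∀ ε → 0ℚ ℚ.< ε → ∃[ N ] (∀ i j → N ℕ.≤ i → N ℕ.≤ j → ℚ.∣ seq i ℚ.- seq j ∣ ℚ.< ε)

open ℝ

infix 4 _≃_
record _≃_ (x y : ℝ) : Set where
  constructor mk≃
  field
    null : ∀ ε → 0ℚ ℚ.< ε → ∃[ N ] (∀ i → N ℕ.≤ i → ℚ.∣ seq x i ℚ.- seq y i ∣ ℚ.< ε)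

open _≃_

private

  module Estimates where

    open Data.Rational.Solver.+-*-Solver
    open ℚ.≤-Reasoning

    half : ∀ ε → 0ℚ ℚ.< ε → ∃[ δ ] (0ℚ ℚ.< δ × δ ℚ.+ δ ≡ ε)
    half ε ε>0 = ½ ℚ.* ε ,
      subst (ℚ._< ½ ℚ.* ε) (ℚ.*-zeroʳ ½) (ℚ.*-monoʳ-<-pos ½ ε>0) ,
      trans (sym (ℚ.*-distribʳ-+ ε ½ ½)) (ℚ.*-identityˡ ε)

    scale : ∀ ε B → 0ℚ ℚ.< ε → 0ℚ ℚ.< B → ∃[ δ ] (0ℚ ℚ.< δ × B ℚ.* δ ℚ.+ B ℚ.* δ ≡ ε)
    scale ε B ε>0 B>0 = let δ , δ>0 , e = half ε ε>0 in
      ℚ.1/ B ℚ.* δ ,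
      subst (ℚ._< ℚ.1/ B ℚ.* δ) (ℚ.*-zeroʳ (ℚ.1/ B)) (ℚ.*-monoʳ-<-pos (ℚ.1/ B) δ>0) ,
      trans (cong₂ ℚ._+_ (cancel δ) (cancel δ)) e
      where
      instance
        B-positive : ℚ.Positive B
        B-positive = ℚ.positive B>0
        B-nonZero : ℚ.NonZero B
        B-nonZero = ℚ.pos⇒nonZero B
        1/B-positive : ℚ.Positive (ℚ.1/ B)
        1/B-positive = ℚ.1/pos⇒pos B
      cancel : ∀ δ → B ℚ.* (ℚ.1/ B ℚ.* δ) ≡ δ
      cancel δ = trans (sym (ℚ.*-assoc B (ℚ.1/ B) δ)) (trans (cong (ℚ._* δ) (ℚ.*-inverseʳ B)) (ℚ.*-identityˡ δ))

    self-distance : ∀ a {ε} → 0ℚ ℚ.< ε → ℚ.∣ a ℚ.- a ∣ ℚ.< ε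
    self-distance a = subst (ℚ._< _) (sym (cong ℚ.∣_∣ (ℚ.+-inverseʳ a)))

    swap-distance : ∀ a b → ℚ.∣ a ℚ.- b ∣ ≡ ℚ.∣ b ℚ.- a ∣
    swap-distance a b = trans (cong ℚ.∣_∣ (solve 2 (λ a b → a :+ :- b := :- (b :+ :- a)) refl a b))
                              (ℚ.∣-p∣≡∣p∣ (b ℚ.- a))

    triangle : ∀ {a b c d e} {x} → x ≡ (a ℚ.- b) ℚ.+ (c ℚ.- d) →
               ℚ.∣ a ℚ.- b ∣ ℚ.< e → ℚ.∣ c ℚ.- d ∣ ℚ.< e → ℚ.∣ x ∣ ℚ.< e ℚ.+ e
    triangle {a} {b} {c} {d} {e} {x} x≡ p q = begin-strict
      ℚ.∣ x ∣                                   ≡⟨ cong ℚ.∣_∣ x≡ ⟩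
      ℚ.∣ (a ℚ.- b) ℚ.+ (c ℚ.- d) ∣             ≤⟨ ℚ.∣p+q∣≤∣p∣+∣q∣ (a ℚ.- b) (c ℚ.- d) ⟩
      ℚ.∣ a ℚ.- b ∣ ℚ.+ ℚ.∣ c ℚ.- d ∣           <⟨ ℚ.+-mono-< p q ⟩
      e ℚ.+ e                                   ∎

    +-distance : ∀ {a b c d e} → ℚ.∣ a ℚ.- b ∣ ℚ.< e → ℚ.∣ c ℚ.- d ∣ ℚ.< e →
                 ℚ.∣ (a ℚ.+ c) ℚ.- (b ℚ.+ d) ∣ ℚ.< e ℚ.+ e
    +-distance {a} {b} {c} {d} = triangle {a} {b} {c} {d}
      (solve 4 (λ a b c d → (a :+ c) :+ :- (b :+ d) := (a :+ :- b) :+ (c :+ :- d)) refl a b c d)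

    trans-distance : ∀ {a b c e} → ℚ.∣ a ℚ.- b ∣ ℚ.< e → ℚ.∣ b ℚ.- c ∣ ℚ.< e → ℚ.∣ a ℚ.- c ∣ ℚ.< e ℚ.+ e
    trans-distance {a} {b} {c} = triangle {a} {b} {b} {c}
      (solve 3 (λ a b c → a :+ :- c := (a :+ :- b) :+ (b :+ :- c)) refl a b c)

    neg-distance : ∀ {a b e} → ℚ.∣ a ℚ.- b ∣ ℚ.< e → ℚ.∣ (ℚ.- a) ℚ.- (ℚ.- b) ∣ ℚ.< e
    neg-distance {a} {b} {e} p = subst (ℚ._< e) (trans (swap-distance a b)
      (cong ℚ.∣_∣ (solve 2 (λ a b → b :+ :- a := :- a :+ :- (:- b)) refl a b))) p

    product : ∀ {x y B δ} → 0ℚ ℚ.< B → ℚ.∣ x ∣ ℚ.< B → ℚ.∣ y ∣ ℚ.< δ → ℚ.∣ x ℚ.* y ∣ ℚ.< B ℚ.* δ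
    product {x} {y} {B} {δ} B>0 p q = begin-strict
      ℚ.∣ x ℚ.* y ∣          ≡⟨ ℚ.∣p*q∣≡∣p∣*∣q∣ x y ⟩
      ℚ.∣ x ∣ ℚ.* ℚ.∣ y ∣    ≤⟨ ℚ.*-monoʳ-≤-nonNeg ℚ.∣ y ∣ {{ℚ.∣-∣-nonNeg y}} (ℚ.<⇒≤ p) ⟩
      B ℚ.* ℚ.∣ y ∣          <⟨ ℚ.*-monoʳ-<-pos B {{ℚ.positive B>0}} q ⟩
      B ℚ.* δ                ∎

    *-distance : ∀ {a b c d B δ} → 0ℚ ℚ.< B → ℚ.∣ a ∣ ℚ.< B → ℚ.∣ d ∣ ℚ.< B →
                 ℚ.∣ a ℚ.- b ∣ ℚ.< δ → ℚ.∣ c ℚ.- d ∣ ℚ.< δ → ℚ.∣ a ℚ.* c ℚ.- b ℚ.* d ∣ ℚ.< B ℚ.* δ ℚ.+ B ℚ.* δ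
    *-distance {a} {b} {c} {d} {B} {δ} B>0 aB dB p q = begin-strict
      ℚ.∣ a ℚ.* c ℚ.- b ℚ.* d ∣
        ≡⟨ cong ℚ.∣_∣ (solve 4 (λ a b c d → a :* c :+ :- (b :* d) := a :* (c :+ :- d) :+ d :* (a :+ :- b)) refl a b c d) ⟩
      ℚ.∣ a ℚ.* (c ℚ.- d) ℚ.+ d ℚ.* (a ℚ.- b) ∣
        ≤⟨ ℚ.∣p+q∣≤∣p∣+∣q∣ (a ℚ.* (c ℚ.- d)) (d ℚ.* (a ℚ.- b)) ⟩
      ℚ.∣ a ℚ.* (c ℚ.- d) ∣ ℚ.+ ℚ.∣ d ℚ.* (a ℚ.- b) ∣
        <⟨ ℚ.+-mono-< (product {a} B>0 aB q) (product {d} B>0 dB p) ⟩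
      B ℚ.* δ ℚ.+ B ℚ.* δ ∎

    0<1 : 0ℚ ℚ.< 1ℚ
    0<1 = ℚ.positive⁻¹ 1ℚ

    bounded : ∀ x → ∃[ B ] (0ℚ ℚ.< B × ∃[ N ] (∀ i → N ℕ.≤ i → ℚ.∣ seq x i ∣ ℚ.< B))
    bounded x = let N , close = cauchy x 1ℚ 0<1 in
      1ℚ ℚ.+ ℚ.∣ seq x N ∣ ,
      ℚ.+-mono-<-≤ {0ℚ} {1ℚ} {0ℚ} 0<1 (ℚ.0≤∣p∣ (seq x N)) ,
      N , λ i N≤i → begin-strict
        ℚ.∣ seq x i ∣
          ≡⟨ cong ℚ.∣_∣ (solve 2 (λ a b → a := (a :+ :- b) :+ b) refl (seq x i) (seq x N)) ⟩
        ℚ.∣ (seq x i ℚ.- seq x N) ℚ.+ seq x N ∣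
          ≤⟨ ℚ.∣p+q∣≤∣p∣+∣q∣ (seq x i ℚ.- seq x N) (seq x N) ⟩
        ℚ.∣ seq x i ℚ.- seq x N ∣ ℚ.+ ℚ.∣ seq x N ∣
          <⟨ ℚ.+-monoˡ-< ℚ.∣ seq x N ∣ (close i N N≤i ℕ.≤-refl) ⟩
        1ℚ ℚ.+ ℚ.∣ seq x N ∣ ∎

    commonly-bounded : ∀ x y → ∃[ B ] (0ℚ ℚ.< B × ∃[ N ] (∀ i → N ℕ.≤ i → ℚ.∣ seq x i ∣ ℚ.< B × ℚ.∣ seq y i ∣ ℚ.< B))
    commonly-bounded x y =
      let B , B>0 , M , p = bounded x
          C , C>0 , N , q = bounded y
      in B ℚ.+ C , ℚ.+-mono-< B>0 C>0 , M ⊔ N , λ i le →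
        ℚ.<-trans (p i (ℕ.m⊔n≤o⇒m≤o M N le)) (subst (ℚ._< B ℚ.+ C) (ℚ.+-identityʳ B) (ℚ.+-monoʳ-< B C>0)) ,
        ℚ.<-trans (q i (ℕ.m⊔n≤o⇒n≤o M N le)) (subst (ℚ._< B ℚ.+ C) (ℚ.+-identityˡ C) (ℚ.+-monoˡ-< C B>0))

  open Estimates

constant : ℚ → ℝ
constant a .seq _ = a
constant a .cauchy ε ε>0 = 0 , λ _ _ _ _ → self-distance a ε>0

infixl 6 _⊕_
infixl 7 _⊗_

_⊕_ : ℝ → ℝ → ℝ
(x ⊕ y) .seq i = seq x i ℚ.+ seq y i
(x ⊕ y) .cauchy ε ε>0 =
  let δ , δ>0 , e = half ε ε>0
      M , p = cauchy x δ δ>0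
      N , q = cauchy y δ δ>0
  in M ⊔ N , λ i j le le′ → subst (ℚ.∣ _ ∣ ℚ.<_) e
       (+-distance {seq x i} {seq x j} (p i j (ℕ.m⊔n≤o⇒m≤o M N le) (ℕ.m⊔n≤o⇒m≤o M N le′))
                   (q i j (ℕ.m⊔n≤o⇒n≤o M N le) (ℕ.m⊔n≤o⇒n≤o M N le′)))

⊖_ : ℝ → ℝ
(⊖ x) .seq i = ℚ.- seq x i
(⊖ x) .cauchy ε ε>0 = let N , p = cauchy x ε ε>0 in
  N , λ i j le le′ → neg-distance {seq x i} {seq x j} (p i j le le′)

_⊗_ : ℝ → ℝ → ℝ
(x ⊗ y) .seq i = seq x i ℚ.* seq y i
(x ⊗ y) .cauchy ε ε>0 =
  let B , B>0 , L , b = commonly-bounded x y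
      δ , δ>0 , e = scale ε B ε>0 B>0
      M , p = cauchy x δ δ>0
      N , q = cauchy y δ δ>0
  in L ⊔ (M ⊔ N) , λ i j le le′ →
       let leʳ  = ℕ.m⊔n≤o⇒n≤o L (M ⊔ N) le
           leʳ′ = ℕ.m⊔n≤o⇒n≤o L (M ⊔ N) le′
       in subst (ℚ.∣ _ ∣ ℚ.<_) e
         (*-distance {seq x i} {seq x j} {seq y i} B>0
           (proj₁ (b i (ℕ.m⊔n≤o⇒m≤o L (M ⊔ N) le))) (proj₂ (b j (ℕ.m⊔n≤o⇒m≤o L (M ⊔ N) le′)))
           (p i j (ℕ.m⊔n≤o⇒m≤o M N leʳ) (ℕ.m⊔n≤o⇒m≤o M N leʳ′))
           (q i j (ℕ.m⊔n≤o⇒n≤o M N leʳ) (ℕ.m⊔n≤o⇒n≤o M N leʳ′)))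

pointwise : ∀ {x y} → (∀ i → seq x i ≡ seq y i) → x ≃ y
pointwise {x} {y} h = mk≃ λ ε ε>0 → 0 , λ i _ →
  subst (λ z → ℚ.∣ seq x i ℚ.- z ∣ ℚ.< ε) (h i) (self-distance (seq x i) ε>0)

private

  ≃-refl : ∀ {x} → x ≃ x
  ≃-refl = pointwise λ _ → refl

  ≃-sym : ∀ {x y} → x ≃ y → y ≃ x
  ≃-sym {x} {y} (mk≃ h) = mk≃ λ ε ε>0 → let N , p = h ε ε>0 in
    N , λ i le → subst (ℚ._< ε) (swap-distance (seq x i) (seq y i)) (p i le)

  ≃-trans : ∀ {x y z} → x ≃ y → y ≃ z → x ≃ z
  ≃-trans {x} {y} {z} (mk≃ h) (mk≃ h′) = mk≃ λ ε ε>0 →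
    let δ , δ>0 , e = half ε ε>0
        M , p = h δ δ>0
        N , q = h′ δ δ>0
    in M ⊔ N , λ i le → subst (ℚ.∣ _ ∣ ℚ.<_) e
         (trans-distance {seq x i} {seq y i} (p i (ℕ.m⊔n≤o⇒m≤o M N le)) (q i (ℕ.m⊔n≤o⇒n≤o M N le)))

  ⊕-cong : ∀ {x x′ y y′} → x ≃ x′ → y ≃ y′ → x ⊕ y ≃ x′ ⊕ y′
  ⊕-cong {x} {x′} (mk≃ h) (mk≃ h′) = mk≃ λ ε ε>0 →
    let δ , δ>0 , e = half ε ε>0
        M , p = h δ δ>0
        N , q = h′ δ δ>0
    in M ⊔ N , λ i le → subst (ℚ.∣ _ ∣ ℚ.<_) e
         (+-distance {seq x i} {seq x′ i} (p i (ℕ.m⊔n≤o⇒m≤o M N le)) (q i (ℕ.m⊔n≤o⇒n≤o M N le)))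

  ⊖-cong : ∀ {x y} → x ≃ y → ⊖ x ≃ ⊖ y
  ⊖-cong {x} {y} (mk≃ h) = mk≃ λ ε ε>0 → let N , p = h ε ε>0 in
    N , λ i le → neg-distance {seq x i} {seq y i} (p i le)

  ⊗-cong : ∀ {x x′ y y′} → x ≃ x′ → y ≃ y′ → x ⊗ y ≃ x′ ⊗ y′
  ⊗-cong {x} {x′} {y} {y′} (mk≃ h) (mk≃ h′) = mk≃ λ ε ε>0 →
    let B , B>0 , L , b = commonly-bounded x y′
        δ , δ>0 , e = scale ε B ε>0 B>0
        M , p = h δ δ>0
        N , q = h′ δ δ>0
    in L ⊔ (M ⊔ N) , λ i le →
         let leʳ = ℕ.m⊔n≤o⇒n≤o L (M ⊔ N) le
             bx , by = b i (ℕ.m⊔n≤o⇒m≤o L (M ⊔ N) le)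
         in subst (ℚ.∣ _ ∣ ℚ.<_) e
           (*-distance {seq x i} {seq x′ i} {seq y i} B>0 bx by
             (p i (ℕ.m⊔n≤o⇒m≤o M N leʳ)) (q i (ℕ.m⊔n≤o⇒n≤o M N leʳ)))

  ⊕-assoc : ∀ x y z → (x ⊕ y) ⊕ z ≃ x ⊕ (y ⊕ z)
  ⊕-assoc x y z = pointwise λ i → ℚ.+-assoc (seq x i) (seq y i) (seq z i)

  ⊕-comm : ∀ x y → x ⊕ y ≃ y ⊕ x
  ⊕-comm x y = pointwise λ i → ℚ.+-comm (seq x i) (seq y i)

  ⊕-identityˡ : ∀ x → constant 0ℚ ⊕ x ≃ x
  ⊕-identityˡ x = pointwise λ i → ℚ.+-identityˡ (seq x i)

  ⊕-identityʳ : ∀ x → x ⊕ constant 0ℚ ≃ x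
  ⊕-identityʳ x = pointwise λ i → ℚ.+-identityʳ (seq x i)

  ⊕-inverseˡ : ∀ x → (⊖ x) ⊕ x ≃ constant 0ℚ
  ⊕-inverseˡ x = pointwise λ i → ℚ.+-inverseˡ (seq x i)

  ⊕-inverseʳ : ∀ x → x ⊕ (⊖ x) ≃ constant 0ℚ
  ⊕-inverseʳ x = pointwise λ i → ℚ.+-inverseʳ (seq x i)

  ⊗-assoc : ∀ x y z → (x ⊗ y) ⊗ z ≃ x ⊗ (y ⊗ z)
  ⊗-assoc x y z = pointwise λ i → ℚ.*-assoc (seq x i) (seq y i) (seq z i)

  ⊗-comm : ∀ x y → x ⊗ y ≃ y ⊗ x
  ⊗-comm x y = pointwise λ i → ℚ.*-comm (seq x i) (seq y i)

  ⊗-identityˡ : ∀ x → constant 1ℚ ⊗ x ≃ x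
  ⊗-identityˡ x = pointwise λ i → ℚ.*-identityˡ (seq x i)

  ⊗-identityʳ : ∀ x → x ⊗ constant 1ℚ ≃ x
  ⊗-identityʳ x = pointwise λ i → ℚ.*-identityʳ (seq x i)

  ⊗-distribˡ-⊕ : ∀ x y z → x ⊗ (y ⊕ z) ≃ (x ⊗ y) ⊕ (x ⊗ z)
  ⊗-distribˡ-⊕ x y z = pointwise λ i → ℚ.*-distribˡ-+ (seq x i) (seq y i) (seq z i)

  ⊗-distribʳ-⊕ : ∀ x y z → (y ⊕ z) ⊗ x ≃ (y ⊗ x) ⊕ (z ⊗ x)
  ⊗-distribʳ-⊕ x y z = pointwise λ i → ℚ.*-distribʳ-+ (seq x i) (seq y i) (seq z i)

ℝ-commutativeRing : CommutativeRing 0ℓ 0ℓ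
ℝ-commutativeRing = record
  { Carrier = ℝ
  ; _≈_ = _≃_
  ; _+_ = _⊕_
  ; _*_ = _⊗_
  ; -_ = ⊖_
  ; 0# = constant 0ℚ
  ; 1# = constant 1ℚ
  ; isCommutativeRing = record
    { isRing = record
      { +-isAbelianGroup = record
        { isGroup = record
          { isMonoid = record
            { isSemigroup = record
              { isMagma = record
                { isEquivalence = record { refl = ≃-refl ; sym = ≃-sym ; trans = ≃-trans }
                ; ∙-cong = ⊕-cong
                }
              ; assoc = ⊕-assoc
              }
            ; identity = ⊕-identityˡ , ⊕-identityʳ
            }
          ; inverse = ⊕-inverseˡ , ⊕-inverseʳ
          ; ⁻¹-cong = ⊖-cong
          }
        ; comm = ⊕-comm
        }
      ; *-cong = ⊗-cong
      ; *-assoc = ⊗-assoc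
      ; *-identity = ⊗-identityˡ , ⊗-identityʳ
      ; distrib = ⊗-distribˡ-⊕ , ⊗-distribʳ-⊕
      }
    ; *-comm = ⊗-comm
    }
  }

record Graph (n m : ℕ) : Set where
  field
    tail head : Fin m → Fin n

open Graph

module _ {n m : ℕ} (G : Graph n m) (T : Subset m) where

  Adjacent : Fin n → Fin n → Set
  Adjacent u v = ∃[ e ] (e ∈ T × tail G e ≡ u × head G e ≡ v)

  Connected : Fin n → Fin n → Set
  Connected = EqClosure Adjacent

  record Components : Set where
    field
      count      : ℕ
      component  : Fin n → Fin count
      surjective : ∀ k → ∃[ v ] component v ≡ k
      connected  : ∀ u v → component u ≡ component v ⇔ Connected u v

private

  merge : ∀ {k} (x y : Fin k) → ∃[ l ] Σ (Fin k → Fin l) λ π →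
          (∀ i → ∃[ z ] π z ≡ i) × π x ≡ π y ×
          (∀ z w → π z ≡ π w → z ≡ w ⊎ (z ≡ x × w ≡ y) ⊎ (z ≡ y × w ≡ x))
  merge {suc k} x y with y Fin.≟ x
  ... | yes y≡x = suc k , (λ z → z) , (λ i → i , refl) , sym y≡x , λ z w e → inj₁ e
  ... | no y≢x = k , (λ z → π z (y Fin.≟ z)) , surjective , glued , λ z w → injective z w (y Fin.≟ z) (y Fin.≟ w)
    where
    π : ∀ z → Dec (y ≡ z) → Fin k
    π z (yes _)  = punchOut y≢x
    π z (no y≢z) = punchOut y≢z
    π-no : ∀ z (d : Dec (y ≡ z)) (y≢z : y ≢ z) → π z d ≡ punchOut y≢z
    π-no z (yes e)   y≢z = contradiction e y≢z
    π-no z (no y≢z′) y≢z = punchOut-cong y refl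
    surjective : ∀ i → ∃[ z ] π z (y Fin.≟ z) ≡ i
    surjective i = punchIn y i ,
      trans (π-no (punchIn y i) (y Fin.≟ punchIn y i) (λ e → punchInᵢ≢i y i (sym e))) (punchOut-punchIn y)
    glued : π x (y Fin.≟ x) ≡ π y (y Fin.≟ y)
    glued with y Fin.≟ y
    ... | yes _  = π-no x (y Fin.≟ x) y≢x
    ... | no y≢y = contradiction refl y≢y
    injective : ∀ z w d d′ → π z d ≡ π w d′ → z ≡ w ⊎ (z ≡ x × w ≡ y) ⊎ (z ≡ y × w ≡ x)
    injective z w (yes p)  (yes q)  e = inj₁ (trans (sym p) q)
    injective z w (yes p)  (no y≢w) e = inj₂ (inj₂ (sym p , sym (punchOut-injective y≢x y≢w e)))
    injective z w (no y≢z) (yes q)  e = inj₂ (inj₁ (punchOut-injective y≢z y≢x e , sym q))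
    injective z w (no y≢z) (no y≢w) e = inj₁ (punchOut-injective y≢z y≢w e)

  module _ {n m : ℕ} (G : Graph n (suc m)) where

    delete-first : Graph n m
    delete-first .tail e = tail G (suc e)
    delete-first .head e = head G (suc e)

    grow : ∀ {s T u v} → Connected delete-first T u v → Connected G (s ∷ T) u v
    grow = EqClosure.map λ (e , e∈T , p , q) → suc e , there e∈T , p , q

    skip : ∀ {T} → Components delete-first T → Components G (outside ∷ T)
    skip {T} C = record { Components C hiding (connected) ; connected = λ u v → mk⇔
      (λ e → grow (Equivalence.to (connected u v) e))
      (λ c → Equivalence.from (connected u v) (EqClosure.map shrink c)) }
      where
      open Components C
      shrink : ∀ {u v} → Adjacent G (outside ∷ T) u v → Adjacent delete-first T u v
      shrink (suc e , there e∈T , p , q) = e , e∈T , p , q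

    join : ∀ {T} → Components delete-first T → Components G (inside ∷ T)
    join {T} C with merge (Components.component C (tail G zero)) (Components.component C (head G zero))
    ... | l , π , π-surjective , glued , π-injective = record
      { count      = l
      ; component  = component′
      ; surjective = λ i → let z , p = π-surjective i ; v , q = surjective z in v , trans (cong π q) p
      ; connected  = λ u v → mk⇔ (λ e → connect (π-injective _ _ e)) (λ c → EqClosure.gfold isEquivalence component′ same c)
      }
      where
      open Components C
      component′ : Fin n → Fin l
      component′ v = π (component v)
      path : ∀ u v → component u ≡ component v → Connected G (inside ∷ T) u v
      path u v e = grow (Equivalence.to (connected u v) e)
      edge : Connected G (inside ∷ T) (tail G zero) (head G zero)
      edge = EqClosure.return (zero , here , refl , refl)
      connect : ∀ {u v} →
        (component u ≡ component v ⊎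
         (component u ≡ component (tail G zero) × component v ≡ component (head G zero)) ⊎
         (component u ≡ component (head G zero) × component v ≡ component (tail G zero))) →
        Connected G (inside ∷ T) u v
      connect (inj₁ e)              = path _ _ e
      connect (inj₂ (inj₁ (p , q))) = path _ _ p ◅◅ (edge ◅◅ path _ _ (sym q))
      connect (inj₂ (inj₂ (p , q))) = path _ _ p ◅◅ (EqClosure.symmetric _ edge ◅◅ path _ _ (sym q))
      same : ∀ {u v} → Adjacent G (inside ∷ T) u v → component′ u ≡ component′ v
      same (zero  , here      , refl , refl) = glued
      same (suc e , there e∈T , p    , q)    =
        cong π (Equivalence.from (connected _ _) (EqClosure.return (e , e∈T , p , q)))

abstract
  components : ∀ {n m} (G : Graph n m) (T : Subset m) → Components G T
  components {n} {zero}  G []            = record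
    { count = n ; component = λ v → v ; surjective = λ v → v , refl
    ; connected = λ u v → mk⇔ (λ { refl → Star.ε }) (EqClosure.fold isEquivalence λ { (() , _) }) }
  components {n} {suc m} G (inside ∷ T)  = join G (components (delete-first G) T)
  components {n} {suc m} G (outside ∷ T) = skip G (components (delete-first G) T)

#components : ∀ {n m} → Graph n m → Subset m → ℕ
#components G T = Components.count (components G T)

-- The subtraction never truncates, as a spanning subgraph with edge set T has at least n − |T| components.
nullity : ∀ {n m} → Graph n m → Subset m → ℕ
nullity {n} G T = ∣ T ∣ ℕ.+ #components G T ∸ n

nullity-after-removing : ∀ {n m} → Graph n m → Subset m → ℕ
nullity-after-removing G S = nullity G (∁ S)

ℤ/_ : ℕ → Set
ℤ/ q = Fin q

reduce : ∀ q .{{_ : NonZero q}} → ℤ → ℤ/ q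
reduce q z = fromℕ< (n%ℕd<d z q)

module _ {q : ℕ} .{{_ : NonZero q}} where

  0q : ℤ/ q
  0q = reduce q 0ℤ

  infixl 6 _+q_ _-q_
  _+q_ _-q_ : ℤ/ q → ℤ/ q → ℤ/ q
  x +q y = reduce q (+ toℕ x ℤ.+ + toℕ y)
  x -q y = reduce q (+ toℕ x ℤ.- + toℕ y)

  module _ {n m : ℕ} (G : Graph n m) (b : Fin n → ℤ/ q) where

    inflow outflow : (Fin m → ℤ/ q) → Fin n → ℤ/ q
    inflow  f v = List.foldr _+q_ 0q (List.map f (List.filter (λ e → head G e Fin.≟ v) (List.allFin m)))
    outflow f v = List.foldr _+q_ 0q (List.map f (List.filter (λ e → tail G e Fin.≟ v) (List.allFin m)))

    IsFlow : (Fin m → ℤ/ q) → Set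
    IsFlow f = ∀ v → inflow f v -q outflow f v ≡ b v

    NowhereZero : (Fin m → ℤ/ q) → Set
    NowhereZero f = ∀ e → f e ≢ 0q

    nowhereZeroFlow? : ∀ f → Dec (IsFlow f × NowhereZero f)
    nowhereZeroFlow? f = all? (λ v → inflow f v -q outflow f v Fin.≟ b v) ×-dec all? (λ e → ¬? (f e Fin.≟ 0q))

words : ∀ {A : Set} → List A → ∀ m → List (Vec A m)
words xs zero    = [] ∷ []
words xs (suc m) = List.cartesianProductWith _∷_ xs (words xs m)

#F* : ∀ {n m} (G : Graph n m) {q} .{{_ : NonZero q}} → (Fin n → ℤ/ q) → ℕ
#F* {m = m} G {q} b = length (List.filter (λ f → nowhereZeroFlow? G b (Vec.lookup f)) (words (List.allFin q) m))

subsets : ∀ m → List (Subset m)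
subsets = words (inside ∷ outside ∷ [])

Σ⊆ : ∀ {m} → (Subset m → ℤ) → ℤ
Σ⊆ {m} f = List.foldr ℤ._+_ 0ℤ (List.map f (subsets m))

sign : ∀ {m} → Subset m → ℤ
sign S = -1ℤ ℤ.^ ∣ S ∣

-- The i-th entry is the coefficient of tⁱ; trailing zeros are allowed.
Polynomial : Set
Polynomial = List ℤ

coefficient : Polynomial → ℕ → ℤ
coefficient []      i       = 0ℤ
coefficient (a ∷ p) zero    = a
coefficient (a ∷ p) (suc i) = coefficient p i

infix 4 _≈ₚ_
_≈ₚ_ : Polynomial → Polynomial → Set
p ≈ₚ r = ∀ i → coefficient p i ≡ coefficient r i

infixl 6 _+ₚ_
_+ₚ_ : Polynomial → Polynomial → Polynomial
[]      +ₚ r       = r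
(a ∷ p) +ₚ []      = a ∷ p
(a ∷ p) +ₚ (b ∷ r) = a ℤ.+ b ∷ (p +ₚ r)

_t^_ : ℤ → ℕ → Polynomial
a t^ zero  = a ∷ []
a t^ suc k = 0ℤ ∷ (a t^ k)

eval : Polynomial → ℤ → ℤ
eval p x = List.foldr (λ a y → a ℤ.+ x ℤ.* y) 0ℤ p

Σₚ : List Polynomial → Polynomial
Σₚ = List.foldr _+ₚ_ []

elements : ∀ {k} (S : Subset k) → Vector (Fin k) ∣ S ∣
elements (inside  ∷ S) zero    = zero
elements (inside  ∷ S) (suc i) = suc (elements S i)
elements (outside ∷ S) i       = suc (elements S i)

module _ {n m : ℕ} (G : Graph n m) where

  incidence : Integral.Matrix n m
  incidence v e =
    if does (head G e Fin.≟ tail G e) then 0ℤ else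
    if does (head G e Fin.≟ v) then 1ℤ else
    if does (tail G e Fin.≟ v) then -1ℤ else 0ℤ

  module _ (b : Fin n → ℤ) where

    M̄ : (S : Subset m) → Integral.Matrix (n ℕ.+ ∣ S ∣) (m ℕ.+ 1)
    M̄ S = (λ v → incidence v ++ (λ _ → b v)) ++ (λ i → Integral.𝟙 (elements S i) ++ (λ _ → 0ℤ))

    RankCondition : Subset m → Set
    RankCondition S = rank (M̄ S) ≡ m ∸ nullity-after-removing G S

    rankCondition? : ∀ S → Dec (RankCondition S)
    rankCondition? S = rank (M̄ S) ℕ.≟ m ∸ nullity-after-removing G S

    q_b : ℕ
    q_b = max 0 (List.map (λ S → largestInvariantFactor (M̄ S)) (List.filter (λ S → ¬? (rankCondition? S)) (subsets m)))

    d̃ : Subset m → ℕ → ℕ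
    d̃ S q = if does (rankCondition? S) then 1 else
            if does (q ℕ∣.∣? largestInvariantFactor (M̄ S)) then 1 else 0

    τ-sum : Polynomial
    τ-sum = Σₚ (List.map (λ S → sign S t^ nullity-after-removing G S) (List.filter rankCondition? (subsets m)))

module Real = LinearAlgebra ℝ-commutativeRing

ℤ⇒ℝ : ℤ → ℝ
ℤ⇒ℝ z = constant (z ℚ./ 1)

record Arrangement (k m : ℕ) : Set₁ where
  field
    ambient : Vector ℝ k → Set
    member  : Fin m → Vector ℝ k → Set

module _ {k m : ℕ} (𝒜 : Arrangement k m) where

  open Arrangement 𝒜

  ⋂H : Subset m → Vector ℝ k → Set
  ⋂H S x = ambient x × (∀ e → e ∈ S → member e x)

  IsDimension : Subset m → Maybe ℕ → Set
  IsDimension S nothing  = ¬ ∃ (⋂H S)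
  IsDimension S (just d) = Real.HasAffineDimension (⋂H S) d

  -- The witness records, for every S, either that the intersection is empty or its dimension, both of which
  -- are determined by S.
  IsCharacteristicPolynomial : Polynomial → Set
  IsCharacteristicPolynomial χ = Σ (Subset m → Maybe ℕ) λ dim →
    (∀ S → IsDimension S (dim S)) ×
    χ ≈ₚ Σₚ (List.map (λ S → maybe (sign S t^_) [] (dim S)) (subsets m))

V : ∀ {n m} → Integral.Matrix n m → (Fin n → ℤ) → Vector ℝ m → Set
V M b x = ∀ v → ((λ v e → ℤ⇒ℝ (M v e)) Real.∙ x) v ≃ ℤ⇒ℝ (b v)

𝒜 : ∀ {n m} → Integral.Matrix n m → (Fin n → ℤ) → Arrangement m m
𝒜 M b = record { ambient = V M b ; member = λ e x → V M b x × x e ≃ ℤ⇒ℝ 0ℤ }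

{-# OPTIONS --safe #-}
-- Removing S from G leaves a graph whose components κ and nullity ν arise by adding its edges one at a time: an
-- edge inside a component raises ν, and the value of a flow on a bridge between two components is forced. Hence, over
-- every commutative ring, a flow vanishing on S exists exactly when the component sums β of b vanish, and these flows
-- form a coset of a free module of rank ν. Over ℤ/q this counts them, and inclusion–exclusion over S gives the sum for
-- #F*; over ℝ it gives the dimensions of the intersections of the arrangement.
--
-- It remains to read β off the matrix M̄. By rank–nullity over ℚ, the rank condition says that β = 0. Modulo the
-- columns of edges the last column of M̄ becomes β ∈ ℤᶜ, so for β ≠ 0 the exponent of the torsion of the cokernel of M̄,
-- which is the largest invariant factor, is the greatest common divisor of the entries of β; thus q divides β exactly
-- when it divides d(M̄).
--
-- For (3), a flow modulo q and a flow modulo pq differ by a cycle modulo q, which lifts to an integer cycle, so every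
-- nowhere-zero flow modulo q is the reduction of a flow modulo pq, again nowhere-zero.

module Submission where

open import Algebra.Bundles using (CommutativeRing)
import Algebra.Morphism.Construct.Identity as Identity
open import Algebra.Morphism.Structures using (module RingMorphisms)
import Algebra.Properties.Ring
import Algebra.Properties.Semiring.Sum
open import Data.Bool.Base using (true; false; if_then_else_)
open import Data.Fin.Base using (Fin; zero; suc; toℕ; punchIn; punchOut; _↑ˡ_; _↑ʳ_; splitAt)
import Data.Fin.Properties as Fin
open import Data.Fin.Subset using (Subset; inside; outside; ∣_∣; _∈_; _∉_; ∁; ⊥)
open import Data.Fin.Subset.Properties using (_∈?_; ∉⊥; x∉p⇒x∈∁p; x∈∁p⇒x∉p)
open import Data.Integer.Base as ℤ using (ℤ; +_; 0ℤ; 1ℤ; -1ℤ)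
import Data.Integer.Coprimality as Coprime
open import Data.Integer.DivMod using (a≡a%ℕn+[a/ℕn]*n; n%ℕd<d; _%ℕ_; _/ℕ_)
import Data.Integer.Divisibility.Signed as ℤ∣
import Data.Integer.Properties as ℤ
import Data.Integer.Solver
open import Data.List.Base as List using (List; []; _∷_; length)
open import Data.List.Extrema.Nat using (xs≤max)
import Data.List.Membership.Propositional as List
import Data.List.Membership.Propositional.Properties as List
open import Data.List.Membership.Setoid.Properties using (index-injective)
import Data.List.Properties as List
open import Data.List.Relation.Unary.All as All using (All; []; _∷_)
open import Data.List.Relation.Unary.AllPairs using ([]; _∷_)
open import Data.List.Relation.Unary.Any as Any using (here; there)
open import Data.List.Relation.Unary.Linked using (Linked; []; [-]; _∷_)
open import Data.List.Relation.Unary.Unique.Propositional using (Unique)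
import Data.List.Relation.Unary.Unique.Propositional.Properties as Unique
open import Data.Maybe.Base using (Maybe; just; nothing; maybe; fromMaybe)
open import Data.Nat.Base as ℕ using (ℕ; zero; suc; z≤n; s≤s; NonZero)
import Data.Nat.Divisibility as ℕ∣
import Data.Nat.Properties as ℕ
open import Data.Nat.Properties using (m*n≢0)
open import Data.Product.Base using (Σ; ∃-syntax; _×_; _,_; proj₁; proj₂)
open import Data.Rational.Base as ℚ using (ℚ; 0ℚ; 1ℚ)
import Data.Rational.Properties as ℚ
import Data.Rational.Unnormalised.Base as ℚᵘ
import Data.Rational.Unnormalised.Properties as ℚᵘ
open import Data.Sum.Base using (_⊎_; inj₁; inj₂; [_,_]′)
open import Data.Unit.Base using (⊤; tt)
open import Data.Vec.Base as Vec using (Vec; []; _∷_; here; there)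
open import Data.Vec.Functional as Vector using (Vector; _++_)
open import Data.Vec.Functional.Properties using (lookup-++ˡ; lookup-++ʳ)
import Data.Vec.Properties as Vec
open import Function.Base using (_∘_)
open import Function.Bundles using (_⇔_; mk⇔; Equivalence)
open import Level using (0ℓ)
open import Relation.Binary.Construct.Closure.Equivalence as EqClosure using (EqClosure)
open import Relation.Binary.Definitions using (tri<; tri≈; tri>)
open import Relation.Binary.PropositionalEquality as ≡
  using (_≡_; _≢_; refl; sym; trans; cong; cong₂; subst; isEquivalence; module ≡-Reasoning)
import Relation.Binary.Reasoning.Setoid
open import Relation.Nullary using (Dec; ¬_; ¬?; yes; no; does; contradiction; _×-dec_)
open import Relation.Nullary.Decidable using (dec-true; dec-false; does-⇔)
open import Relation.Unary using (Pred; Decidable)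
open import Defs

open Data.Integer.Solver.+-*-Solver using (solve; con; _:=_; _:+_; _:*_; _:-_; :-_)
open Graph

-- Components

-- `rank`, `smithNormalForm` and `components` rest on abstract definitions, so their values cannot
-- be computed; each is reached through a property that pins it down. The number of components is
-- fixed by the universal property of a quotient of the vertex set. The rank is fixed by invariance
-- of dimension, which is proved with traces and is conclusive only in characteristic zero. The
-- largest invariant factor is fixed by how it acts on the cokernel, so neither minors nor
-- uniqueness of the normal form enter.
--
-- Solvability, the dimension of the cycle space and the number of solutions are three inductions on
-- the same datatype `Build`. None of them divides, and this is essential twice: solutions over ℤ
-- are what makes the cokernel of the edge columns free and what lifts cycles in the inequality
-- between two moduli; and over ℝ, where equality is undecidable, every case distinction is made on
-- integers, never on real numbers.

rest : ∀ {n m} → Graph n (suc m) → Graph n m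
rest G .tail e = tail G (suc e)
rest G .head e = head G (suc e)

-- The index `y` disappears and its members join the class of `w`. The surviving classes are exactly
-- the `punchIn y k`, which is how later formulas address them.
merge : ∀ {c} {y w : Fin (suc c)} → y ≢ w → Fin (suc c) → Fin c
merge {y = y} y≢w z with y Fin.≟ z
... | yes _  = punchOut y≢w
... | no y≢z = punchOut y≢z

-- The graph with the edges of S removed, built up edge by edge: κ is its component map and ν its nullity.
data Build {n} : ∀ {m c} → Graph n m → Subset m → (Fin n → Fin c) → ℕ → Set where
  empty   : ∀ {G} → Build {m = 0} G [] (λ v → v) 0
  removed : ∀ {m c} {G : Graph n (suc m)} {S} {κ : Fin n → Fin c} {ν} →
            Build (rest G) S κ ν → Build G (inside ∷ S) κ ν
  cycle   : ∀ {m c} {G : Graph n (suc m)} {S} {κ : Fin n → Fin c} {ν} →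
            κ (head G zero) ≡ κ (tail G zero) →
            Build (rest G) S κ ν → Build G (outside ∷ S) κ (suc ν)
  bridge  : ∀ {m c} {G : Graph n (suc m)} {S} {κ : Fin n → Fin (suc c)} {ν} →
            (h≢t : κ (head G zero) ≢ κ (tail G zero)) →
            Build (rest G) S κ ν → Build G (outside ∷ S) (merge h≢t ∘ κ) ν

build : ∀ {n m} (G : Graph n m) S → ∃[ c ] Σ (Fin n → Fin c) λ κ → ∃[ ν ] Build G S κ ν
build {m = zero}  G []            = _ , _ , _ , empty
build {m = suc m} G (inside ∷ S)  = let _ , _ , _ , B = build (rest G) S in _ , _ , _ , removed B
build {m = suc m} G (outside ∷ S) with build (rest G) S
... | zero  , κ , _ , B = contradiction (κ (head G zero)) λ ()
... | suc c , κ , _ , B with κ (head G zero) Fin.≟ κ (tail G zero)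
...   | yes h≡t = _ , _ , _ , cycle h≡t B
...   | no h≢t  = _ , _ , _ , bridge h≢t B

-- A kept edge raises the number of kept edges by one, and this is balanced either by raising `ν` or
-- by lowering `c`. The additive form keeps the truncated subtraction in `nullity` out of the
-- induction.
edges+components : ∀ {n m c ν} {G : Graph n m} {S} {κ : Fin n → Fin c} →
                   Build G S κ ν → ∣ ∁ S ∣ ℕ.+ c ≡ n ℕ.+ ν
edges+components {n} empty = sym (ℕ.+-identityʳ n)
edges+components (removed B) = edges+components B
edges+components {n} (cycle {ν = ν} _ B) = trans (cong suc (edges+components B)) (sym (ℕ.+-suc n ν))
edges+components (bridge {c = c} {S = S} _ B) = trans (sym (ℕ.+-suc ∣ ∁ S ∣ c)) (edges+components B)

Compatible : ∀ {n m} {A : Set} → Graph n m → Subset m → (Fin n → A) → Set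
Compatible G S g = ∀ e → e ∉ S → g (head G e) ≡ g (tail G e)

-- This universal property holds both for the map carried by `Build` and for the abstract component
-- map, and it determines `c`. Factorisation through `κ` is expressed pointwise by means of
-- representatives.
record IsQuotient {n m c} (G : Graph n m) (S : Subset m) (κ : Fin n → Fin c) : Set₁ where
  field
    representative : Fin c → Fin n
    section        : ∀ k → κ (representative k) ≡ k
    compatible     : Compatible G S κ
    universal      : ∀ {A : Set} (g : Fin n → A) → Compatible G S g → ∀ v → g v ≡ g (representative (κ v))

private
  compatible-rest : ∀ {n m s S} {G : Graph n (suc m)} {A : Set} (g : Fin n → A) →
                    Compatible G (s ∷ S) g → Compatible (rest G) S g
  compatible-rest g p e e∉S = p (suc e) λ where (there e∈S) → e∉S e∈S

isQuotient : ∀ {n m c ν} {G : Graph n m} {S} {κ : Fin n → Fin c} → Build G S κ ν → IsQuotient G S κ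
isQuotient empty = record
  { representative = λ v → v ; section = λ v → refl ; compatible = λ () ; universal = λ _ _ _ → refl }
isQuotient (removed {G = G} B) = record { IsQuotient Q hiding (compatible; universal)
  ; compatible = λ { zero e∉S → contradiction here e∉S ; (suc e) e∉S → compatible e (e∉S ∘ there) }
  ; universal = λ g p → universal g (compatible-rest {G = G} g p) }
  where Q = isQuotient B
        open IsQuotient Q
isQuotient (cycle {G = G} h≡t B) = record { IsQuotient Q hiding (compatible; universal)
  ; compatible = λ { zero _ → h≡t ; (suc e) e∉S → compatible e (e∉S ∘ there) }
  ; universal = λ g p → universal g (compatible-rest {G = G} g p) }
  where Q = isQuotient B
        open IsQuotient Q
isQuotient (bridge {G = G} {κ = κ} h≢t B) = record
  { representative = λ k → representative (punchIn y k)
  ; section = λ k → trans (cong (merge h≢t) (section (punchIn y k))) (merge-punchIn k)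
  ; compatible = λ { zero _ → glued ; (suc e) e∉S → cong (merge h≢t) (compatible e (e∉S ∘ there)) }
  ; universal = uni
  }
  where
  open IsQuotient (isQuotient B)
  y = κ (head G zero)
  merge-punchIn : ∀ k → merge h≢t (punchIn y k) ≡ k
  merge-punchIn k with y Fin.≟ punchIn y k
  ... | yes e  = contradiction (sym e) (Fin.punchInᵢ≢i y k)
  ... | no y≢z = Fin.punchOut-punchIn y
  glued : merge h≢t y ≡ merge h≢t (κ (tail G zero))
  glued with y Fin.≟ y | y Fin.≟ κ (tail G zero)
  ... | no y≢y | _       = contradiction refl y≢y
  ... | yes _  | yes h≡t = contradiction h≡t h≢t
  ... | yes _  | no _    = Fin.punchOut-cong y refl
  uni : ∀ {A : Set} (g : Fin _ → A) → Compatible G _ g → ∀ v → g v ≡ g (representative (punchIn y (merge h≢t (κ v))))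
  uni g p v with y Fin.≟ κ v
  ... | no y≢z = trans (ih v) (cong (g ∘ representative) (sym (Fin.punchIn-punchOut y≢z)))
    where ih = universal g (compatible-rest {G = G} g p)
  -- A vertex of the deleted class is carried across the new edge, from its head to its tail, whose
  -- class survives.
  ... | yes e  = begin
    g v                                                 ≡⟨ ih v ⟩
    g (representative (κ v))                            ≡⟨ cong (g ∘ representative) e ⟨
    g (representative y)                                ≡⟨ ih (head G zero) ⟨
    g (head G zero)                                     ≡⟨ p zero (λ ()) ⟩
    g (tail G zero)                                     ≡⟨ ih (tail G zero) ⟩
    g (representative (κ (tail G zero)))                ≡⟨ cong (g ∘ representative) (Fin.punchIn-punchOut h≢t) ⟨
    g (representative (punchIn y (punchOut h≢t)))       ∎
    where open ≡-Reasoning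
          ih = universal g (compatible-rest {G = G} g p)


components-isQuotient : ∀ {n m} (G : Graph n m) S → IsQuotient G S (Components.component (components G (∁ S)))
components-isQuotient G S = record
  { representative = λ k → proj₁ (surjective k)
  ; section        = λ k → proj₂ (surjective k)
  ; compatible     = λ e e∉S → sym (Equivalence.from (connected _ _)
                       (EqClosure.return (e , x∉p⇒x∈∁p e∉S , refl , refl)))
  ; universal      = λ g p v → EqClosure.gfold isEquivalence g
                       (λ { (e , e∈∁S , refl , refl) → sym (p e (x∈∁p⇒x∉p e∈∁S)) })
                       (Equivalence.to (connected _ _) (sym (proj₂ (surjective (component v)))))
  }
  where open Components (components G (∁ S))

-- Each of the two maps is compatible, so it factors through the other; the induced maps between the
-- index sets have left inverses, and both inequalities follow.
quotient-unique : ∀ {n m c d} {G : Graph n m} {S} {κ : Fin n → Fin c} {μ : Fin n → Fin d} →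
                  IsQuotient G S κ → IsQuotient G S μ → c ≡ d
quotient-unique {κ = κ} {μ} Q R = ℕ.≤-antisym
  (Fin.injective⇒≤ (retraction {g = κ ∘ representative R} (back κ μ Q R)))
      (Fin.injective⇒≤ (retraction {g = μ ∘ representative Q} (back μ κ R Q)))
  where
  open IsQuotient
  retraction : ∀ {c d} {f : Fin c → Fin d} {g : Fin d → Fin c} → (∀ k → g (f k) ≡ k) →
               ∀ {i j} → f i ≡ f j → i ≡ j
  retraction {g = g} h e = trans (sym (h _)) (trans (cong g e) (h _))
  back : ∀ {c d} (κ : Fin _ → Fin c) (μ : Fin _ → Fin d) (Q : IsQuotient _ _ κ) (R : IsQuotient _ _ μ) →
         ∀ k → κ (representative R (μ (representative Q k))) ≡ k
  back κ μ Q R k = trans (sym (universal R κ (compatible Q) (representative Q k))) (section Q k)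

nullity-build : ∀ {n m c ν} {G : Graph n m} {S} {κ : Fin n → Fin c} →
                Build G S κ ν → nullity-after-removing G S ≡ ν
nullity-build {n} {ν = ν} {G} {S} B = begin
  ∣ ∁ S ∣ ℕ.+ #components G (∁ S) ℕ.∸ n
    ≡⟨ cong (λ c → ∣ ∁ S ∣ ℕ.+ c ℕ.∸ n) (quotient-unique (components-isQuotient G S) (isQuotient B)) ⟩
  ∣ ∁ S ∣ ℕ.+ _ ℕ.∸ n                    ≡⟨ cong (ℕ._∸ n) (edges+components B) ⟩
  n ℕ.+ ν ℕ.∸ n                          ≡⟨ ℕ.m+n∸m≡n n ν ⟩
  ν                                      ∎
  where open ≡-Reasoning

-- Flows over a commutative ring

module Boundary {a ℓ} (R : CommutativeRing a ℓ) where

  open CommutativeRing R hiding (zero; refl; sym; trans; isEquivalence)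
  open CommutativeRing R using () renaming (refl to ≈-refl; sym to ≈-sym; trans to ≈-trans; reflexive to ≈-reflexive)
  open Algebra.Properties.Semiring.Sum semiring
  open Algebra.Properties.Ring ring
  open LinearAlgebra R
  open Relation.Binary.Reasoning.Setoid setoid

  𝟙-diagonal : ∀ {k} (i : Fin k) → 𝟙 i i ≡ 1#
  𝟙-diagonal i rewrite dec-true (i Fin.≟ i) refl = refl

  𝟙-off : ∀ {k} {i j : Fin k} → i ≢ j → 𝟙 i j ≡ 0#
  𝟙-off {i = i} {j} i≢j rewrite dec-false (i Fin.≟ j) i≢j = refl

  𝟙-⇔ : ∀ {k l} {i j : Fin k} {i′ j′ : Fin l} → (i ≡ j ⇔ i′ ≡ j′) → 𝟙 i j ≡ 𝟙 i′ j′
  𝟙-⇔ {i = i} {j} {i′} {j′} p rewrite does-⇔ p (i Fin.≟ j) (i′ Fin.≟ j′) = refl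

  private
    𝟙-punchOut : ∀ {c} {y z : Fin (suc c)} (y≢z : y ≢ z) k → 𝟙 (punchOut y≢z) k ≡ 𝟙 z (punchIn y k)
    𝟙-punchOut {y = y} y≢z k = 𝟙-⇔ (mk⇔
      (λ e → trans (sym (Fin.punchIn-punchOut y≢z)) (cong (punchIn y) e))
      (λ e → Fin.punchIn-injective y _ _ (trans (Fin.punchIn-punchOut y≢z) e)))

  -- Whatever sat on the deleted class `y` is transferred to `w`. In this linear form the identity
  -- can be summed over vertices, which gives `Σκ-merge`.
  𝟙-merge : ∀ {c} {y w : Fin (suc c)} (y≢w : y ≢ w) z k →
            𝟙 (merge y≢w z) k ≈ 𝟙 z (punchIn y k) + 𝟙 z y * 𝟙 w (punchIn y k)
  𝟙-merge {y = y} {w} y≢w z k with y Fin.≟ z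
  ... | yes refl = begin
    𝟙 (punchOut y≢w) k                                     ≡⟨ 𝟙-punchOut y≢w k ⟩
    𝟙 w (punchIn y k)                                      ≈⟨ *-identityˡ _ ⟨
    1# * 𝟙 w (punchIn y k)                                 ≈⟨ +-identityˡ _ ⟨
    0# + 1# * 𝟙 w (punchIn y k)                            ≡⟨ cong₂ (λ a b → a + b * 𝟙 w (punchIn y k))
                                                                 (𝟙-off (Fin.punchInᵢ≢i y k ∘ sym)) (𝟙-diagonal y) ⟨
    𝟙 y (punchIn y k) + 𝟙 y y * 𝟙 w (punchIn y k)          ∎
  ... | no y≢z = begin
    𝟙 (punchOut y≢z) k                                     ≡⟨ 𝟙-punchOut y≢z k ⟩
    𝟙 z (punchIn y k)                                      ≈⟨ +-identityʳ _ ⟨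
    𝟙 z (punchIn y k) + 0#                                 ≈⟨ +-congˡ (zeroˡ _) ⟨
    𝟙 z (punchIn y k) + 0# * 𝟙 w (punchIn y k)             ≡⟨ cong (λ b → 𝟙 z (punchIn y k) + b * 𝟙 w (punchIn y k))
                                                                 (𝟙-off (y≢z ∘ sym)) ⟨
    𝟙 z (punchIn y k) + 𝟙 z y * 𝟙 w (punchIn y k)          ∎

  incident : ∀ {n} → Fin n → Fin n → Vector Carrier n
  incident h t v = 𝟙 h v - 𝟙 t v

  ∂ : ∀ {n m} → Graph n m → Vector Carrier m → Vector Carrier n
  ∂ {m = m} G x v = ∑[ e < m ] (incident (head G e) (tail G e) v * x e)

  Vanishes : ∀ {m} → Subset m → Vector Carrier m → Set ℓ
  Vanishes S x = ∀ e → e ∈ S → x e ≈ 0#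

  Σκ : ∀ {n c} → (Fin n → Fin c) → Vector Carrier n → Vector Carrier c
  Σκ {n} κ b k = ∑[ v < n ] (b v * 𝟙 (κ v) k)

  Null : ∀ {c} → Vector Carrier c → Set ℓ
  Null y = ∀ k → y k ≈ 0#

  module _ {n c} (κ : Fin n → Fin c) where

    Σκ-cong : ∀ {b d} → (∀ v → b v ≈ d v) → ∀ k → Σκ κ b k ≈ Σκ κ d k
    Σκ-cong h k = sum-cong (λ v → *-congʳ (h v))

    Σκ-0 : ∀ k → Σκ κ (λ _ → 0#) k ≈ 0#
    Σκ-0 k = sum-0* (λ v → 𝟙 (κ v) k)

    Σκ-+ : ∀ b d k → Σκ κ (λ v → b v + d v) k ≈ Σκ κ b k + Σκ κ d k
    Σκ-+ b d k = ≈-trans (sum-cong (λ v → distribʳ _ (b v) (d v))) (∑-distrib-+ {n} _ _)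

    Σκ-* : ∀ x b k → Σκ κ (λ v → x * b v) k ≈ x * Σκ κ b k
    Σκ-* x b k = ≈-trans (sum-cong (λ v → *-assoc x (b v) _)) (≈-sym (*-distribˡ-sum {n} x _))

    Σκ-neg : ∀ b k → Σκ κ (λ v → - b v) k ≈ - Σκ κ b k
    Σκ-neg b k = begin
      Σκ κ (λ v → - b v) k        ≈⟨ Σκ-cong (λ v → -1*x≈-x (b v)) k ⟨
      Σκ κ (λ v → - 1# * b v) k   ≈⟨ Σκ-* (- 1#) b k ⟩
      - 1# * Σκ κ b k             ≈⟨ -1*x≈-x _ ⟩
      - Σκ κ b k                  ∎

    Σκ-- : ∀ b d k → Σκ κ (λ v → b v - d v) k ≈ Σκ κ b k - Σκ κ d k
    Σκ-- b d k = ≈-trans (Σκ-+ b (λ v → - d v) k) (+-congˡ (Σκ-neg d k))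

    Σκ-𝟙 : ∀ u k → Σκ κ (𝟙 u) k ≈ 𝟙 (κ u) k
    Σκ-𝟙 u k = sum-𝟙* (λ v → 𝟙 (κ v) k) u

    Σκ-incident : ∀ h t k → Σκ κ (incident h t) k ≈ incident (κ h) (κ t) k
    Σκ-incident h t k = ≈-trans (Σκ-- (𝟙 h) (𝟙 t) k) (+-cong (Σκ-𝟙 h k) (-‿cong (Σκ-𝟙 t k)))

    Σκ-incident-* : ∀ h t x k → Σκ κ (λ v → incident h t v * x) k ≈ incident (κ h) (κ t) k * x
    Σκ-incident-* h t x k = begin
      Σκ κ (λ v → incident h t v * x) k ≈⟨ Σκ-cong (λ v → *-comm _ x) k ⟩
      Σκ κ (λ v → x * incident h t v) k ≈⟨ Σκ-* x (incident h t) k ⟩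
      x * Σκ κ (incident h t) k         ≈⟨ *-comm x _ ⟩
      Σκ κ (incident h t) k * x         ≈⟨ *-congʳ (Σκ-incident h t k) ⟩
      incident (κ h) (κ t) k * x        ∎

    Σκ-∂ : ∀ {m} (G : Graph n m) x k →
           Σκ κ (∂ G x) k ≈ ∑[ e < m ] (incident (κ (head G e)) (κ (tail G e)) k * x e)
    Σκ-∂ {zero}  G x k = Σκ-0 k
    Σκ-∂ {suc m} G x k = ≈-trans (Σκ-+ _ _ k)
      (+-cong (Σκ-incident-* (head G zero) (tail G zero) (x zero) k) (Σκ-∂ (rest G) (x ∘ suc) k))

    -- An edge of `S` carries zero, and every other edge has both ends in one class, where its two
    -- contributions cancel. This is the necessary condition for solvability.
    Σκ-∂-null : ∀ {m} {G : Graph n m} {S x} → Compatible G S κ → Vanishes S x → Null (Σκ κ (∂ G x))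
    Σκ-∂-null {G = G} {S} {x} p x≈0 k = ≈-trans (Σκ-∂ G x k) (sum-zero term)
      where
      term : ∀ e → incident (κ (head G e)) (κ (tail G e)) k * x e ≈ 0#
      term e with e ∈? S
      ... | yes e∈S = ≈-trans (*-congˡ (x≈0 e e∈S)) (zeroʳ _)
      ... | no e∉S rewrite p e e∉S = ≈-trans (*-congʳ (-‿inverseʳ _)) (zeroˡ _)

  Σκ-id : ∀ {n} b (k : Fin n) → Σκ (λ v → v) b k ≈ b k
  Σκ-id b k = sum-*𝟙 b k

  Σκ-merge : ∀ {n c} {y w : Fin (suc c)} (y≢w : y ≢ w) (κ : Fin n → Fin (suc c)) b k →
             Σκ (merge y≢w ∘ κ) b k ≈ Σκ κ b (punchIn y k) + Σκ κ b y * 𝟙 w (punchIn y k)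
  Σκ-merge {n} {y = y} {w} y≢w κ b k = begin
    ∑[ v < n ] (b v * 𝟙 (merge y≢w (κ v)) k)
      ≈⟨ sum-cong (λ v → ≈-trans (*-congˡ (𝟙-merge y≢w (κ v) k))
           (≈-trans (distribˡ (b v) _ _) (+-congˡ (≈-sym (*-assoc (b v) _ _))))) ⟩
    ∑[ v < n ] (b v * 𝟙 (κ v) (punchIn y k) + b v * 𝟙 (κ v) y * 𝟙 w (punchIn y k))
      ≈⟨ ∑-distrib-+ {n} _ _ ⟩
    Σκ κ b (punchIn y k) + ∑[ v < n ] (b v * 𝟙 (κ v) y * 𝟙 w (punchIn y k))
      ≈⟨ +-congˡ (*-distribʳ-sum (𝟙 w (punchIn y k)) (λ v → b v * 𝟙 (κ v) y)) ⟨
    Σκ κ b (punchIn y k) + Σκ κ b y * 𝟙 w (punchIn y k) ∎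

  x-y≈0⇔x≈y : ∀ x y → (x - y ≈ 0#) ⇔ (x ≈ y)
  x-y≈0⇔x≈y x y = mk⇔ (x-y≈0⇒x≈y x y) (x≈y⇒x-y≈0 {x} {y})
    where
    x-y≈0⇒x≈y : ∀ x y → x - y ≈ 0# → x ≈ y
    x-y≈0⇒x≈y x y e = ≈-trans (≈-sym (≈-trans (+-assoc x (- y) y) (≈-trans (+-congˡ (-‿inverseˡ y)) (+-identityʳ x))))
                            (≈-trans (+-congʳ e) (+-identityˡ y))
    x≈y⇒x-y≈0 : ∀ {x y} → x ≈ y → x - y ≈ 0#
    x≈y⇒x-y≈0 {x} {y} e = ≈-trans (+-congʳ e) (-‿inverseʳ y)

  -- What remains for the other edges when an edge from t to h is given the value x.
  residue : ∀ {n} → Fin n → Fin n → Carrier → Vector Carrier n → Vector Carrier n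
  residue h t x b v = b v - incident h t v * x

  ∂-residue : ∀ {n m} (G : Graph n (suc m)) x b v →
              (∂ G x v ≈ b v) ⇔ (∂ (rest G) (x ∘ suc) v ≈ residue (head G zero) (tail G zero) (x zero) b v)
  ∂-residue G x b v = mk⇔
    (λ e → ≈-sym (≈-trans (+-congʳ (≈-trans (≈-sym e) (+-comm p r)))
       (≈-trans (+-assoc r p (- p)) (≈-trans (+-congˡ (-‿inverseʳ p)) (+-identityʳ r)))))
    (λ e → ≈-trans (+-congˡ e) (≈-trans (+-comm p _)
       (≈-trans (+-assoc (b v) (- p) p) (≈-trans (+-congˡ (-‿inverseˡ p)) (+-identityʳ (b v))))))
    where
    p = incident (head G zero) (tail G zero) v * x zero
    r = ∂ (rest G) (x ∘ suc) v

  Σκ-residue : ∀ {n c} (κ : Fin n → Fin c) h t x b k → Σκ κ (residue h t x b) k ≈ residue (κ h) (κ t) x (Σκ κ b) k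
  Σκ-residue κ h t x b k = ≈-trans (Σκ-- κ b _ k) (+-congˡ (-‿cong (Σκ-incident-* κ h t x k)))

  residue-cycle : ∀ {c} {h t : Fin c} → h ≡ t → ∀ x B k → residue h t x B k ≈ B k
  residue-cycle refl x B k = ≈-trans
    (+-congˡ (≈-trans (-‿cong (≈-trans (*-congʳ (-‿inverseʳ _)) (zeroˡ x))) -0#≈0#)) (+-identityʳ _)

  -- The two ends lie in different classes, so the sum over the class of the head is lowered by
  -- exactly `x`, which forces `x`. With that value the other classes have the sums they would have
  -- after merging.
  residue-bridge : ∀ {n c} (κ : Fin n → Fin (suc c)) {h t} (h≢t : κ h ≢ κ t) x b →
    Null (Σκ κ (residue h t x b)) ⇔ (x ≈ Σκ κ b (κ h) × Null (Σκ (merge h≢t ∘ κ) b))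
  residue-bridge {c = c} κ {h} {t} h≢t x b = mk⇔ to from
    where
    y = κ h
    w = κ t
    B = Σκ κ b
    at-y : incident y w y * x ≈ x
    at-y = begin
      (𝟙 y y - 𝟙 w y) * x  ≡⟨ cong₂ (λ p q → (p - q) * x) (𝟙-diagonal y) (𝟙-off (h≢t ∘ sym)) ⟩
      (1# - 0#) * x        ≈⟨ *-congʳ (≈-trans (+-congˡ -0#≈0#) (+-identityʳ 1#)) ⟩
      1# * x               ≈⟨ *-identityˡ x ⟩
      x                    ∎
    at-other : ∀ k → incident y w (punchIn y k) * x ≈ - (x * 𝟙 w (punchIn y k))
    at-other k = begin
      (𝟙 y p - 𝟙 w p) * x  ≡⟨ cong (λ q → (q - 𝟙 w p) * x) (𝟙-off (Fin.punchInᵢ≢i y k ∘ sym)) ⟩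
      (0# - 𝟙 w p) * x     ≈⟨ *-congʳ (+-identityˡ _) ⟩
      - 𝟙 w p * x          ≈⟨ -‿distribˡ-* _ _ ⟨
      - (𝟙 w p * x)        ≈⟨ -‿cong (*-comm _ x) ⟩
      - (x * 𝟙 w p)        ∎
      where p = punchIn y k
    merged : ∀ k → x ≈ B y → residue y w x B (punchIn y k) ≈ Σκ (merge h≢t ∘ κ) b k
    merged k e = begin
      B p - incident y w p * x    ≈⟨ +-congˡ (-‿cong (at-other k)) ⟩
      B p - - (x * 𝟙 w p)         ≈⟨ +-congˡ (-‿involutive _) ⟩
      B p + x * 𝟙 w p             ≈⟨ +-congˡ (*-congʳ e) ⟩
      B p + B y * 𝟙 w p           ≈⟨ Σκ-merge h≢t κ b k ⟨
      Σκ (merge h≢t ∘ κ) b k      ∎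
      where p = punchIn y k
    to : Null (Σκ κ (residue h t x b)) → x ≈ B y × Null (Σκ (merge h≢t ∘ κ) b)
    to null = x≈ , λ k → ≈-trans (≈-sym (merged k x≈)) (null′ (punchIn y k))
      where
      null′ : Null (residue y w x B)
      null′ k = ≈-trans (≈-sym (Σκ-residue κ h t x b k)) (null k)
      x≈ : x ≈ B y
      x≈ = ≈-sym (Equivalence.to (x-y≈0⇔x≈y _ _) (≈-trans (+-congˡ (-‿cong (≈-sym at-y))) (null′ y)))
    from : x ≈ B y × Null (Σκ (merge h≢t ∘ κ) b) → Null (Σκ κ (residue h t x b))
    from (x≈ , null) k = ≈-trans (Σκ-residue κ h t x b k) (null′ k)
      where
      null′ : Null (residue y w x B)
      null′ k = by-cases k (y Fin.≟ k)
        where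
        by-cases : ∀ k → Dec (y ≡ k) → residue y w x B k ≈ 0#
        by-cases k (yes refl) = Equivalence.from (x-y≈0⇔x≈y _ _) (≈-trans (≈-sym x≈) (≈-sym at-y))
        by-cases k (no y≢k)   = subst (λ k → residue y w x B k ≈ 0#) (Fin.punchIn-punchOut y≢k)
                                  (≈-trans (merged (punchOut y≢k) x≈) (null _))

  residue-zero : ∀ {n} (h t : Fin n) {x} b → x ≈ 0# → ∀ v → residue h t x b v ≈ b v
  residue-zero h t b x≈0 v = ≈-trans (+-congˡ (≈-trans (-‿cong (≈-trans (*-congˡ x≈0) (zeroʳ _))) -0#≈0#))
      (+-identityʳ _)

  -- Converse of `Σκ-∂-null`. An edge inside a component may be given 0 since it leaves the
  -- component sums alone, and a bridge receives the sum over the class of its head. No division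
  -- occurs, so solutions exist even over ℤ.
  exact : ∀ {n m c ν} {G : Graph n m} {S} {κ : Fin n → Fin c} → Build G S κ ν →
          ∀ b → Null (Σκ κ b) → ∃[ x ] (Vanishes S x × (∀ v → ∂ G x v ≈ b v))
  exact empty b null = (λ ()) , (λ ()) , λ v → ≈-sym (≈-trans (≈-sym (Σκ-id b v)) (null v))
  exact {G = G} (removed B) b null =
    let x , x≈0 , e = exact B b null in
    0# Vector.∷ x ,
    (λ { zero _ → ≈-refl ; (suc e) (there e∈S) → x≈0 e e∈S }) ,
    λ v → Equivalence.from (∂-residue G (0# Vector.∷ x) b v)
        (≈-trans (e v) (≈-sym (residue-zero (head G zero) (tail G zero) b ≈-refl v)))
  exact {G = G} (cycle _ B) b null =
    let x , x≈0 , e = exact B b null in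
    0# Vector.∷ x ,
    (λ { (suc e) (there e∈S) → x≈0 e e∈S }) ,
    λ v → Equivalence.from (∂-residue G (0# Vector.∷ x) b v)
        (≈-trans (e v) (≈-sym (residue-zero (head G zero) (tail G zero) b ≈-refl v)))
  exact {G = G} (bridge {κ = κ} h≢t B) b null =
    let y = Σκ κ b (κ (head G zero))
        x , x≈0 , e = exact B (residue (head G zero) (tail G zero) y b)
                        (Equivalence.from (residue-bridge κ h≢t y b) (≈-refl , null))
    in y Vector.∷ x ,
    (λ { (suc e) (there e∈S) → x≈0 e e∈S }) ,
    λ v → Equivalence.from (∂-residue G (y Vector.∷ x) b v) (e v)

  ∂-+* : ∀ {n m} (G : Graph n m) x a z v → ∂ G (λ e → x e + a * z e) v ≈ ∂ G x v + a * ∂ G z v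
  ∂-+* {m = m} G x a z v = begin
    ∑[ e < m ] (i e * (x e + a * z e))              ≈⟨ sum-cong
        (λ e → ≈-trans (distribˡ (i e) _ _) (+-congˡ (swap (i e) a (z e)))) ⟩
    ∑[ e < m ] (i e * x e + a * (i e * z e))        ≈⟨ ∑-distrib-+ {m} _ _ ⟩
    ∂ G x v + ∑[ e < m ] (a * (i e * z e))          ≈⟨ +-congˡ (*-distribˡ-sum a (λ e → i e * z e)) ⟨
    ∂ G x v + a * ∂ G z v                           ∎
    where
    i : Vector Carrier m
    i e = incident (head G e) (tail G e) v
    swap : ∀ i a z → i * (a * z) ≈ a * (i * z)
    swap i a z = ≈-trans (≈-sym (*-assoc i a z)) (≈-trans (*-congʳ (*-comm i a)) (*-assoc a i z))

  dimension-pad : ∀ {p p′ k d} {P : Vector Carrier (suc k) → Set p} {P′ : Vector Carrier k → Set p′} →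
                  (∀ x → P x ⇔ (x zero ≈ 0# × P′ (x ∘ suc))) → HasDimension P′ d → HasDimension P d
  dimension-pad P⇔ (v , independent , span) =
    (λ j → 0# Vector.∷ v j) , (λ c h → independent c (h ∘ suc)) , λ x → mk⇔
      (λ Px → let x₀ , Px′ = Equivalence.to (P⇔ x) Px
                  c , e = Equivalence.to (span _) Px′
              in c , λ { zero → ≈-trans x₀ (≈-sym (sum-*0 c)) ; (suc i) → e i })
      (λ (c , e) → Equivalence.from (P⇔ x) (≈-trans (e zero) (sum-*0 c) , Equivalence.from (span _) (c , e ∘ suc)))

  -- The shear that adds `x zero * z` to the other coordinates turns `P` into a free coordinate
  -- times `P′`. Undoing it sends the free generator to `(1 , - z)`, the added basis vector.
  dimension-suc : ∀ {p p′ k d} {P : Vector Carrier (suc k) → Set p} {P′ : Vector Carrier k → Set p′}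
      (z : Vector Carrier k) →
                  (∀ x → P x ⇔ P′ (λ i → x (suc i) + x zero * z i)) → HasDimension P′ d → HasDimension P (suc d)
  dimension-suc {k = k} {d} z P⇔ (v , independent , span) = basis , independent′ , λ x → mk⇔
      (λ Px → let c , e = Equivalence.to (span _) (Equivalence.to (P⇔ x) Px) in
         x zero Vector.∷ c , λ where
           zero    → ≈-sym (at-zero (x zero Vector.∷ c))
           (suc i) → begin
             x (suc i)                                                 ≈⟨ drop (x (suc i)) (x zero) (z i) ⟨
             x zero * - z i + (x (suc i) + x zero * z i)               ≈⟨ +-congˡ (e i) ⟩
             x zero * - z i + combination c v i                        ∎)
      (λ (c , e) → Equivalence.from (P⇔ x) (Equivalence.from (span _) (c ∘ suc , λ i → begin
         x (suc i) + x zero * z i                                      ≈⟨ +-cong (e (suc i))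
             (*-congʳ (≈-trans (e zero) (at-zero c))) ⟩
         c zero * - z i + combination (c ∘ suc) v i + c zero * z i     ≈⟨ +-assoc _ _ _ ⟩
         c zero * - z i + (combination (c ∘ suc) v i + c zero * z i)   ≈⟨ drop _ (c zero) (z i) ⟩
         combination (c ∘ suc) v i                                     ∎)))
    where
    basis : Vector (Vector Carrier (suc k)) (suc d)
    basis = (1# Vector.∷ (λ i → - z i)) Vector.∷ (λ j → 0# Vector.∷ v j)
    at-zero : ∀ c → combination c basis zero ≈ c zero
    at-zero c = ≈-trans (+-cong (*-identityʳ _) (sum-*0 (c ∘ suc))) (+-identityʳ _)
    drop : ∀ w a z → a * - z + (w + a * z) ≈ w
    drop w a z = begin
      a * - z + (w + a * z)     ≈⟨ +-congʳ (-‿distribʳ-* a z) ⟨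
      - (a * z) + (w + a * z)   ≈⟨ +-comm _ _ ⟩
      (w + a * z) - a * z       ≈⟨ +-assoc _ _ _ ⟩
      w + (a * z - a * z)       ≈⟨ +-congˡ (-‿inverseʳ _) ⟩
      w + 0#                    ≈⟨ +-identityʳ w ⟩
      w                         ∎
    independent′ : LinearlyIndependent basis
    independent′ c h = λ { zero → c₀≈0 ; (suc j) → independent (c ∘ suc) rest≈0 j }
      where
      c₀≈0 : c zero ≈ 0#
      c₀≈0 = ≈-trans (≈-sym (at-zero c)) (h zero)
      rest≈0 : ∀ i → combination (c ∘ suc) v i ≈ 0#
      rest≈0 i = begin
        combination (c ∘ suc) v i                    ≈⟨ +-identityˡ _ ⟨
        0# + combination (c ∘ suc) v i               ≈⟨ +-congʳ (≈-trans (*-congʳ c₀≈0) (zeroˡ _)) ⟨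
        c zero * - z i + combination (c ∘ suc) v i   ≈⟨ h (suc i) ⟩
        0#                                           ∎

  Kernel : ∀ {n m} → Graph n m → Subset m → Vector Carrier m → Set ℓ
  Kernel G S x = Null (∂ G x) × Vanishes S x

  private
    ∂-zero : ∀ {n m} (G : Graph n (suc m)) x → x zero ≈ 0# → ∀ v → ∂ G x v ≈ ∂ (rest G) (x ∘ suc) v
    ∂-zero G x x₀ v = ≈-trans (+-congʳ (≈-trans (*-congˡ x₀) (zeroʳ _))) (+-identityˡ _)

  kernel-dimension : ∀ {n m c ν} {G : Graph n m} {S} {κ : Fin n → Fin c} → Build G S κ ν → HasDimension (Kernel G S) ν
  kernel-dimension empty = (λ ()) , (λ c h ()) , λ x → mk⇔ (λ _ → (λ ()) , λ ()) (λ _ → (λ v → ≈-refl) , λ ())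
  kernel-dimension {G = G} (removed {S = S} B) = dimension-pad (λ x → mk⇔
    (λ (null , x≈0) → x≈0 zero here ,
      (λ v → ≈-trans (≈-sym (∂-zero G x (x≈0 zero here) v)) (null v)) , λ e e∈S → x≈0 (suc e) (there e∈S))
    (λ (x₀ , null , x≈0) → (λ v → ≈-trans (∂-zero G x x₀ v) (null v)) ,
      λ { zero _ → x₀ ; (suc e) (there e∈S) → x≈0 e e∈S }))
    (kernel-dimension B)
  kernel-dimension {G = G} (bridge {S = S} {κ = κ} h≢t B) = dimension-pad (λ x → mk⇔
    (λ (null , x≈0) → let x₀ = forced x null (x≈0) in
      x₀ , (λ v → ≈-trans (≈-sym (∂-zero G x x₀ v)) (null v)) , λ e e∈S → x≈0 (suc e) (there e∈S))
    (λ (x₀ , null , x≈0) → (λ v → ≈-trans (∂-zero G x x₀ v) (null v)) , λ { (suc e) (there e∈S) → x≈0 e e∈S }))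
    (kernel-dimension B)
    where
    forced : ∀ x → Null (∂ G x) → Vanishes (outside ∷ S) x → x zero ≈ 0#
    forced x null x≈0 = ≈-trans
      (proj₁ (Equivalence.to (residue-bridge κ h≢t (x zero) (λ _ → 0#)) λ k →
        ≈-trans (Σκ-cong κ (λ v → ≈-sym (Equivalence.to (∂-residue G x (λ _ → 0#) v) (null v))) k)
          (Σκ-∂-null κ {G = rest G} (IsQuotient.compatible (isQuotient B)) (λ e e∈S → x≈0 (suc e) (there e∈S)) k)))
      (Σκ-0 κ _)
  -- `z` realises the boundary of the new edge by the edges already present, so the new edge minus
  -- `z` is its fundamental cycle.
  kernel-dimension {G = G} (cycle {S = S} {κ = κ} h≡t B)
    with exact B (incident (head G zero) (tail G zero)) (λ k → ≈-trans (Σκ-incident κ (head G zero) (tail G zero) k)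
           (Equivalence.from (x-y≈0⇔x≈y _ _) (≈-reflexive (cong (λ i → 𝟙 i k) h≡t))))
  ... | z , z≈0 , ∂z = dimension-suc z (λ x → mk⇔
    (λ (null , x≈0) → (λ v → ≈-trans (closed x v) (null v)) , λ e e∈S →
      ≈-trans (+-cong (x≈0 (suc e) (there e∈S)) (≈-trans (*-congˡ (z≈0 e e∈S)) (zeroʳ _))) (+-identityʳ 0#))
    (λ (null , x≈0) → (λ v → ≈-trans (≈-sym (closed x v)) (null v)) , λ { (suc e) (there e∈S) →
      ≈-trans (≈-sym (≈-trans (+-congˡ (≈-trans (*-congˡ (z≈0 e e∈S)) (zeroʳ _))) (+-identityʳ _))) (x≈0 e e∈S) }))
    (kernel-dimension B)
    where
    closed : ∀ x v → ∂ (rest G) (λ e → x (suc e) + x zero * z e) v ≈ ∂ G x v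
    closed x v = ≈-trans (∂-+* (rest G) (x ∘ suc) (x zero) z v)
      (≈-trans (+-congˡ (≈-trans (*-congˡ (∂z v)) (*-comm _ _))) (+-comm _ _))

  ∂-cong : ∀ {n m} (G : Graph n m) {x y} → (∀ e → x e ≈ y e) → ∀ v → ∂ G x v ≈ ∂ G y v
  ∂-cong G x≈y v = sum-cong (λ e → *-congˡ (x≈y e))

  ∂-+ : ∀ {n m} (G : Graph n m) x z v → ∂ G (λ e → x e + z e) v ≈ ∂ G x v + ∂ G z v
  ∂-+ {m = m} G x z v = ≈-trans (sum-cong {m} (λ e → distribˡ _ (x e) (z e))) (∑-distrib-+ {m} _ _)

  translate⇔ : ∀ {n m} (G : Graph n m) {S} {b : Vector Carrier n} {x} → Vanishes S x → (∀ v → ∂ G x v ≈ b v) →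
               ∀ (z : Vector Carrier m) →
               (Vanishes S (λ e → x e + z e) × (∀ v → ∂ G (λ e → x e + z e) v ≈ b v)) ⇔ Kernel G S z
  translate⇔ G {x = x} x≈0 ∂x z = mk⇔
    (λ (x+z≈0 , ∂x+z) →
      (λ v → cancel (∂ G z v) (∂x v) (≈-trans (≈-sym (∂-+ G x z v)) (∂x+z v))) ,
      (λ e e∈S → cancel (z e) (x≈0 e e∈S) (x+z≈0 e e∈S)))
    (λ (null , z≈0) →
      (λ e e∈S → ≈-trans (+-cong (x≈0 e e∈S) (z≈0 e e∈S)) (+-identityʳ 0#)) ,
      (λ v → ≈-trans (∂-+ G x z v) (≈-trans (+-cong (∂x v) (null v)) (+-identityʳ _))))
    where
    cancel : ∀ {a b} z → a ≈ b → a + z ≈ b → z ≈ 0#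
    cancel {a} {b} z a≈b a+z≈b = +-cancelˡ a z 0# (≈-trans a+z≈b (≈-sym (≈-trans (+-identityʳ a) a≈b)))

  dimension-⇔ : ∀ {p p′ k d} {P : Vector Carrier k → Set p} {P′ : Vector Carrier k → Set p′} →
                (∀ x → P x ⇔ P′ x) → HasDimension P′ d → HasDimension P d
  dimension-⇔ P⇔ (v , independent , span) = v , independent , λ x → mk⇔
    (λ Px → Equivalence.to (span x) (Equivalence.to (P⇔ x) Px))
    (λ s → Equivalence.from (P⇔ x) (Equivalence.from (span x) s))

-- Dimension

↑-cases : ∀ {k l p} {P : Fin (k ℕ.+ l) → Set p} → (∀ i → P (i ↑ˡ l)) → (∀ j → P (k ↑ʳ j)) → ∀ i → P i
↑-cases {k} {l} {P = P} f g i with splitAt k i | Fin.join-splitAt k l i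
... | inj₁ j | refl = f j
... | inj₂ j | refl = g j

module Dimension {a ℓ} (R : CommutativeRing a ℓ) where

  open CommutativeRing R hiding (zero; refl; sym; trans; isEquivalence)
  open CommutativeRing R using () renaming (refl to ≈-refl; sym to ≈-sym; trans to ≈-trans; reflexive to ≈-reflexive)
  open Algebra.Properties.Semiring.Sum semiring
  open Algebra.Properties.Ring ring
  open LinearAlgebra R
  open Boundary R using (𝟙-diagonal; x-y≈0⇔x≈y)
  open Relation.Binary.Reasoning.Setoid setoid

  sum-++ : ∀ k {l} (f : Vector Carrier (k ℕ.+ l)) → sum f ≈ sum (λ i → f (i ↑ˡ l)) + sum (λ j → f (k ↑ʳ j))
  sum-++ zero    f = ≈-sym (+-identityˡ _)
  sum-++ (suc k) f = ≈-trans (+-congˡ (sum-++ k (f ∘ suc))) (≈-sym (+-assoc _ _ _))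

  combination-cong : ∀ {d k} {c c′ : Vector Carrier d} {v v′ : Vector (Vector Carrier k) d} →
                     (∀ j → c j ≈ c′ j) → (∀ j i → v j i ≈ v′ j i) → ∀ i → combination c v i ≈ combination c′ v′ i
  combination-cong p q i = sum-cong (λ j → *-cong (p j) (q j i))

  combination-- : ∀ {d k} c c′ (v : Vector (Vector Carrier k) d) i →
                  combination (λ j → c j - c′ j) v i ≈ combination c v i - combination c′ v i
  combination-- {d} c c′ v i = begin
    ∑[ j < d ] ((c j - c′ j) * v j i)
      ≈⟨ sum-cong (λ j → ≈-trans (distribʳ (v j i) (c j) (- c′ j)) (+-congˡ
           (≈-trans (≈-sym (-‿distribˡ-* (c′ j) (v j i))) (≈-sym (-1*x≈-x _))))) ⟩
    ∑[ j < d ] (c j * v j i + - 1# * (c′ j * v j i))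
      ≈⟨ ∑-distrib-+ {d} _ _ ⟩
    combination c v i + ∑[ j < d ] (- 1# * (c′ j * v j i))
      ≈⟨ +-congˡ (≈-trans (≈-sym (*-distribˡ-sum {d} (- 1#) (λ j → c′ j * v j i))) (-1*x≈-x _)) ⟩
    combination c v i - combination c′ v i ∎

  combination-assoc : ∀ {d l k} c (A : Matrix d l) (v : Matrix l k) i →
                      combination c (A · v) i ≈ combination (combination c A) v i
  combination-assoc c A v i = ≈-sym (·-assoc {k = 1} (λ _ → c) A v zero i)

  combination-++ : ∀ {d e k} c (u : Vector (Vector Carrier k) d) (v : Vector (Vector Carrier k) e) i →
                   combination c (u ++ v) i ≈ combination (λ j → c (j ↑ˡ e)) u i + combination (λ j → c (d ↑ʳ j)) v i
  combination-++ {d} {e} c u v i = ≈-trans (sum-++ d (λ j → c j * (u ++ v) j i)) (+-cong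
    (sum-cong (λ j → *-congˡ (≈-reflexive (cong (λ w → w i) (lookup-++ˡ u v j)))))
    (sum-cong (λ j → *-congˡ (≈-reflexive (cong (λ w → w i) (lookup-++ʳ u v j))))))

  basis-member : ∀ {p k d} {P : Vector Carrier k → Set p} ((v , _) : HasDimension P d) → ∀ j → P (v j)
  basis-member (v , _ , span) j = Equivalence.from (span (v j)) (𝟙 j , λ i → ≈-sym (sum-𝟙* (λ h → v h i) j))

  full-dimension : ∀ k → HasDimension {k = k} (λ _ → ⊤) k
  full-dimension k = 𝟙 , (λ c h j → ≈-trans (≈-sym (sum-*𝟙 c j)) (h j)) , λ y → mk⇔
    (λ _ → y , λ i → ≈-sym (sum-*𝟙 y i)) (λ _ → tt)

  dimension-reindex : ∀ {p p′ k l d} {P : Vector Carrier l → Set p} {P′ : Vector Carrier k → Set p′}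
                      (f : Fin k → Fin l) (g : Fin l → Fin k) → (∀ i → f (g i) ≡ i) → (∀ j → g (f j) ≡ j) →
                      (∀ x → P x ⇔ P′ (x ∘ f)) → HasDimension P′ d → HasDimension P d
  dimension-reindex {k = k} {l} {d} f g fg gf P⇔ (v , independent , span) =
    (λ j → v j ∘ g) ,
    (λ c h → independent c (λ i → subst (λ i → combination c v i ≈ 0#) (gf i) (h (f i)))) , λ x → mk⇔
      (λ Px → let c , e = Equivalence.to (span _) (Equivalence.to (P⇔ x) Px) in
         c , λ i → ≈-trans (≈-reflexive (cong x (sym (fg i)))) (e (g i)))
      (λ (c , e) → Equivalence.from (P⇔ x) (Equivalence.from (span _) (c , λ j →
         ≈-trans (e (f j)) (≈-reflexive (cong (combination c v) (gf j))))))

  trace : ∀ {k} → Matrix k k → Carrier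
  trace {k} A = ∑[ i < k ] A i i

  trace-comm : ∀ {k l} (A : Matrix k l) (B : Matrix l k) → trace (A · B) ≈ trace (B · A)
  trace-comm {k} {l} A B = ≈-trans (∑-comm (λ i j → A i j * B j i))
    (sum-cong (λ j → sum-cong {k} (λ i → *-comm (A i j) (B j i))))

  trace-𝟙 : ∀ k → trace (𝟙 {k}) ≈ ∑[ i < k ] 1#
  trace-𝟙 k = sum-cong {k} (λ i → ≈-reflexive (𝟙-diagonal i))

  private
    change : ∀ {p k d e} {P : Vector Carrier k → Set p} (X : HasDimension P d) (Y : HasDimension P e) →
             Σ (Matrix d e) λ A → proj₁ X ≋ A · proj₁ Y
    change X (v , _ , span) =
      (λ j → proj₁ (Equivalence.to (span _) (basis-member X j))) ,
      (λ j → proj₂ (Equivalence.to (span _) (basis-member X j)))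

    independent-cancel : ∀ {k d} {u : Matrix d k} (A : Matrix d d) → LinearlyIndependent u → u ≋ A · u → A ≋ 𝟙
    independent-cancel {u = u} A independent e i j =
      Equivalence.to (x-y≈0⇔x≈y (A i j) (𝟙 i j)) (independent (λ h → A i h - 𝟙 i h) (λ g →
        ≈-trans (combination-- (A i) (𝟙 i) u g)
          (Equivalence.from (x-y≈0⇔x≈y _ _) (≈-trans (≈-sym (e i g)) (≈-sym (sum-𝟙* (λ h → u h g) i))))) j)

  -- Two bases are exchanged by matrices with A · B = 𝟙 and B · A = 𝟙, whose traces agree.
  trace-dimension : ∀ {p k d e} {P : Vector Carrier k → Set p} → HasDimension P d → HasDimension P e →
                    ∑[ i < d ] 1# ≈ ∑[ i < e ] 1#
  trace-dimension {d = d} {e} X@(u , indep-u , _) Y@(v , indep-v , _) =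
    let A , u≋Av = change X Y
        B , v≋Bu = change Y X
        AB≋𝟙 = independent-cancel (A · B) indep-u
                 (≋-trans u≋Av (≋-trans (·-cong (≋-refl {A = A}) v≋Bu) (≋-sym (·-assoc A B u))))
        BA≋𝟙 = independent-cancel (B · A) indep-v
                 (≋-trans v≋Bu (≋-trans (·-cong (≋-refl {A = B}) u≋Av) (≋-sym (·-assoc B A v))))
    in begin
      ∑[ i < d ] 1#        ≈⟨ trace-𝟙 d ⟨
      trace (𝟙 {d})        ≈⟨ sum-cong (λ i → AB≋𝟙 i i) ⟨
      trace (A · B)        ≈⟨ trace-comm A B ⟩
      trace (B · A)        ≈⟨ sum-cong (λ i → BA≋𝟙 i i) ⟩
      trace (𝟙 {e})        ≈⟨ trace-𝟙 e ⟩
      ∑[ i < e ] 1#        ∎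

  Relations : ∀ {l k} → Vector (Vector Carrier k) l → Vector Carrier l → Set ℓ
  Relations N c = ∀ i → combination c N i ≈ 0#

  -- Rank-nullity with an explicit basis: `K` spans the relations, and `P` lifts a basis of the span
  -- along `N`. Any `x` differs from a combination of `P` by a relation.
  relations+span : ∀ {l k ν d} (N : Vector (Vector Carrier k) l) →
                   HasDimension (Relations N) ν → HasDimension (Span N) d → HasDimension {k = l} (λ _ → ⊤) (ν ℕ.+ d)
  relations+span {l} {k} {ν} {d} N X@(K , indep-K , span-K) Y@(u , indep-u , span-u) =
    K ++ P , independent , λ x → mk⇔ (λ _ → spanning x) (λ _ → tt)
    where
    P : Matrix d l
    P j = proj₁ (basis-member Y j)
    u≋PN : u ≋ P · N
    u≋PN j = proj₂ (basis-member Y j)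
    K·N : ∀ h i → combination (combination h K) N i ≈ 0#
    K·N h i = ≈-trans (≈-sym (combination-assoc h K N i))
      (sum-zero (λ j → ≈-trans (*-congˡ (basis-member X j i)) (zeroʳ (h j))))
    P·N : ∀ g i → combination (combination g P) N i ≈ combination g u i
    P·N g i = ≈-trans (≈-sym (combination-assoc g P N i)) (sum-cong (λ j → *-congˡ (≈-sym (u≋PN j i))))
    independent : LinearlyIndependent (K ++ P)
    independent c h = ↑-cases {k = ν} c₁≈0 c₂≈0
      where
      c₁ = λ j → c (j ↑ˡ d)
      c₂ = λ j → c (ν ↑ʳ j)
      split : ∀ i → combination c₁ K i + combination c₂ P i ≈ 0#
      split i = ≈-trans (≈-sym (combination-++ c K P i)) (h i)
      c₂≈0 : ∀ j → c₂ j ≈ 0#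
      -- Applying `N` to the vanishing combination kills the part along `K` and turns the part along
      -- `P` into a combination of the independent `u`.
      c₂≈0 = indep-u c₂ (λ i → begin
        combination c₂ u i
          ≈⟨ P·N c₂ i ⟨
        combination (combination c₂ P) N i
          ≈⟨ +-identityˡ _ ⟨
        0# + combination (combination c₂ P) N i
          ≈⟨ +-congʳ (K·N c₁ i) ⟨
        combination (combination c₁ K) N i + combination (combination c₂ P) N i
          ≈⟨ ∑-distrib-+ {l} _ _ ⟨
        ∑[ j < l ] (combination c₁ K j * N j i + combination c₂ P j * N j i)
          ≈⟨ sum-cong {l} (λ j → ≈-trans (≈-sym (distribʳ (N j i) _ _)) (≈-trans (*-congʳ (split j)) (zeroˡ _))) ⟩
        ∑[ j < l ] 0#
          ≈⟨ sum-replicate-zero l ⟩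
        0# ∎)
      c₁≈0 : ∀ j → c₁ j ≈ 0#
      c₁≈0 = indep-K c₁ (λ i → begin
        combination c₁ K i                         ≈⟨ +-identityʳ _ ⟨
        combination c₁ K i + 0#                    ≈⟨ +-congˡ
            (sum-zero (λ j → ≈-trans (*-congʳ (c₂≈0 j)) (zeroˡ (P j i)))) ⟨
        combination c₁ K i + combination c₂ P i    ≈⟨ split i ⟩
        0#                                         ∎)
    spanning : ∀ x → Span (K ++ P) x
    spanning x =
      let g , e = Equivalence.to (span-u (combination x N)) (x , λ i → ≈-refl)
          y = combination g P
          h , e′ = Equivalence.to (span-K (λ j → x j - y j)) (λ i → ≈-trans (combination-- x y N i)
                     (Equivalence.from (x-y≈0⇔x≈y _ _) (≈-trans (e i) (≈-sym (P·N g i)))))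
      in h ++ g , λ i → begin
        x i                                          ≈⟨ +-identityʳ _ ⟨
        x i + 0#                                     ≈⟨ +-congˡ (-‿inverseˡ (y i)) ⟨
        x i + (- y i + y i)                          ≈⟨ +-assoc _ _ _ ⟨
        x i - y i + y i                              ≈⟨ +-congʳ (e′ i) ⟩
        combination h K i + combination g P i
          ≈⟨ +-cong (sum-cong (λ j → *-congʳ (≈-reflexive (lookup-++ˡ h g j))))
                    (sum-cong (λ j → *-congʳ (≈-reflexive (lookup-++ʳ h g j)))) ⟨
        combination (λ j → (h ++ g) (j ↑ˡ d)) K i + combination (λ j → (h ++ g) (ν ↑ʳ j)) P i
          ≈⟨ combination-++ (h ++ g) K P i ⟨
        combination (h ++ g) (K ++ P) i              ∎

-- The largest invariant factor

module _ where

  open Integral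
  open Algebra.Properties.Semiring.Sum ℤ.+-*-semiring using (*-distribˡ-sum)

  Image : ∀ {k l} → Matrix k l → Vector ℤ k → Set
  Image N y = ∃[ x ] (∀ i → (N ∙ x) i ≡ y i)

  scale : ∀ {k} → ℤ → Vector ℤ k → Vector ℤ k
  scale s y i = s ℤ.* y i

  Image-cong : ∀ {k l} (N : Matrix k l) {y z} → (∀ i → y i ≡ z i) → Image N y → Image N z
  Image-cong N e (x , p) = x , λ i → trans (p i) (e i)

  ∙-scale : ∀ {k l} (N : Matrix k l) s x i → (N ∙ scale s x) i ≡ s ℤ.* (N ∙ x) i
  ∙-scale N s x i = trans (sum-cong (λ j → trans (sym (ℤ.*-assoc (N i j) s (x j)))
    (trans (cong (ℤ._* x j) (ℤ.*-comm (N i j) s)) (ℤ.*-assoc s (N i j) (x j)))))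
    (sym (*-distribˡ-sum s (λ j → N i j ℤ.* x j)))

  -- d is the exponent of the torsion subgroup of the cokernel of N.
  record Exponent {k l} (N : Matrix k l) (d : ℕ) : Set where
    field
      positive : 0 ℕ.< d
      torsion  : ∀ {s} y → s ≢ 0ℤ → Image N (scale s y) → Image N (scale (+ d) y)
      sharp    : ∃[ y ] (Image N (scale (+ d) y) × (∀ s → Image N (scale s y) → + d ℤ∣.∣ s))

  private

    Image-diagonal-[] : ∀ {k l} (y : Vector ℤ k) → Image (diagonal {k} {l} []) y ⇔ (∀ i → y i ≡ 0ℤ)
    Image-diagonal-[] {k} {l} y = mk⇔
      (λ (x , p) i → trans (sym (p i)) (sum-0* x))
      (λ y≡0 → (λ _ → 0ℤ) , λ i → trans (sum-0* {l} (λ _ → 0ℤ)) (sym (y≡0 i)))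

    Image-diagonal-∷ : ∀ {k l} d ds (y : Vector ℤ (suc k)) →
      Image (diagonal {suc k} {suc l} (d ∷ ds)) y ⇔ (+ d ℤ∣.∣ y zero × Image (diagonal {k} {l} ds) (y ∘ suc))
    Image-diagonal-∷ {k} {l} d ds y = mk⇔
      (λ (x , p) → ℤ∣.divides (x zero) (trans (sym (p zero)) (trans (at-zero x) (ℤ.*-comm (+ d) (x zero)))) ,
        x ∘ suc , λ i → trans (sym (at-suc x i)) (p (suc i)))
      (λ { (ℤ∣.divides q e , x , p) → q Vector.∷ x , λ where
        zero    → trans (at-zero (q Vector.∷ x)) (trans (ℤ.*-comm (+ d) q) (sym e))
        (suc i) → trans (at-suc (q Vector.∷ x) i) (p i) })
      where
      at-zero : ∀ (x : Vector ℤ (suc l)) → (diagonal {suc k} (d ∷ ds) ∙ x) zero ≡ + d ℤ.* x zero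
      at-zero x = trans (cong (ℤ._+_ (+ d ℤ.* x zero)) (sum-0* (x ∘ suc))) (ℤ.+-identityʳ _)
      at-suc : ∀ (x : Vector ℤ (suc l)) i → (diagonal {suc k} (d ∷ ds) ∙ x) (suc i) ≡ (diagonal ds ∙ (x ∘ suc)) i
      at-suc x i = trans (cong (ℤ._+ (diagonal ds ∙ (x ∘ suc)) i) (ℤ.*-zeroˡ (x zero))) (ℤ.+-identityˡ _)

    cancel-scale : ∀ {s a} → s ≢ 0ℤ → s ℤ.* a ≡ 0ℤ → a ≡ 0ℤ
    cancel-scale {s} s≢0 e with ℤ.i*j≡0⇒i≡0∨j≡0 s e
    ... | inj₁ s≡0 = contradiction s≡0 s≢0
    ... | inj₂ a≡0 = a≡0

    -- On the diagonal every factor divides `d`. Beyond the diagonal a torsion element has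
    -- coordinate zero, because ℤ has no zero divisors and `s` is nonzero.
    diagonal-torsion : ∀ {k l} ds {d s} y → length ds ℕ.≤ k → length ds ℕ.≤ l → All (ℕ∣._∣ d) ds → s ≢ 0ℤ →
                       Image (diagonal {k} {l} ds) (scale s y) → Image (diagonal {k} {l} ds) (scale (+ d) y)
    diagonal-torsion [] {d} {s} y _ _ _ s≢0 p = Equivalence.from (Image-diagonal-[] _) λ i →
      trans (cong (ℤ._*_ (+ d)) (cancel-scale s≢0 (Equivalence.to (Image-diagonal-[] (scale s y)) p i)))
          (ℤ.*-zeroʳ (+ d))
    diagonal-torsion (e ∷ ds) {d} {s} y (s≤s le) (s≤s le′) (e∣d ∷ ds∣d) s≢0 p =
      let _ , p′ = Equivalence.to (Image-diagonal-∷ e ds (scale s y)) p in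
      Equivalence.from (Image-diagonal-∷ e ds (scale (+ d) y))
        (ℤ∣.∣m⇒∣m*n {m = + d} (y zero) (ℤ∣.∣ᵤ⇒∣ e∣d) , diagonal-torsion ds (y ∘ suc) le le′ ds∣d s≢0 p′)

    -- The witness is the unit vector at the position of the last factor; its order in the cokernel
    -- is `d` itself.
    diagonal-sharp : ∀ {k l} ds {d} → length ds ℕ.≤ k → length ds ℕ.≤ l → List.last ds ≡ just d →
                     ∃[ y ] (Image (diagonal {k} {l} ds) (scale (+ d) y) ×
                             (∀ s → Image (diagonal {k} {l} ds) (scale s y) → + d ℤ∣.∣ s))
    diagonal-sharp (d ∷ []) (s≤s _) (s≤s _) refl = y ,
      Equivalence.from (Image-diagonal-∷ d [] (scale (+ d) y))
        (ℤ∣.∣m⇒∣m*n 1ℤ ℤ∣.∣-refl , Equivalence.from (Image-diagonal-[] _) λ i → ℤ.*-zeroʳ (+ d)) ,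
      λ s p → subst (+ d ℤ∣.∣_) (ℤ.*-identityʳ s) (proj₁ (Equivalence.to (Image-diagonal-∷ d [] (scale s y)) p))
      where
      y : Vector ℤ _
      y = 1ℤ Vector.∷ (λ _ → 0ℤ)
    diagonal-sharp (e ∷ ds@(_ ∷ _)) {d} (s≤s le) (s≤s le′) last≡d =
      let y , p , least = diagonal-sharp ds le le′ last≡d in
      0ℤ Vector.∷ y ,
      Equivalence.from (Image-diagonal-∷ e ds (scale (+ d) (0ℤ Vector.∷ y)))
        (subst (+ e ℤ∣.∣_) (sym (ℤ.*-zeroʳ (+ d))) (ℤ∣.divides 0ℤ (sym (ℤ.*-zeroˡ (+ e)))) , p) ,
      λ s p → least s (proj₂ (Equivalence.to (Image-diagonal-∷ e ds (scale s (0ℤ Vector.∷ y))) p))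

    ∣last : ∀ {d ds} → Linked ℕ∣._∣_ ds → List.last ds ≡ just d → All (ℕ∣._∣ d) ds
    ∣last []              ()
    ∣last [-]             refl = ℕ∣.∣-refl ∷ []
    ∣last (e∣e′ ∷ chain) last≡d with ∣last chain last≡d
    ... | e′∣d ∷ rest∣d = ℕ∣.∣-trans e∣e′ e′∣d ∷ e′∣d ∷ rest∣d

    last-satisfies : ∀ {P : ℕ → Set} {ds d} → All P ds → List.last ds ≡ just d → P d
    last-satisfies (p ∷ [])            refl   = p
    last-satisfies (_ ∷ ps@(_ ∷ _))    last≡d = last-satisfies ps last≡d

    ∙-assoc : ∀ {k l p} (A : Matrix k l) (B : Matrix l p) x i → ((A · B) ∙ x) i ≡ (A ∙ (B ∙ x)) i
    ∙-assoc A B x i = ·-assoc {r = 1} A B (λ j _ → x j) i zero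

    ∙-cong : ∀ {k l} {A B : Matrix k l} {x y} → A ≋ B → (∀ j → x j ≡ y j) → ∀ i → (A ∙ x) i ≡ (B ∙ y) i
    ∙-cong p q i = sum-cong (λ j → cong₂ ℤ._*_ (p i j) (q j))

    𝟙-∙ : ∀ {k} (x : Vector ℤ k) i → (𝟙 ∙ x) i ≡ x i
    𝟙-∙ x i = sum-𝟙* x i

    module _ {k l} {N D : Matrix k l} (N~D : N ~ D) where

      open _~_ N~D renaming (left to U; right to W)
      open Invertible left-invertible renaming (inverse to U⁻¹; inverseˡ to U⁻¹U; inverseʳ to UU⁻¹)
      open Invertible right-invertible renaming (inverse to W⁻¹; inverseʳ to VV⁻¹) hiding (inverseˡ)

      Dx : ∀ x i → (D ∙ x) i ≡ (U ∙ (N ∙ (W ∙ x))) i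
      Dx x i = trans (∙-cong (≋-sym left·A·right) (λ _ → refl) i)
        (trans (∙-assoc (U · N) W x i) (∙-assoc U N (W ∙ x) i))

      Image-~ : ∀ y → Image N y ⇔ Image D (U ∙ y)
      Image-~ y = mk⇔
        (λ (x , p) → W⁻¹ ∙ x , λ i → trans (Dx (W⁻¹ ∙ x) i) (∙-cong (≋-refl {A = U}) (λ j → trans
          (∙-cong (≋-refl {A = N}) (λ h → trans (sym (∙-assoc W W⁻¹ x h))
              (trans (∙-cong VV⁻¹ (λ _ → refl) h) (𝟙-∙ x h))) j)
          (p j)) i))
        (λ (x , p) → W ∙ x , λ i → trans (sym (collapse (N ∙ (W ∙ x)) i))
          (trans (∙-cong (≋-refl {A = U⁻¹}) (λ j → trans (sym (Dx x j)) (p j)) i) (collapse y i)))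
        where
        collapse : ∀ z i → (U⁻¹ ∙ (U ∙ z)) i ≡ z i
        collapse z i = trans (sym (∙-assoc U⁻¹ U z i)) (trans (∙-cong U⁻¹U (λ _ → refl) i) (𝟙-∙ z i))

    module _ {k l} {N D : Matrix k l} (N~D : N ~ D) where

      open _~_ N~D using () renaming (left to U; left-invertible to u)
      open Invertible u using () renaming (inverse to U⁻¹; inverseʳ to UU⁻¹)

      Exponent-~ : ∀ {d} → Exponent D d → Exponent N d
      Exponent-~ {d} E = record
        { positive = positive
        ; torsion  = λ {s} y s≢0 p → Equivalence.from (Image-~ N~D (scale (+ d) y))
            (Image-cong D (λ i → sym (∙-scale U (+ d) y i)) (torsion (U ∙ y) s≢0
              (Image-cong D (∙-scale U s y) (Equivalence.to (Image-~ N~D (scale s y)) p))))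
        ; sharp    = let y , p , least = sharp in U⁻¹ ∙ y ,
            Equivalence.from (Image-~ N~D _) (Image-cong D (λ i → sym (expand (+ d) y i)) p) ,
            λ s p → least s (Image-cong D (expand s y) (Equivalence.to (Image-~ N~D _) p))
        }
        where
        open Exponent E
        expand : ∀ s y i → (U ∙ scale s (U⁻¹ ∙ y)) i ≡ s ℤ.* y i
        expand s y i = trans (∙-scale U s (U⁻¹ ∙ y) i) (cong (s ℤ.*_)
          (trans (sym (∙-assoc U U⁻¹ y i)) (trans (∙-cong UU⁻¹ (λ _ → refl) i) (𝟙-∙ y i))))

    Zero-~ : ∀ {k l} {N : Matrix k l} → N ~ diagonal [] → ∀ {y} → Image N y → ∀ i → y i ≡ 0ℤ
    Zero-~ {N = N} N~0@(equivalence {U} {W} u v _) {y} p i =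
      let x , q = Equivalence.to (Image-~ N~0 y) p
          Uy≡0  = λ j → trans (sym (q j)) (sum-0* x)
      in trans (sym (trans (sym (∙-assoc U⁻¹ U y i)) (trans (∙-cong (Invertible.inverseˡ u) (λ _ → refl) i) (𝟙-∙ y i))))
         (trans (∙-cong (≋-refl {A = U⁻¹}) Uy≡0 i) (sum-*0 (U⁻¹ i)))
      where U⁻¹ = Invertible.inverse u

  -- A matrix without invariant factors receives the default value 0, which is not a positive
  -- exponent; it is split off as the case where the image is zero.
  largestInvariantFactor-exponent : ∀ {k l} (N : Matrix k l) →
    (∀ {y} → Image N y → ∀ i → y i ≡ 0ℤ) ⊎ Exponent N (largestInvariantFactor N)
  largestInvariantFactor-exponent {k} {l} N with smithNormalForm N
  ... | s = by-last (List.last factors) refl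
    where
    open SmithNormalForm s
    by-last : ∀ d → List.last factors ≡ d → (∀ {y} → Image N y → ∀ i → y i ≡ 0ℤ) ⊎ Exponent N (fromMaybe 0 d)
    by-last nothing e = inj₁ (Zero-~ (subst (λ ds → N ~ diagonal ds) (last-nothing factors e) equivalent))
      where
      last-nothing : ∀ (ds : List ℕ) → List.last ds ≡ nothing → ds ≡ []
      last-nothing []               _ = refl
      last-nothing (_ ∷ ds@(_ ∷ _)) e with last-nothing ds e
      ... | ()
    by-last (just d) e = inj₂ (Exponent-~ equivalent (record
      { positive = last-satisfies positive e
      ; torsion  = λ y → diagonal-torsion factors y ≤rows ≤columns (∣last chain e)
      ; sharp    = diagonal-sharp factors ≤rows ≤columns e
      }))

-- The matrix M̄

elements-∈ : ∀ {m} (S : Subset m) i → elements S i ∈ S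
elements-∈ (inside  ∷ S) zero    = here
elements-∈ (inside  ∷ S) (suc i) = there (elements-∈ S i)
elements-∈ (outside ∷ S) i       = there (elements-∈ S i)

elements-onto : ∀ {m} (S : Subset m) {e} → e ∈ S → ∃[ i ] elements S i ≡ e
elements-onto (inside  ∷ S) here        = zero , refl
elements-onto (inside  ∷ S) (there e∈S) = let i , p = elements-onto S e∈S in suc i , cong suc p
elements-onto (outside ∷ S) (there e∈S) = let i , p = elements-onto S e∈S in i , cong suc p

module ℤ-Boundary = Boundary ℤ.+-*-commutativeRing

-- For a loop the two indicators cancel, in agreement with the zero column prescribed for loops.
incidence-incident : ∀ {n m} (G : Graph n m) v e → incidence G v e ≡ ℤ-Boundary.incident (head G e) (tail G e) v
incidence-incident G v e with head G e Fin.≟ tail G e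
... | yes h≡t rewrite h≡t = sym (ℤ.+-inverseʳ (Integral.𝟙 (tail G e) v))
... | no h≢t with head G e Fin.≟ v | tail G e Fin.≟ v
...   | yes h≡v | yes t≡v = contradiction (trans h≡v (sym t≡v)) h≢t
...   | yes _   | no _    = refl
...   | no _    | yes _   = refl
...   | no _    | no _    = refl

-- `M̄` is an integer matrix read in three rings: in ℚ for its rank, in ℝ for the arrangement, and
-- in ℤ, with `φ` the identity, for its cokernel.
module BaseChange {a ℓ} (R : CommutativeRing a ℓ) (φ : ℤ → CommutativeRing.Carrier R)
  (isHom : RingMorphisms.IsRingHomomorphism ℤ.+-*-rawRing (CommutativeRing.rawRing R) φ) where

  open CommutativeRing R hiding (zero; refl; sym; trans; isEquivalence)
  open CommutativeRing R using () renaming (refl to ≈-refl; sym to ≈-sym; trans to ≈-trans; reflexive to ≈-reflexive)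
  open Algebra.Properties.Semiring.Sum semiring
  open Algebra.Properties.Ring ring
  open LinearAlgebra R
  open Boundary R
  open Dimension R
  open Relation.Binary.Reasoning.Setoid setoid
  open RingMorphisms.IsRingHomomorphism isHom using (+-homo; *-homo; 0#-homo; 1#-homo; -‿homo)

  φ-𝟙 : ∀ {k} (i j : Fin k) → φ (Integral.𝟙 i j) ≈ 𝟙 i j
  φ-𝟙 i j with does (i Fin.≟ j)
  ... | true  = 1#-homo
  ... | false = 0#-homo

  φ-sum : ∀ k (f : Fin k → ℤ) → φ (Algebra.Properties.Semiring.Sum.sum ℤ.+-*-semiring f) ≈ ∑[ i < k ] φ (f i)
  φ-sum zero    f = 0#-homo
  φ-sum (suc k) f = ≈-trans (+-homo _ _) (+-congˡ (φ-sum k (f ∘ suc)))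

  φ-Σκ : ∀ {n c} (κ : Fin n → Fin c) b k → φ (ℤ-Boundary.Σκ κ b k) ≈ Σκ κ (φ ∘ b) k
  φ-Σκ {n} κ b k = ≈-trans (φ-sum n _)
    (sum-cong (λ v → ≈-trans (*-homo (b v) (Integral.𝟙 (κ v) k)) (*-congˡ (φ-𝟙 (κ v) k))))

  φ-incidence : ∀ {n m} (G : Graph n m) v e → φ (incidence G v e) ≈ incident (head G e) (tail G e) v
  φ-incidence G v e = begin
    φ (incidence G v e)
      ≡⟨ cong φ (incidence-incident G v e) ⟩
    φ (Integral.𝟙 (head G e) v ℤ.- Integral.𝟙 (tail G e) v)
      ≈⟨ +-homo _ _ ⟩
    φ (Integral.𝟙 (head G e) v) + φ (ℤ.- Integral.𝟙 (tail G e) v)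
      ≈⟨ +-cong (φ-𝟙 (head G e) v) (≈-trans (-‿homo _) (-‿cong (φ-𝟙 (tail G e) v))) ⟩
    𝟙 (head G e) v - 𝟙 (tail G e) v ∎

  module _ {n m} (G : Graph n m) (b : Fin n → ℤ) (S : Subset m) where

    columns : Vector (Vector Carrier (n ℕ.+ ∣ S ∣)) (m ℕ.+ 1)
    columns j i = φ (M̄ G b S i j)

    edgePart : Vector Carrier (m ℕ.+ 1) → Vector Carrier m
    edgePart c e = c (e ↑ˡ 1)

    constantPart : Vector Carrier (m ℕ.+ 1) → Carrier
    constantPart c = c (m ↑ʳ zero)

    private
      combination-split : ∀ c i {row : Vector Carrier m} {t} →
        (∀ e → columns (e ↑ˡ 1) i ≈ row e) → columns (m ↑ʳ zero) i ≈ t →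
        combination c columns i ≈ ∑[ e < m ] (edgePart c e * row e) + constantPart c * t
      combination-split c i p q = ≈-trans (sum-++ m (λ j → c j * columns j i))
        (+-cong (sum-cong {m} (λ e → *-congˡ (p e))) (≈-trans (+-identityʳ _) (*-congˡ q)))

      top : ∀ v j → M̄ G b S (v ↑ˡ ∣ S ∣) j ≡ (incidence G v ++ (λ _ → b v)) j
      top v j = cong (λ r → r j) (lookup-++ˡ {n = ∣ S ∣} (λ v → incidence G v ++ (λ _ → b v))
                                   (λ i → Integral.𝟙 (elements S i) ++ (λ _ → 0ℤ)) v)

      bottom : ∀ i j → M̄ G b S (n ↑ʳ i) j ≡ (Integral.𝟙 (elements S i) ++ (λ _ → 0ℤ)) j
      bottom i j = cong (λ r → r j) (lookup-++ʳ {m = n} (λ v → incidence G v ++ (λ _ → b v))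
                                      (λ i → Integral.𝟙 (elements S i) ++ (λ _ → 0ℤ)) i)

    combination-vertex : ∀ c v → combination c columns (v ↑ˡ ∣ S ∣) ≈ ∂ G (edgePart c) v + constantPart c * φ (b v)
    combination-vertex c v = ≈-trans
      (combination-split c (v ↑ˡ ∣ S ∣)
        (λ e → ≈-trans (≈-reflexive (cong φ (trans (top v (e ↑ˡ 1)) (lookup-++ˡ (incidence G v) (λ _ → b v) e))))
            (φ-incidence G v e))
        (≈-reflexive (cong φ (trans (top v (m ↑ʳ zero)) (lookup-++ʳ (incidence G v) (λ _ → b v) zero)))))
      (+-congʳ (sum-cong {m} (λ e → *-comm (edgePart c e) _)))

    combination-element : ∀ c i → combination c columns (n ↑ʳ i) ≈ edgePart c (elements S i)
    combination-element c i = ≈-trans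
      (combination-split c (n ↑ʳ i)
        (λ e → ≈-trans (≈-reflexive (cong φ (trans (bottom i (e ↑ˡ 1))
            (lookup-++ˡ (Integral.𝟙 (elements S i)) (λ _ → 0ℤ) e)))) (φ-𝟙 (elements S i) e))
        (≈-trans (≈-reflexive (cong φ (trans (bottom i (m ↑ʳ zero))
            (lookup-++ʳ (Integral.𝟙 (elements S i)) (λ _ → 0ℤ) zero)))) 0#-homo))
      (≈-trans (+-cong (≈-trans (sum-cong {m} (λ e → *-comm (edgePart c e) _)) (sum-𝟙* (edgePart c) (elements S i)))
          (zeroʳ _))
        (+-identityʳ _))

    -- The relations between the columns, with the coefficient of the last column first.
    Augmented : Vector Carrier (suc m) → Set ℓ
    Augmented w = Null (λ v → ∂ G (w ∘ suc) v + w zero * φ (b v)) × Vanishes S (w ∘ suc)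

    relations⇔ : ∀ c → Relations columns c ⇔ Augmented (constantPart c Vector.∷ edgePart c)
    relations⇔ c = mk⇔
      (λ h → (λ v → ≈-trans (≈-sym (combination-vertex c v)) (h (v ↑ˡ ∣ S ∣))) , λ e e∈S →
        let i , p = elements-onto S e∈S in
        subst (λ e → edgePart c e ≈ 0#) p (≈-trans (≈-sym (combination-element c i)) (h (n ↑ʳ i))))
      (λ (null , x≈0) → ↑-cases {k = n} (λ v → ≈-trans (combination-vertex c v) (null v))
        (λ i → ≈-trans (combination-element c i) (x≈0 _ (elements-∈ S i))))

    -- The last column is moved to the front because `dimension-pad` and `dimension-suc` split off
    -- coordinate zero.
    relations-dimension : ∀ {d} → HasDimension Augmented d → HasDimension (Relations columns) d
    relations-dimension = dimension-reindex f g
      (↑-cases {k = m} (λ e → cong f (g-↑ˡ e)) (λ { zero → cong f g-↑ʳ }))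
      (λ { zero → g-↑ʳ ; (suc e) → g-↑ˡ e })
      (λ c → mk⇔ (Equivalence.to (relations⇔ c)) (Equivalence.from (relations⇔ c)))
      where
      f : Fin (suc m) → Fin (m ℕ.+ 1)
      f zero    = m ↑ʳ zero
      f (suc e) = e ↑ˡ 1
      g : Fin (m ℕ.+ 1) → Fin (suc m)
      g j = [ suc , (λ _ → zero) ]′ (splitAt m j)
      g-↑ˡ : ∀ e → g (e ↑ˡ 1) ≡ suc e
      g-↑ˡ e = cong [ suc , (λ _ → zero) ]′ (Fin.splitAt-↑ˡ m e 1)
      g-↑ʳ : g (m ↑ʳ zero) ≡ zero
      g-↑ʳ = cong [ suc , (λ _ → zero) ]′ (Fin.splitAt-↑ʳ m 1 zero)

    module _ {c ν} {κ : Fin n → Fin c} (B : Build G S κ ν) where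

      β : Vector ℤ c
      β = ℤ-Boundary.Σκ κ b

      solvable⇒ : ∀ {x} → Vanishes S x → (∀ v → ∂ G x v ≈ φ (b v)) → ∀ k → φ (β k) ≈ 0#
      solvable⇒ {x} x≈0 ∂x k = begin
        φ (β k)           ≈⟨ φ-Σκ κ b k ⟩
        Σκ κ (φ ∘ b) k    ≈⟨ Σκ-cong κ ∂x k ⟨
        Σκ κ (∂ G x) k    ≈⟨ Σκ-∂-null κ {G = G} (IsQuotient.compatible (isQuotient B)) x≈0 k ⟩
        0#                ∎

      solvable⇐ : (∀ k → β k ≡ 0ℤ) → ∃[ x ] (Vanishes S x × (∀ v → ∂ G x v ≈ φ (b v)))
      solvable⇐ β≡0 = exact B (φ ∘ b) (λ k → ≈-trans (≈-sym (φ-Σκ κ b k))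
        (≈-trans (≈-reflexive (cong φ (β≡0 k))) 0#-homo))

      -- Summing a relation over a component kills its edge part and leaves only the multiple of the
      -- last column.
      augmented⇒ : ∀ w → Augmented w → ∀ k → w zero * φ (β k) ≈ 0#
      augmented⇒ w (null , x≈0) k = begin
        w zero * φ (β k)                                                ≈⟨ *-congˡ (φ-Σκ κ b k) ⟩
        w zero * Σκ κ (φ ∘ b) k                                         ≈⟨ Σκ-* κ (w zero) (φ ∘ b) k ⟨
        Σκ κ (λ v → w zero * φ (b v)) k                                 ≈⟨ +-identityˡ _ ⟨
        0# + Σκ κ (λ v → w zero * φ (b v)) k                            ≈⟨ +-congʳ
            (Σκ-∂-null κ {G = G} (IsQuotient.compatible (isQuotient B)) x≈0 k) ⟨
        Σκ κ (∂ G (w ∘ suc)) k + Σκ κ (λ v → w zero * φ (b v)) k        ≈⟨ Σκ-+ κ (∂ G (w ∘ suc))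
            (λ v → w zero * φ (b v)) k ⟨
        Σκ κ (λ v → ∂ G (w ∘ suc) v + w zero * φ (b v)) k               ≈⟨ Σκ-cong κ null k ⟩
        Σκ κ (λ _ → 0#) k                                               ≈⟨ Σκ-0 κ k ⟩
        0#                                                              ∎

      -- A flow `z` expresses the last column through the edge columns, which yields one relation
      -- beyond the cycles. The shear by `z` separates it from them.
      augmented-consistent : (∀ k → β k ≡ 0ℤ) → HasDimension Augmented (suc ν)
      augmented-consistent β≡0 with solvable⇐ β≡0
      ... | z , z≈0 , ∂z = dimension-suc z (λ w → mk⇔
        (λ (null , x≈0) → (λ v → ≈-trans (absorb w v) (null v)) , λ e e∈S →
          ≈-trans (+-cong (x≈0 e e∈S) (≈-trans (*-congˡ (z≈0 e e∈S)) (zeroʳ _))) (+-identityʳ 0#))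
        (λ (null , x≈0) → (λ v → ≈-trans (≈-sym (absorb w v)) (null v)) , λ e e∈S →
          ≈-trans (≈-sym (≈-trans (+-congˡ (≈-trans (*-congˡ (z≈0 e e∈S)) (zeroʳ _))) (+-identityʳ _))) (x≈0 e e∈S)))
        (kernel-dimension B)
        where
        absorb : ∀ w v → ∂ G (λ e → w (suc e) + w zero * z e) v ≈ ∂ G (w ∘ suc) v + w zero * φ (b v)
        absorb w v = ≈-trans (∂-+* G (w ∘ suc) (w zero) z v) (+-congˡ (*-congˡ (∂z v)))

      -- `cancel` is what a field supplies as soon as one entry of `β` is nonzero. The last column
      -- then has coefficient zero in every relation, and only cycles remain.
      augmented-inconsistent : (∀ t → (∀ k → t * φ (β k) ≈ 0#) → t ≈ 0#) → HasDimension Augmented ν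
      augmented-inconsistent cancel = dimension-pad (λ w → mk⇔
        (λ aug@(null , x≈0) → let w₀ = cancel (w zero) (augmented⇒ w aug) in
          w₀ , (λ v → ≈-trans (≈-sym (drop w w₀ v)) (null v)) , x≈0)
        (λ (w₀ , null , x≈0) → (λ v → ≈-trans (drop w w₀ v) (null v)) , x≈0))
        (kernel-dimension B)
        where
        drop : ∀ w → w zero ≈ 0# → ∀ v → ∂ G (w ∘ suc) v + w zero * φ (b v) ≈ ∂ G (w ∘ suc) v
        drop w w₀ v = ≈-trans (+-congˡ (≈-trans (*-congʳ w₀) (zeroˡ _))) (+-identityʳ _)

-- The rational rank of `M̄`

fromℤ : ℤ → ℚ
fromℤ z = z ℚ./ 1

private
  -- Equations between normalised fractions are checked on unnormalised ones, where with denominator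
  -- 1 they become integer identities.
  fromℤ-via : ∀ {p} i → ℚ.toℚᵘ p ℚᵘ.≃ ℚᵘ.mkℚᵘ i 0 → p ≡ fromℤ i
  fromℤ-via {p} i e = trans (sym (ℚ.fromℚᵘ-toℚᵘ p)) (ℚ.fromℚᵘ-cong e)

  toℚᵘ-fromℤ : ∀ i → ℚ.toℚᵘ (fromℤ i) ℚᵘ.≃ ℚᵘ.mkℚᵘ i 0
  toℚᵘ-fromℤ i = ℚ.toℚᵘ-fromℚᵘ (ℚᵘ.mkℚᵘ i 0)

fromℤ-isRingHomomorphism : RingMorphisms.IsRingHomomorphism ℤ.+-*-rawRing ℚ.+-*-rawRing fromℤ
fromℤ-isRingHomomorphism = record
  { isSemiringHomomorphism = record
    { isNearSemiringHomomorphism = record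
      { +-isMonoidHomomorphism = record
        { isMagmaHomomorphism = record
          { isRelHomomorphism = record { cong = cong fromℤ }
          ; homo = λ i j → sym (fromℤ-via (i ℤ.+ j) (ℚᵘ.≃-trans (ℚ.toℚᵘ-homo-+ (fromℤ i) (fromℤ j))
              (ℚᵘ.≃-trans (ℚᵘ.+-cong (toℚᵘ-fromℤ i) (toℚᵘ-fromℤ j))
                (ℚᵘ.*≡* (solve 2 (λ i j → (i :* con 1ℤ :+ j :* con 1ℤ) :* con 1ℤ := (i :+ j) :* con 1ℤ) refl i j)))))
          }
        ; ε-homo = refl
        }
      ; *-homo = λ i j → sym (fromℤ-via (i ℤ.* j) (ℚᵘ.≃-trans (ℚ.toℚᵘ-homo-* (fromℤ i) (fromℤ j))
          (ℚᵘ.≃-trans (ℚᵘ.*-cong (toℚᵘ-fromℤ i) (toℚᵘ-fromℤ j)) (ℚᵘ.*≡* refl))))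
      }
    ; 1#-homo = refl
    }
  ; -‿homo = λ i → sym (fromℤ-via (ℤ.- i) (ℚᵘ.≃-trans (ℚ.toℚᵘ-homo‿- (fromℤ i))
      (ℚᵘ.≃-trans (ℚᵘ.-‿cong (toℚᵘ-fromℤ i)) (ℚᵘ.*≡* refl))))
  }
  where open Data.Integer.Solver.+-*-Solver

fromℤ-injective : ∀ {i j} → fromℤ i ≡ fromℤ j → i ≡ j
fromℤ-injective {i} {j} e with ℚ.fromℚᵘ-injective {ℚᵘ.mkℚᵘ i 0} {ℚᵘ.mkℚᵘ j 0} e
... | ℚᵘ.*≡* p = trans (sym (ℤ.*-identityʳ i)) (trans p (ℤ.*-identityʳ j))

module ℚ-Change = BaseChange ℚ.+-*-commutativeRing fromℤ fromℤ-isRingHomomorphism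
module ℤ-Change = BaseChange ℤ.+-*-commutativeRing (λ z → z) (Identity.isRingHomomorphism ℤ.+-*-rawRing refl)
module ℚ-Dimension = Dimension ℚ.+-*-commutativeRing

nullity≤edges : ∀ {n m c ν} {G : Graph n m} {S} {κ : Fin n → Fin c} → Build G S κ ν → ν ℕ.≤ m
nullity≤edges empty        = z≤n
nullity≤edges (removed B)  = ℕ.m≤n⇒m≤1+n (nullity≤edges B)
nullity≤edges (cycle _ B)  = s≤s (nullity≤edges B)
nullity≤edges (bridge _ B) = ℕ.m≤n⇒m≤1+n (nullity≤edges B)

private
  -- Characteristic zero enters here: `trace-dimension` equates only multiples of 1 in the ring, and
  -- the injectivity of `fromℤ` turns these into equal dimensions.
  ∑1 : ∀ k → Algebra.Properties.Semiring.Sum.sum (CommutativeRing.semiring ℚ.+-*-commutativeRing) {k} (λ _ → 1ℚ)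
             ≡ fromℤ (+ k)
  ∑1 zero    = refl
  ∑1 (suc k) = trans (cong (ℚ._+_ 1ℚ) (∑1 k))
    (sym (RingMorphisms.IsRingHomomorphism.+-homo fromℤ-isRingHomomorphism 1ℤ (+ k)))

rank+relations : ∀ {n m ν} (G : Graph n m) b S →
  Rational.HasDimension (ℚ-Dimension.Relations (ℚ-Change.columns G b S)) ν → ν ℕ.+ rank (M̄ G b S) ≡ suc m
rank+relations {m = m} {ν} G b S dim = trans
  (ℤ.+-injective (fromℤ-injective (trans (sym (∑1 (ν ℕ.+ rank (M̄ G b S)))) (trans
    (ℚ-Dimension.trace-dimension
      (ℚ-Dimension.relations+span (ℚ-Change.columns G b S) dim (proj₂ (span-dimension (ℚ-Change.columns G b S))))
      (ℚ-Dimension.full-dimension (m ℕ.+ 1)))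
    (∑1 (m ℕ.+ 1))))))
  (ℕ.+-comm m 1)

-- The integral image and cokernel of `M̄`

module _ where

  open ℤ-Boundary using (∂; Σκ; Null; Vanishes; Σκ-cong; Σκ-0; Σκ-+; Σκ-*; Σκ--; Σκ-∂-null; Σκ-𝟙; ∂-+*; ∂-cong; exact)

  extend : ∀ {m} (S : Subset m) → Vector ℤ ∣ S ∣ → Vector ℤ m
  extend (inside  ∷ S) z zero    = z zero
  extend (inside  ∷ S) z (suc e) = extend S (z ∘ suc) e
  extend (outside ∷ S) z zero    = 0ℤ
  extend (outside ∷ S) z (suc e) = extend S z e

  extend-elements : ∀ {m} (S : Subset m) z i → extend S z (elements S i) ≡ z i
  extend-elements (inside  ∷ S) z zero    = refl
  extend-elements (inside  ∷ S) z (suc i) = extend-elements S (z ∘ suc) i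
  extend-elements (outside ∷ S) z i       = extend-elements S z i

  extend-zero : ∀ {m} (S : Subset m) {z} → (∀ i → z i ≡ 0ℤ) → ∀ e → extend S z e ≡ 0ℤ
  extend-zero (inside  ∷ S) z≡0 zero    = z≡0 zero
  extend-zero (inside  ∷ S) z≡0 (suc e) = extend-zero S (z≡0 ∘ suc) e
  extend-zero (outside ∷ S) z≡0 zero    = refl
  extend-zero (outside ∷ S) z≡0 (suc e) = extend-zero S z≡0 e

  extend-scale : ∀ {m} (S : Subset m) s z e → extend S (scale s z) e ≡ s ℤ.* extend S z e
  extend-scale (inside  ∷ S) s z zero    = refl
  extend-scale (inside  ∷ S) s z (suc e) = extend-scale S s (z ∘ suc) e
  extend-scale (outside ∷ S) s z zero    = sym (ℤ.*-zeroʳ s)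
  extend-scale (outside ∷ S) s z (suc e) = extend-scale S s z e

  ∂-0 : ∀ {n m} (G : Graph n m) v → ∂ G (λ _ → 0ℤ) v ≡ 0ℤ
  ∂-0 {m = m} G v = Integral.sum-*0 {m} (λ e → ℤ-Boundary.incident (head G e) (tail G e) v)

  ∂-scale : ∀ {n m} (G : Graph n m) s x v → ∂ G (scale s x) v ≡ s ℤ.* ∂ G x v
  ∂-scale G s x v = trans (∂-cong G (λ e → sym (ℤ.+-identityˡ _)) v)
    (trans (∂-+* G (λ _ → 0ℤ) s x v) (trans (cong (ℤ._+ s ℤ.* ∂ G x v) (∂-0 G v)) (ℤ.+-identityˡ _)))

  image⇔ : ∀ {n m} (G : Graph n m) b S y → Image (M̄ G b S) y ⇔
    (∃[ x ] ∃[ t ] ((∀ v → ∂ G x v ℤ.+ t ℤ.* b v ≡ y (v ↑ˡ ∣ S ∣)) × (∀ i → x (elements S i) ≡ y (n ↑ʳ i))))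
  image⇔ {n} {m} G b S y = mk⇔
    (λ (c , p) → edgePart c , constantPart c ,
      (λ v → trans (sym (combination-vertex G b S c v)) (trans (commute c (v ↑ˡ ∣ S ∣)) (p (v ↑ˡ ∣ S ∣)))) ,
      (λ i → trans (sym (combination-element G b S c i)) (trans (commute c (n ↑ʳ i)) (p (n ↑ʳ i)))))
    (λ (x , t , p , q) → let c = x ++ (λ _ → t)
                             cx = λ e → lookup-++ˡ {n = 1} x (λ _ → t) e
                             ct = lookup-++ʳ {n = 1} x (λ _ → t) zero in
      c , ↑-cases {k = n}
        (λ v → trans (sym (commute c (v ↑ˡ ∣ S ∣))) (trans (combination-vertex G b S c v)
          (trans (cong₂ ℤ._+_ (∂-cong G cx v) (cong (ℤ._* b v) ct)) (p v))))
        (λ i → trans (sym (commute c (n ↑ʳ i)))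
            (trans (combination-element G b S c i) (trans (cx (elements S i)) (q i)))))
    where
    open ℤ-Change using (columns; combination-vertex; combination-element)
    edgePart = ℤ-Change.edgePart G b S
    constantPart = ℤ-Change.constantPart G b S
    commute : ∀ c i → Integral.combination c (columns G b S) i ≡ (M̄ G b S Integral.∙ c) i
    commute c i = Integral.sum-cong {m ℕ.+ 1} (λ j → ℤ.*-comm (c j) (M̄ G b S i j))

  module _ {n m c ν} {G : Graph n m} {S} {κ : Fin n → Fin c} (B : Build G S κ ν) (b : Fin n → ℤ) where

    private
      β : Fin c → ℤ
      β = ℤ-Boundary.Σκ κ b

      nonzero : ¬ (∀ k → β k ≡ 0ℤ) → ∃[ k ] β k ≢ 0ℤ
      nonzero = Fin.¬∀⟶∃¬ c (λ k → β k ≡ 0ℤ) (λ k → β k ℤ.≟ 0ℤ)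

    -- `M̄` has `m + 1` columns, with `ν + 1` independent relations if `β` vanishes and only `ν`
    -- otherwise. So the rank is `m - ν` in the first case and one more in the second.
    rankCondition⇔ : RankCondition G b S ⇔ (∀ k → β k ≡ 0ℤ)
    rankCondition⇔ = mk⇔ to from
      where
      from : (∀ k → β k ≡ 0ℤ) → RankCondition G b S
      from β≡0 = begin
        rank (M̄ G b S)
          ≡⟨ ℕ.m+n∸m≡n ν _ ⟨
        ν ℕ.+ rank (M̄ G b S) ℕ.∸ ν
          ≡⟨ cong (ℕ._∸ ν) (ℕ.suc-injective (rank+relations G b S
               (ℚ-Change.relations-dimension G b S (ℚ-Change.augmented-consistent G b S B β≡0)))) ⟩
        m ℕ.∸ ν
          ≡⟨ cong (m ℕ.∸_) (nullity-build B) ⟨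
        m ℕ.∸ nullity-after-removing G S ∎
        where open ≡-Reasoning
      to : RankCondition G b S → ∀ k → β k ≡ 0ℤ
      to rank≡ k with β k ℤ.≟ 0ℤ
      ... | yes βk≡0 = βk≡0
      ... | no βk≢0 = contradiction (begin
        m
          ≡⟨ ℕ.m+[n∸m]≡n (nullity≤edges B) ⟨
        ν ℕ.+ (m ℕ.∸ ν)
          ≡⟨ cong (λ μ → ν ℕ.+ (m ℕ.∸ μ)) (nullity-build B) ⟨
        ν ℕ.+ (m ℕ.∸ nullity-after-removing G S)
          ≡⟨ cong (ν ℕ.+_) rank≡ ⟨
        ν ℕ.+ rank (M̄ G b S)
          ≡⟨ rank+relations G b S (ℚ-Change.relations-dimension G b S
               (ℚ-Change.augmented-inconsistent G b S B λ t h → cancel t (h k))) ⟩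
        suc m ∎)
            (ℕ.m≢1+m+n m ∘ λ e → trans e (sym (cong suc (ℕ.+-identityʳ m))))
        where
        open ≡-Reasoning
        instance
          φ≢0 : ℚ.NonZero (fromℤ (β k))
          φ≢0 = ℚ.≢-nonZero (βk≢0 ∘ fromℤ-injective)
        cancel : ∀ t → t ℚ.* fromℤ (β k) ≡ 0ℚ → t ≡ 0ℚ
        cancel t e = begin
          t                                                   ≡⟨ ℚ.*-identityʳ t ⟨
          t ℚ.* 1ℚ                                            ≡⟨ cong (t ℚ.*_) (ℚ.*-inverseʳ (fromℤ (β k))) ⟨
          t ℚ.* (fromℤ (β k) ℚ.* ℚ.1/ fromℤ (β k))            ≡⟨ ℚ.*-assoc t (fromℤ (β k)) (ℚ.1/ fromℤ (β k)) ⟨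
          t ℚ.* fromℤ (β k) ℚ.* ℚ.1/ fromℤ (β k)              ≡⟨ cong (ℚ._* ℚ.1/ fromℤ (β k)) e ⟩
          0ℚ ℚ.* ℚ.1/ fromℤ (β k)                             ≡⟨ ℚ.*-zeroˡ (ℚ.1/ fromℤ (β k)) ⟩
          0ℚ                                                  ∎

    -- Φ identifies the cokernel of the first m columns of M̄ with ℤᶜ, and takes the last column to β.
    private
      Φ : Vector ℤ (n ℕ.+ ∣ S ∣) → Vector ℤ c
      Φ y = Σκ κ (λ v → y (v ↑ˡ ∣ S ∣) ℤ.- ∂ G (extend S (λ i → y (n ↑ʳ i))) v)

      -- The lower block prescribes `x` on `S`. Subtracting its extension `z` leaves a vector
      -- vanishing on `S`, whose boundary has zero component sums; only the multiple of the last
      -- column survives.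
      image⇒ : ∀ y → Image (M̄ G b S) y → ∃[ t ] ∀ k → Φ y k ≡ t ℤ.* β k
      image⇒ y image = let x , t , p , q = Equivalence.to (image⇔ G b S y) image
                           z = extend S (λ i → y (n ↑ʳ i)) in
        t , λ k → begin
          Φ y k
            ≡⟨ Σκ-cong κ (λ v → trans (cong (ℤ._- ∂ G z v) (sym (p v)))
                 (trans (solve 3 (λ a d z → (a :+ d) :- z := (a :+ con -1ℤ :* z) :+ d) refl (∂ G x v) (t ℤ.* b v)
                     (∂ G z v))
                   (cong (ℤ._+ t ℤ.* b v) (sym (∂-+* G x -1ℤ z v))))) k ⟩
          Σκ κ (λ v → ∂ G (λ e → x e ℤ.+ -1ℤ ℤ.* z e) v ℤ.+ t ℤ.* b v) k
            ≡⟨ Σκ-+ κ (∂ G (λ e → x e ℤ.+ -1ℤ ℤ.* z e)) (λ v → t ℤ.* b v) k ⟩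
          Σκ κ (∂ G (λ e → x e ℤ.+ -1ℤ ℤ.* z e)) k ℤ.+ Σκ κ (λ v → t ℤ.* b v) k
            ≡⟨ cong₂ ℤ._+_ (Σκ-∂-null κ {G = G} (IsQuotient.compatible (isQuotient B)) (off x q) k) (Σκ-* κ t b k) ⟩
          0ℤ ℤ.+ t ℤ.* β k
            ≡⟨ ℤ.+-identityˡ _ ⟩
          t ℤ.* β k ∎
        where
        open ≡-Reasoning
        off : ∀ x → (∀ i → x (elements S i) ≡ y (n ↑ʳ i)) →
              Vanishes S (λ e → x e ℤ.+ -1ℤ ℤ.* extend S (λ i → y (n ↑ʳ i)) e)
        off x q e e∈S with elements-onto S e∈S
        ... | i , refl = trans (cong₂ (λ a d → a ℤ.+ -1ℤ ℤ.* d) (q i) (extend-elements S _ i))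
          (solve 1 (λ a → a :+ con -1ℤ :* a := con 0ℤ) refl (y (n ↑ʳ i)))

      -- The lower block is met by `z`. After the contributions of `z` and of the last column are
      -- removed, the upper block has zero component sums, and `exact` supplies edge values that
      -- leave `S` untouched.
      image⇐ : ∀ y t → (∀ k → Φ y k ≡ t ℤ.* β k) → Image (M̄ G b S) y
      image⇐ y t e = Equivalence.from (image⇔ G b S y) ((λ e → x e ℤ.+ 1ℤ ℤ.* z e) , t ,
        (λ v → trans (cong (ℤ._+ t ℤ.* b v) (trans (∂-+* G x 1ℤ z v) (cong (ℤ._+ 1ℤ ℤ.* ∂ G z v) (∂x v))))
          (solve 3 (λ y z d → ((y :- z) :- d) :+ con 1ℤ :* z :+ d := y) refl (y (v ↑ˡ ∣ S ∣)) (∂ G z v) (t ℤ.* b v))) ,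
        λ i → trans (cong₂ (λ a d → a ℤ.+ 1ℤ ℤ.* d) (x≡0 _ (elements-∈ S i)) (extend-elements S _ i))
          (trans (ℤ.+-identityˡ _) (ℤ.*-identityˡ _)))
        where
        z = extend S (λ i → y (n ↑ʳ i))
        r : Vector ℤ n
        r v = (y (v ↑ˡ ∣ S ∣) ℤ.- ∂ G z v) ℤ.- t ℤ.* b v
        solution : ∃[ x ] (Vanishes S x × (∀ v → ∂ G x v ≡ r v))
        solution = exact B r (λ k → trans (Σκ-- κ (λ v → y (v ↑ˡ ∣ S ∣) ℤ.- ∂ G z v) (λ v → t ℤ.* b v) k)
          (trans (cong₂ ℤ._-_ (e k) (Σκ-* κ t b k)) (ℤ.+-inverseʳ (t ℤ.* β k))))
        x = proj₁ solution
        x≡0 = proj₁ (proj₂ solution)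
        ∂x = proj₂ (proj₂ solution)

      Φ-scale : ∀ s y k → Φ (scale s y) k ≡ s ℤ.* Φ y k
      Φ-scale s y k = trans (Σκ-cong κ (λ v → trans
          (cong (λ d → s ℤ.* y (v ↑ˡ ∣ S ∣) ℤ.- d) (trans (∂-cong G (extend-scale S s _) v) (∂-scale G s _ v)))
          (solve 3 (λ s a d → s :* a :- s :* d := s :* (a :- d)) refl s (y (v ↑ˡ ∣ S ∣))
              (∂ G (extend S (λ i → y (n ↑ʳ i))) v))) k)
        (Σκ-* κ s _ k)

      lift : Vector ℤ n → Vector ℤ (n ℕ.+ ∣ S ∣)
      lift a = a ++ (λ _ → 0ℤ)

      Φ-lift : ∀ a k → Φ (lift a) k ≡ Σκ κ a k
      Φ-lift a k = Σκ-cong κ (λ v → trans (cong₂ ℤ._-_ (lookup-++ˡ {n = ∣ S ∣} a (λ _ → 0ℤ) v)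
        (trans (∂-cong G (extend-zero S (lookup-++ʳ {n = ∣ S ∣} a (λ _ → 0ℤ))) v) (∂-0 G v))) (ℤ.+-identityʳ (a v))) k

      -- Each entry of `γ` is placed on the representative of its class.
      Σκ-surjective : ∀ γ → ∃[ a ] ∀ k → Σκ κ a k ≡ γ k
      Σκ-surjective γ = Integral.combination γ E , λ k → begin
        Σκ κ (Integral.combination γ E) k
          ≡⟨ ℤ-Dimension.combination-assoc γ E (λ v → Integral.𝟙 (κ v)) k ⟨
        Integral.combination γ (E Integral.· (λ v → Integral.𝟙 (κ v))) k
          ≡⟨ ℤ-Dimension.combination-cong {c = γ} (λ _ → refl) (λ j i → trans
               (Integral.sum-𝟙* (λ v → Integral.𝟙 (κ v) i) (representative j)) (cong (λ h → Integral.𝟙 h i) (section j))) k ⟩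
        Integral.combination γ Integral.𝟙 k
          ≡⟨ Integral.sum-*𝟙 γ k ⟩
        γ k ∎
        where
        open ≡-Reasoning
        open IsQuotient (isQuotient B)
        module ℤ-Dimension = Dimension ℤ.+-*-commutativeRing
        E : Integral.Matrix c n
        E j = Integral.𝟙 (representative j)

    -- As `q` varies, this says that `d` is the greatest common divisor of the entries of `β`. The
    -- divisibility form is the one that `d̃` asks for, and it avoids forming the divisor.
    exponent-∣ : ∀ {d q} .{{_ : NonZero q}} → Exponent (M̄ G b S) d → ¬ (∀ k → β k ≡ 0ℤ) →
                 (q ℕ∣.∣ d) ⇔ (∀ k → + q ℤ∣.∣ β k)
    exponent-∣ {d} {q} E β≢0 = mk⇔ to from
      where
      open Exponent E
      k₀ = proj₁ (nonzero β≢0)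
      βk₀≢0 = proj₂ (nonzero β≢0)
      -- If dy is congruent to tβ, then d and t are coprime because no proper divisor of d annihilates y.
      to : q ℕ∣.∣ d → ∀ k → + q ℤ∣.∣ β k
      to q∣d k with sharp
      ... | y , image , least with image⇒ (scale (+ d) y) image
      ...   | t , e = ℤ∣.∣-trans (ℤ∣.∣ᵤ⇒∣ q∣d) (ℤ∣.∣ᵤ⇒∣ {+ d} {β k}
                        (Coprime.coprime-divisor (+ d) t (β k) (λ {i} → coprime {i})
                            (ℤ∣.∣⇒∣ᵤ {+ d} {t ℤ.* β k} (ℤ∣.divides (Φ y k)
                          (trans (sym (e k)) (trans (Φ-scale (+ d) y k) (ℤ.*-comm (+ d) (Φ y k))))))))
        where
        coprime : ∀ {i} → i ℕ∣.∣ d × i ℕ∣.∣ ℤ.∣ t ∣ → i ≡ 1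
        coprime {i} (ℕ∣.divides d′ d≡ , i∣t) = ℕ∣.∣1⇒≡1
            (ℕ∣.*-cancelˡ-∣ d′ (subst (d′ ℕ.* i ℕ∣.∣_) (sym (ℕ.*-identityʳ d′)) (subst (ℕ∣._∣ d′) d≡ (ℤ∣.∣⇒∣ᵤ d∣d′))))
          where
          t′ = ℤ∣.quotient (ℤ∣.∣ᵤ⇒∣ {+ i} {t} i∣t)
          t≡ : t ≡ t′ ℤ.* + i
          t≡ = ℤ∣._∣_.equality (ℤ∣.∣ᵤ⇒∣ {+ i} {t} i∣t)
          instance
            d′i≢0 : NonZero (d′ ℕ.* i)
            d′i≢0 = ℕ.>-nonZero (subst (0 ℕ.<_) d≡ positive)
            d′≢0 : NonZero d′
            d′≢0 = ℕ.m*n≢0⇒m≢0 d′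
            i≢0 : NonZero i
            i≢0 = ℕ.m*n≢0⇒n≢0 d′
          d∣d′ : + d ℤ∣.∣ + d′
          d∣d′ = least (+ d′) (image⇐ (scale (+ d′) y) t′ (λ k → trans (Φ-scale (+ d′) y k)
            (ℤ.*-cancelʳ-≡ (+ d′ ℤ.* Φ y k) (t′ ℤ.* β k) (+ i) (begin
              + d′ ℤ.* Φ y k ℤ.* + i     ≡⟨ solve 3 (λ d f i → d :* f :* i := d :* i :* f) refl (+ d′) (Φ y k) (+ i) ⟩
              + d′ ℤ.* + i ℤ.* Φ y k     ≡⟨ cong (ℤ._* Φ y k) (trans (sym (ℤ.pos-* d′ i)) (cong +_ (sym d≡))) ⟩
              + d ℤ.* Φ y k              ≡⟨ Φ-scale (+ d) y k ⟨
              Φ (scale (+ d) y) k        ≡⟨ e k ⟩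
              t ℤ.* β k                  ≡⟨ cong (ℤ._* β k) t≡ ⟩
              t′ ℤ.* + i ℤ.* β k         ≡⟨ solve 3 (λ t i b → t :* i :* b := t :* b :* i) refl t′ (+ i) (β k) ⟩
              t′ ℤ.* β k ℤ.* + i         ∎))))
            where open ≡-Reasoning
      from : (∀ k → + q ℤ∣.∣ β k) → q ℕ∣.∣ d
      from q∣β =
        -- Since `β = q γ`, the lift of `γ` is torsion in the cokernel, so `d` annihilates it:
        -- `d γ = t β = t q γ` for some `t`. A nonzero entry of `γ` cancels and leaves `d = t q`.
        let γ = λ k → ℤ∣.quotient (q∣β k)
            β≡ : ∀ k → β k ≡ γ k ℤ.* + q
            β≡ k = ℤ∣._∣_.equality (q∣β k)
            a , Σa = Σκ-surjective γ
            Φy : ∀ s k → Φ (scale s (lift a)) k ≡ s ℤ.* γ k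
            Φy s k = trans (Φ-scale s (lift a) k) (cong (s ℤ.*_) (trans (Φ-lift a k) (Σa k)))
            t , e = image⇒ _ (torsion (lift a) (λ q≡0 → ℕ.≢-nonZero⁻¹ q (ℤ.+-injective q≡0))
                      (image⇐ (scale (+ q) (lift a)) 1ℤ (λ k → trans (Φy (+ q) k)
                        (trans (ℤ.*-comm (+ q) (γ k)) (trans (sym (β≡ k)) (sym (ℤ.*-identityˡ (β k))))))))
            γ≢0 : γ k₀ ≢ 0ℤ
            γ≢0 = λ γ≡0 → βk₀≢0 (trans (β≡ k₀) (trans (cong (ℤ._* + q) γ≡0) (ℤ.*-zeroˡ (+ q))))
        in ℤ∣.∣⇒∣ᵤ {+ q} {+ d} (ℤ∣.divides t (ℤ.*-cancelʳ-≡ (+ d) (t ℤ.* + q) (γ k₀) {{ℤ.≢-nonZero γ≢0}}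
             (trans (sym (Φy (+ d) k₀)) (trans (e k₀) (trans (cong (t ℤ.*_) (β≡ k₀))
               (solve 3 (λ t g q → t :* (g :* q) := t :* q :* g) refl t (γ k₀) (+ q)))))))

    -- The last column of `M̄` is `b` padded with zeros. If the image were zero, then `b`, and with
    -- it `β`, would vanish.
    exponent : ¬ (∀ k → β k ≡ 0ℤ) → Exponent (M̄ G b S) (largestInvariantFactor (M̄ G b S))
    exponent β≢0 with largestInvariantFactor-exponent (M̄ G b S)
    ... | inj₂ E = E
    ... | inj₁ zero-image = contradiction (λ k → trans (sym (Φ-lift b k)) (trans
      (sym (trans (Φ-scale 1ℤ (lift b) k) (ℤ.*-identityˡ _)))
      (trans (Σκ-cong κ (λ v → cong₂ ℤ._-_ (b≡0 (v ↑ˡ ∣ S ∣))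
        (trans (∂-cong G (extend-zero S (λ i → b≡0 (n ↑ʳ i))) v) (∂-0 G v))) k) (Σκ-0 κ k)))) β≢0
      where
      b≡0 : ∀ i → scale 1ℤ (lift b) i ≡ 0ℤ
      b≡0 = zero-image (image⇐ (scale 1ℤ (lift b)) 1ℤ
          (λ k → trans (Φ-scale 1ℤ (lift b) k) (cong (1ℤ ℤ.*_) (Φ-lift b k))))

open Graph

-- Counting flows modulo q

∑ₗ : ∀ {A : Set} → List A → (A → ℤ) → ℤ
∑ₗ xs f = List.foldr ℤ._+_ 0ℤ (List.map f xs)

-- The Iverson bracket, by which lengths of filtered lists become integer sums that can be factored
-- and interchanged.
[_] : ∀ {p} {P : Set p} → Dec P → ℤ
[ P? ] = if does P? then 1ℤ else 0ℤ

[]-⇔ : ∀ {p r} {P : Set p} {R : Set r} → P ⇔ R → (P? : Dec P) (R? : Dec R) → [ P? ] ≡ [ R? ]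
[]-⇔ P⇔R P? R? = cong (λ t → if t then 1ℤ else 0ℤ) (does-⇔ P⇔R P? R?)

[]-× : ∀ {p r} {P : Set p} {R : Set r} (P? : Dec P) (R? : Dec R) → [ P? ×-dec R? ] ≡ [ P? ] ℤ.* [ R? ]
[]-× P? R? with does P? | does R?
... | false | false = refl
... | false | true  = refl
... | true  | false = refl
... | true  | true  = refl

[]-¬ : ∀ {p} {P : Set p} (P? : Dec P) → [ ¬? P? ] ≡ 1ℤ ℤ.- [ P? ]
[]-¬ P? with does P?
... | false = refl
... | true  = refl


module _ {A : Set} where

  ∑ₗ-cong : ∀ (xs : List A) {f g} → (∀ x → f x ≡ g x) → ∑ₗ xs f ≡ ∑ₗ xs g
  ∑ₗ-cong xs p = cong (List.foldr ℤ._+_ 0ℤ) (List.map-cong p xs)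

  ∑ₗ-+ : ∀ (xs : List A) f g → ∑ₗ xs (λ x → f x ℤ.+ g x) ≡ ∑ₗ xs f ℤ.+ ∑ₗ xs g
  ∑ₗ-+ []       f g = refl
  ∑ₗ-+ (x ∷ xs) f g = trans (cong (ℤ._+_ (f x ℤ.+ g x)) (∑ₗ-+ xs f g))
    (solve 4 (λ a b c d → (a :+ b) :+ (c :+ d) := (a :+ c) :+ (b :+ d)) refl (f x) (g x) (∑ₗ xs f) (∑ₗ xs g))

  ∑ₗ-0 : ∀ (xs : List A) → ∑ₗ xs (λ _ → 0ℤ) ≡ 0ℤ
  ∑ₗ-0 []       = refl
  ∑ₗ-0 (x ∷ xs) = trans (ℤ.+-identityˡ _) (∑ₗ-0 xs)

  ∑ₗ-* : ∀ (xs : List A) a f → ∑ₗ xs (λ x → a ℤ.* f x) ≡ a ℤ.* ∑ₗ xs f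
  ∑ₗ-* []       a f = sym (ℤ.*-zeroʳ a)
  ∑ₗ-* (x ∷ xs) a f = trans (cong (ℤ._+_ (a ℤ.* f x)) (∑ₗ-* xs a f)) (sym (ℤ.*-distribˡ-+ a (f x) (∑ₗ xs f)))

  ∑ₗ-++ : ∀ (xs ys : List A) f → ∑ₗ (xs List.++ ys) f ≡ ∑ₗ xs f ℤ.+ ∑ₗ ys f
  ∑ₗ-++ []       ys f = sym (ℤ.+-identityˡ _)
  ∑ₗ-++ (x ∷ xs) ys f = trans (cong (ℤ._+_ (f x)) (∑ₗ-++ xs ys f)) (sym (ℤ.+-assoc (f x) (∑ₗ xs f) (∑ₗ ys f)))

  ∑ₗ-filter : ∀ {p} {P : Pred A p} (P? : Decidable P) xs f → ∑ₗ (List.filter P? xs) f ≡ ∑ₗ xs (λ x → [ P? x ] ℤ.* f x)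
  ∑ₗ-filter P? []       f = refl
  ∑ₗ-filter P? (x ∷ xs) f with does (P? x)
  ... | true  = cong₂ ℤ._+_ (sym (ℤ.*-identityˡ (f x))) (∑ₗ-filter P? xs f)
  ... | false = trans (∑ₗ-filter P? xs f)
      (sym (trans (cong (ℤ._+ ∑ₗ xs (λ x → [ P? x ] ℤ.* f x)) (ℤ.*-zeroˡ (f x))) (ℤ.+-identityˡ _)))

  length-∑ₗ : ∀ (xs : List A) → + length xs ≡ ∑ₗ xs (λ _ → 1ℤ)
  length-∑ₗ []       = refl
  length-∑ₗ (x ∷ xs) = cong (ℤ._+_ 1ℤ) (length-∑ₗ xs)

  length-filter : ∀ {p} {P : Pred A p} (P? : Decidable P) xs → + length (List.filter P? xs) ≡ ∑ₗ xs (λ x → [ P? x ])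
  length-filter P? xs = trans (length-∑ₗ (List.filter P? xs))
    (trans (∑ₗ-filter P? xs (λ _ → 1ℤ)) (∑ₗ-cong xs (λ x → ℤ.*-identityʳ [ P? x ])))

  ∑ₗ-tabulate : ∀ {n} (g : Fin n → A) f →
                ∑ₗ (List.tabulate g) f ≡ Algebra.Properties.Semiring.Sum.sum ℤ.+-*-semiring (f ∘ g)
  ∑ₗ-tabulate {zero}  g f = refl
  ∑ₗ-tabulate {suc n} g f = cong (ℤ._+_ (f (g zero))) (∑ₗ-tabulate (g ∘ suc) f)

∑ₗ-words : ∀ {A : Set} (xs : List A) {m} (ws : List (Vec A m)) f →
           ∑ₗ (List.cartesianProductWith _∷_ xs ws) f ≡ ∑ₗ xs (λ x → ∑ₗ ws (λ w → f (x ∷ w)))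
∑ₗ-words []       ws f = refl
∑ₗ-words (x ∷ xs) ws f = trans (∑ₗ-++ (List.map (x ∷_) ws) _ f)
  (cong₂ ℤ._+_ (cong (List.foldr ℤ._+_ 0ℤ) (sym (List.map-∘ ws))) (∑ₗ-words xs ws f))

∑ₗ-swap : ∀ {A B : Set} (xs : List A) (ys : List B) (f : A → B → ℤ) →
         ∑ₗ xs (λ x → ∑ₗ ys (f x)) ≡ ∑ₗ ys (λ y → ∑ₗ xs (λ x → f x y))
∑ₗ-swap []       ys f = sym (∑ₗ-0 ys)
∑ₗ-swap (x ∷ xs) ys f = trans (cong (ℤ._+_ (∑ₗ ys (f x))) (∑ₗ-swap xs ys f))
  (sym (∑ₗ-+ ys (f x) (λ y → ∑ₗ xs (λ x → f x y))))

∑ₗ-select : ∀ {n} (a : Fin n) f → ∑ₗ (List.allFin n) (λ x → [ a Fin.≟ x ] ℤ.* f x) ≡ f a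
∑ₗ-select a f = trans (∑ₗ-tabulate (λ x → x) (λ x → [ a Fin.≟ x ] ℤ.* f x)) (Integral.sum-𝟙* f a)

∑ₗ-constant : ∀ n a → ∑ₗ (List.allFin n) (λ _ → a) ≡ + n ℤ.* a
∑ₗ-constant n a = trans (∑ₗ-tabulate {n = n} (λ x → x) (λ _ → a)) (go n)
  where
  go : ∀ n → Algebra.Properties.Semiring.Sum.sum ℤ.+-*-semiring {n} (λ _ → a) ≡ + n ℤ.* a
  go zero    = sym (ℤ.*-zeroˡ a)
  go (suc n) = trans (cong (ℤ._+_ a) (go n)) (sym (ℤ.suc-* (+ n) a))

-- ℤ/q as the setoid of integers up to congruence, so that sums in ℤ/q are literally sums in ℤ.
module Modular (q : ℕ) where

  infix 4 _≈_
  _≈_ : ℤ → ℤ → Set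
  x ≈ y = + q ℤ∣.∣ x ℤ.- y

  ≡⇒≈ : ∀ {x y} → x ≡ y → x ≈ y
  ≡⇒≈ {x} refl = ℤ∣.divides 0ℤ (trans (ℤ.+-inverseʳ x) (sym (ℤ.*-zeroˡ (+ q))))

  private
    ∣-resp : ∀ {x y} → x ≡ y → + q ℤ∣.∣ x → + q ℤ∣.∣ y
    ∣-resp refl p = p

  ≈-sym : ∀ {x y} → x ≈ y → y ≈ x
  ≈-sym {x} {y} p = ∣-resp (solve 2 (λ x y → :- (x :- y) := y :- x) refl x y) (ℤ∣.∣m⇒∣-m p)

  ≈-trans : ∀ {x y z} → x ≈ y → y ≈ z → x ≈ z
  ≈-trans {x} {y} {z} p r = ∣-resp (solve 3 (λ x y z → (x :- y) :+ (y :- z) := x :- z) refl x y z) (ℤ∣.∣m∣n⇒∣m+n p r)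

  commutativeRing : CommutativeRing 0ℓ 0ℓ
  commutativeRing = record
    { Carrier = ℤ
    ; _≈_ = _≈_
    ; _+_ = ℤ._+_
    ; _*_ = ℤ._*_
    ; -_ = ℤ.-_
    ; 0# = 0ℤ
    ; 1# = 1ℤ
    ; isCommutativeRing = record
      { isRing = record
        { +-isAbelianGroup = record
          { isGroup = record
            { isMonoid = record
              { isSemigroup = record
                { isMagma = record
                  { isEquivalence = record
                      { refl = λ {x} → ≡⇒≈ {x} refl
                      ; sym = λ {x} {y} → ≈-sym {x} {y}
                      ; trans = λ {x} {y} {z} → ≈-trans {x} {y} {z}
                      }
                  ; ∙-cong = λ {x} {y} {u} {v} p r → ∣-resp
                      (solve 4 (λ x y u v → (x :- y) :+ (u :- v) := (x :+ u) :- (y :+ v)) refl x y u v)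
                          (ℤ∣.∣m∣n⇒∣m+n p r)
                  }
                ; assoc = λ x y z → ≡⇒≈ (ℤ.+-assoc x y z)
                }
              ; identity = (λ x → ≡⇒≈ (ℤ.+-identityˡ x)) , λ x → ≡⇒≈ (ℤ.+-identityʳ x)
              }
            ; inverse = (λ x → ≡⇒≈ (ℤ.+-inverseˡ x)) , λ x → ≡⇒≈ (ℤ.+-inverseʳ x)
            ; ⁻¹-cong = λ {x} {y} p → ∣-resp (solve 2 (λ x y → :- (x :- y) := :- x :- :- y) refl x y) (ℤ∣.∣m⇒∣-m p)
            }
          ; comm = λ x y → ≡⇒≈ (ℤ.+-comm x y)
          }
        ; *-cong = λ {x} {y} {u} {v} p r → ∣-resp
            (solve 4 (λ x y u v → (x :- y) :* u :+ y :* (u :- v) := x :* u :- y :* v) refl x y u v)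
            (ℤ∣.∣m∣n⇒∣m+n (ℤ∣.∣m⇒∣m*n u p) (ℤ∣.∣n⇒∣m*n y r))
        ; *-assoc = λ x y z → ≡⇒≈ (ℤ.*-assoc x y z)
        ; *-identity = (λ x → ≡⇒≈ (ℤ.*-identityˡ x)) , λ x → ≡⇒≈ (ℤ.*-identityʳ x)
        ; distrib = (λ x y z → ≡⇒≈ (ℤ.*-distribˡ-+ x y z)) , λ x y z → ≡⇒≈ (ℤ.*-distribʳ-+ x y z)
        }
      ; *-comm = λ x y → ≡⇒≈ (ℤ.*-comm x y)
      }
    }

  open CommutativeRing commutativeRing public using (+-cong; *-cong; -‿cong)

  ≈0⇔∣ : ∀ {x} → x ≈ 0ℤ ⇔ + q ℤ∣.∣ x
  ≈0⇔∣ {x} = mk⇔ (∣-resp (ℤ.+-identityʳ x)) (∣-resp (sym (ℤ.+-identityʳ x)))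

  infix 4 _≈?_
  _≈?_ : ∀ x y → Dec (x ≈ y)
  x ≈? y = + q ℤ∣.∣? (x ℤ.- y)

  module _ .{{_ : NonZero q}} where

    value : Fin q → ℤ
    value x = + toℕ x

    value-reduce : ∀ z → value (reduce q z) ≈ z
    value-reduce z = ℤ∣.divides (ℤ.- (z /ℕ q)) (begin
      + toℕ (reduce q z) ℤ.- z                                 ≡⟨ cong (λ r → + r ℤ.- z) (Fin.toℕ-fromℕ< (n%ℕd<d z q)) ⟩
      + (z %ℕ q) ℤ.- z                                         ≡⟨ cong (ℤ._-_ (+ (z %ℕ q))) (a≡a%ℕn+[a/ℕn]*n z q) ⟩
      + (z %ℕ q) ℤ.- (+ (z %ℕ q) ℤ.+ (z /ℕ q) ℤ.* + q)         ≡⟨ solve 3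
          (λ r d q → r :- (r :+ d :* q) := :- d :* q) refl (+ (z %ℕ q)) (z /ℕ q) (+ q) ⟩
      ℤ.- (z /ℕ q) ℤ.* + q                                     ∎)
      where open ≡-Reasoning

    value-injective : ∀ {x y} → value x ≈ value y → x ≡ y
    value-injective {x} {y} p = Fin.toℕ-injective
        (ℤ.+-injective (ℤ.i-j≡0⇒i≡j (value x) (value y) (small (value x ℤ.- value y) p bound)))
      where
      bound : ℤ.∣ value x ℤ.- value y ∣ ℕ.< q
      bound = ℕ.≤-<-trans (subst (λ z → ℤ.∣ z ∣ ℕ.≤ toℕ x ℕ.⊔ toℕ y) (sym (ℤ.m-n≡m⊖n (toℕ x) (toℕ y)))
          (ℤ.∣m⊝n∣≤m⊔n (toℕ x) (toℕ y)))
                (ℕ.⊔-lub (Fin.toℕ<n x) (Fin.toℕ<n y))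
      small : ∀ z → + q ℤ∣.∣ z → ℤ.∣ z ∣ ℕ.< q → z ≡ 0ℤ
      small z d lt with ℤ.∣ z ∣ in e | ℤ∣.∣⇒∣ᵤ d
      ... | zero  | _  = ℤ.∣i∣≡0⇒i≡0 e
      ... | suc k | d′ = contradiction (ℕ∣.∣⇒≤ d′) (ℕ.<⇒≱ lt)

    value-reduce⇔ : ∀ x z → value x ≈ z ⇔ reduce q z ≡ x
    value-reduce⇔ x z = mk⇔
      (λ p → value-injective {reduce q z} {x}
          (≈-trans {value (reduce q z)} {z} {value x} (value-reduce z) (≈-sym {value x} {z} p)))
      (λ { refl → value-reduce z })

    value-0q : value 0q ≈ 0ℤ
    value-0q = value-reduce 0ℤ

module Count (q : ℕ) .{{_ : NonZero q}} where

  open Modular q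
  open Boundary commutativeRing

  values : ∀ {m} → Vec (Fin q) m → Vector ℤ m
  values f e = value (Vec.lookup f e)

  Solves : ∀ {n m} → Graph n m → Vector ℤ n → Vec (Fin q) m → Set
  Solves G b f = ∀ v → ∂ G (values f) v ≈ b v

  solves? : ∀ {n m} (G : Graph n m) b f → Dec (Solves G b f)
  solves? G b f = Fin.all? (λ v → ∂ G (values f) v ≈? b v)

  null? : ∀ {c} (y : Vector ℤ c) → Dec (Null y)
  null? y = Fin.all? (λ k → y k ≈? 0ℤ)

  δ : Fin q → ℤ
  δ x = [ 0q Fin.≟ x ]

  vanishing : ∀ {m} → Subset m → Vec (Fin q) m → ℤ
  vanishing []            []      = 1ℤ
  vanishing (inside  ∷ S) (x ∷ f) = δ x ℤ.* vanishing S f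
  vanishing (outside ∷ S) (x ∷ f) = vanishing S f

  nowhereVanishing : ∀ {m} → Vec (Fin q) m → ℤ
  nowhereVanishing []      = 1ℤ
  nowhereVanishing (x ∷ f) = (1ℤ ℤ.- δ x) ℤ.* nowhereVanishing f

  -- This expands the product of the factors `1 - δ x` over the edges: `inside` picks the term
  -- `- δ x` and `outside` picks 1.
  inclusion–exclusion : ∀ {m} (f : Vec (Fin q) m) → ∑ₗ (subsets m) (λ S → sign S ℤ.* vanishing S f) ≡ nowhereVanishing f
  inclusion–exclusion []      = refl
  inclusion–exclusion {suc m} (x ∷ f) = begin
    ∑ₗ (subsets (suc m)) (λ S → sign S ℤ.* vanishing S (x ∷ f))
      ≡⟨ ∑ₗ-words (inside ∷ outside ∷ []) (subsets m) (λ S → sign S ℤ.* vanishing S (x ∷ f)) ⟩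
    ∑ₗ (subsets m) (λ S → (-1ℤ ℤ.* sign S) ℤ.* (δ x ℤ.* vanishing S f)) ℤ.+ (∑ₗ (subsets m) t ℤ.+ 0ℤ)
      ≡⟨ cong (ℤ._+ (∑ₗ (subsets m) t ℤ.+ 0ℤ)) (trans
           (∑ₗ-cong (subsets m) (λ S → solve 3 (λ s d v → (con -1ℤ :* s) :* (d :* v) := (:- d) :* (s :* v)) refl
               (sign S) (δ x) (vanishing S f)))
           (∑ₗ-* (subsets m) (ℤ.- δ x) t)) ⟩
    (ℤ.- δ x) ℤ.* ∑ₗ (subsets m) t ℤ.+ (∑ₗ (subsets m) t ℤ.+ 0ℤ)
      ≡⟨ solve 2 (λ d s → (:- d) :* s :+ (s :+ con 0ℤ) := (con 1ℤ :- d) :* s) refl (δ x) (∑ₗ (subsets m) t) ⟩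
    (1ℤ ℤ.- δ x) ℤ.* ∑ₗ (subsets m) t
      ≡⟨ cong ((1ℤ ℤ.- δ x) ℤ.*_) (inclusion–exclusion f) ⟩
    (1ℤ ℤ.- δ x) ℤ.* nowhereVanishing f ∎
    where
    open ≡-Reasoning
    t : Subset m → ℤ
    t S = sign S ℤ.* vanishing S f

  nowhereVanishing-[] : ∀ {m} (f : Vec (Fin q) m) →
    [ Fin.all? (λ e → ¬? (Vec.lookup f e Fin.≟ 0q)) ] ≡ nowhereVanishing f
  nowhereVanishing-[] []      = refl
  nowhereVanishing-[] (x ∷ f) = begin
    [ Fin.all? (λ e → ¬? (Vec.lookup (x ∷ f) e Fin.≟ 0q)) ]
      ≡⟨ []-⇔ {P = ∀ e → Vec.lookup (x ∷ f) e ≢ 0q} {R = 0q ≢ x × (∀ e → Vec.lookup f e ≢ 0q)}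
           (mk⇔ (λ h → (λ e → h zero (sym e)) , (λ e → h (suc e)))
                (λ { (h , h′) zero → λ e → h (sym e) ; (h , h′) (suc e) → h′ e }))
           (Fin.all? (λ e → ¬? (Vec.lookup (x ∷ f) e Fin.≟ 0q)))
           (¬? (0q Fin.≟ x) ×-dec Fin.all? (λ e → ¬? (Vec.lookup f e Fin.≟ 0q))) ⟩
    [ ¬? (0q Fin.≟ x) ×-dec Fin.all? (λ e → ¬? (Vec.lookup f e Fin.≟ 0q)) ]
      ≡⟨ []-× (¬? (0q Fin.≟ x)) (Fin.all? (λ e → ¬? (Vec.lookup f e Fin.≟ 0q))) ⟩
    [ ¬? (0q Fin.≟ x) ] ℤ.* [ Fin.all? (λ e → ¬? (Vec.lookup f e Fin.≟ 0q)) ]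
      ≡⟨ cong₂ ℤ._*_ ([]-¬ (0q Fin.≟ x)) (nowhereVanishing-[] f) ⟩
    (1ℤ ℤ.- δ x) ℤ.* nowhereVanishing f ∎
    where open ≡-Reasoning

  private
    Words : ∀ m → List (Vec (Fin q) m)
    Words = words (List.allFin q)

    null-cong : ∀ {c} (y z : Vector ℤ c) → (∀ k → y k ≈ z k) → [ null? y ] ≡ [ null? z ]
    null-cong y z p = []-⇔ (mk⇔
      (λ h k → ≈-trans {z k} {y k} {0ℤ} (≈-sym {y k} {z k} (p k)) (h k))
      (λ h k → ≈-trans {y k} {z k} {0ℤ} (p k) (h k))) (null? y) (null? z)

    solves-∷ : ∀ {n m} (G : Graph n (suc m)) b x f →
               [ solves? G b (x ∷ f) ] ≡ [ solves? (rest G) (residue (head G zero) (tail G zero) (value x) b) f ]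
    solves-∷ G b x f = []-⇔ (mk⇔
      (λ h v → Equivalence.to (∂-residue G (values (x ∷ f)) b v) (h v))
      (λ h v → Equivalence.from (∂-residue G (values (x ∷ f)) b v) (h v)))
      (solves? G b (x ∷ f)) (solves? (rest G) (residue (head G zero) (tail G zero) (value x) b) f)

  #solutions : ∀ {n m} → Graph n m → Subset m → Vector ℤ n → ℤ
  #solutions {m = m} G S b = ∑ₗ (Words m) (λ f → vanishing S f ℤ.* [ solves? G b f ])

  -- Sum over the value of the first edge. A removed edge selects the value zero; on a cycle edge
  -- all `q` values leave the component sums unchanged; on a bridge exactly one value passes. The
  -- bracket makes the count zero when there is no solution.
  #solutions-formula : ∀ {n m c ν} {G : Graph n m} {S} {κ : Fin n → Fin c} → Build G S κ ν → ∀ b →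
                       #solutions G S b ≡ [ null? (Σκ κ b) ] ℤ.* + (q ℕ.^ ν)
  #solutions-formula {G = G} empty b = trans (ℤ.+-identityʳ _) (trans (ℤ.*-identityˡ _) (trans
    ([]-⇔ flip (solves? G b []) (null? (Σκ (λ v → v) b))) (sym (ℤ.*-identityʳ [ null? (Σκ (λ v → v) b) ]))))
    where
    flip : (∀ v → 0ℤ ≈ b v) ⇔ Null (Σκ (λ v → v) b)
    flip = mk⇔
      (λ h v → ≈-trans {Σκ (λ v → v) b v} {b v} {0ℤ} (Σκ-id b v) (≈-sym {0ℤ} {b v} (h v)))
      (λ h v → ≈-sym {b v} {0ℤ} (≈-trans {b v} {Σκ (λ v → v) b v} {0ℤ} (≈-sym {Σκ (λ v → v) b v} {b v} (Σκ-id b v))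
          (h v)))
  #solutions-formula {m = suc m} {ν = ν} {G} (removed {S = S} {κ = κ} B) b = begin
    ∑ₗ (Words (suc m)) (λ f → vanishing (inside ∷ S) f ℤ.* [ solves? G b f ])
      ≡⟨ ∑ₗ-words (List.allFin q) (Words m) _ ⟩
    ∑ₗ (List.allFin q) (λ x → ∑ₗ (Words m) (λ f → δ x ℤ.* vanishing S f ℤ.* [ solves? G b (x ∷ f) ]))
      ≡⟨ ∑ₗ-cong (List.allFin q) (λ x → trans
           (∑ₗ-cong (Words m) (λ f → trans (ℤ.*-assoc (δ x) (vanishing S f) _)
               (cong (λ p → δ x ℤ.* (vanishing S f ℤ.* p)) (solves-∷ G b x f))))
           (∑ₗ-* (Words m) (δ x) (λ f → vanishing S f ℤ.* [ solves? (rest G) (b′ x) f ]))) ⟩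
    ∑ₗ (List.allFin q) (λ x → δ x ℤ.* #solutions (rest G) S (b′ x))
      ≡⟨ ∑ₗ-select 0q (λ x → #solutions (rest G) S (b′ x)) ⟩
    #solutions (rest G) S (b′ 0q)
      ≡⟨ #solutions-formula B (b′ 0q) ⟩
    [ null? (Σκ κ (b′ 0q)) ] ℤ.* + (q ℕ.^ ν)
      ≡⟨ cong (ℤ._* + (q ℕ.^ ν)) (null-cong (Σκ κ (b′ 0q)) (Σκ κ b)
            (Σκ-cong κ {b′ 0q} {b} (residue-zero (head G zero) (tail G zero) b value-0q))) ⟩
    [ null? (Σκ κ b) ] ℤ.* + (q ℕ.^ ν) ∎
    where
    open ≡-Reasoning
    b′ : Fin q → Vector ℤ _
    b′ x = residue (head G zero) (tail G zero) (value x) b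
  #solutions-formula {m = suc m} {G = G} (cycle {S = S} {κ = κ} {ν = ν} h≡t B) b = begin
    ∑ₗ (Words (suc m)) (λ f → vanishing (outside ∷ S) f ℤ.* [ solves? G b f ])
      ≡⟨ ∑ₗ-words (List.allFin q) (Words m) _ ⟩
    ∑ₗ (List.allFin q) (λ x → ∑ₗ (Words m) (λ f → vanishing S f ℤ.* [ solves? G b (x ∷ f) ]))
      ≡⟨ ∑ₗ-cong (List.allFin q) (λ x → trans
           (∑ₗ-cong (Words m) (λ f → cong (vanishing S f ℤ.*_) (solves-∷ G b x f)))
           (trans (#solutions-formula B (b′ x))
             (cong (ℤ._* + (q ℕ.^ ν)) (null-cong (Σκ κ (b′ x)) (Σκ κ b) (λ k →
               ≈-trans {Σκ κ (b′ x) k} {residue (κ (head G zero)) (κ (tail G zero)) (value x) (Σκ κ b) k} {Σκ κ b k}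
                 (Σκ-residue κ (head G zero) (tail G zero) (value x) b k)
                     (residue-cycle h≡t (value x) (Σκ κ b) k)))))) ⟩
    ∑ₗ (List.allFin q) (λ x → [ null? (Σκ κ b) ] ℤ.* + (q ℕ.^ ν))
      ≡⟨ ∑ₗ-constant q _ ⟩
    + q ℤ.* ([ null? (Σκ κ b) ] ℤ.* + (q ℕ.^ ν))
      ≡⟨ solve 3 (λ q t p → q :* (t :* p) := t :* (q :* p)) refl (+ q) [ null? (Σκ κ b) ] (+ (q ℕ.^ ν)) ⟩
    [ null? (Σκ κ b) ] ℤ.* (+ q ℤ.* + (q ℕ.^ ν))
      ≡⟨ cong ([ null? (Σκ κ b) ] ℤ.*_) (ℤ.pos-* q (q ℕ.^ ν)) ⟨
    [ null? (Σκ κ b) ] ℤ.* + (q ℕ.^ suc ν) ∎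
    where
    open ≡-Reasoning
    b′ : Fin q → Vector ℤ _
    b′ x = residue (head G zero) (tail G zero) (value x) b
  #solutions-formula {m = suc m} {ν = ν} {G} (bridge {S = S} {κ = κ} h≢t B) b = begin
    ∑ₗ (Words (suc m)) (λ f → vanishing (outside ∷ S) f ℤ.* [ solves? G b f ])
      ≡⟨ ∑ₗ-words (List.allFin q) (Words m) _ ⟩
    ∑ₗ (List.allFin q) (λ x → ∑ₗ (Words m) (λ f → vanishing S f ℤ.* [ solves? G b (x ∷ f) ]))
      ≡⟨ ∑ₗ-cong (List.allFin q) (λ x → trans
           (∑ₗ-cong (Words m) (λ f → cong (vanishing S f ℤ.*_) (solves-∷ G b x f)))
           (trans (#solutions-formula B (b′ x)) (trans
             (cong (ℤ._* + (q ℕ.^ ν)) (trans ([]-⇔ (forced x) (null? (Σκ κ (b′ x)))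
                 ((a Fin.≟ x) ×-dec null? (Σκ (merge h≢t ∘ κ) b))) ([]-× (a Fin.≟ x) (null? (Σκ (merge h≢t ∘ κ) b)))))
             (ℤ.*-assoc [ a Fin.≟ x ] [ null? (Σκ (merge h≢t ∘ κ) b) ] (+ (q ℕ.^ ν)))))) ⟩
    ∑ₗ (List.allFin q) (λ x → [ a Fin.≟ x ] ℤ.* ([ null? (Σκ (merge h≢t ∘ κ) b) ] ℤ.* + (q ℕ.^ ν)))
      ≡⟨ ∑ₗ-select a (λ _ → [ null? (Σκ (merge h≢t ∘ κ) b) ] ℤ.* + (q ℕ.^ ν)) ⟩
    [ null? (Σκ (merge h≢t ∘ κ) b) ] ℤ.* + (q ℕ.^ ν) ∎
    where
    open ≡-Reasoning
    b′ : Fin q → Vector ℤ _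
    b′ x = residue (head G zero) (tail G zero) (value x) b
    a : Fin q
    a = reduce q (Σκ κ b (κ (head G zero)))
    forced : ∀ x → Null (Σκ κ (b′ x)) ⇔ (a ≡ x × Null (Σκ (merge h≢t ∘ κ) b))
    forced x = mk⇔
      (λ h → let x≈ , null = Equivalence.to (residue-bridge κ h≢t (value x) b) h in
        Equivalence.to (value-reduce⇔ x (Σκ κ b (κ (head G zero)))) x≈ , null)
      (λ (a≡x , null) → Equivalence.from (residue-bridge κ h≢t (value x) b)
          (Equivalence.from (value-reduce⇔ x (Σκ κ b (κ (head G zero)))) a≡x , null))

  private
    sum-filter : ∀ {A : Set} {p} {P : Pred A p} (P? : Decidable P) (f : A → Fin q) xs →
                 value (List.foldr _+q_ 0q (List.map f (List.filter P? xs))) ≈ ∑ₗ xs (λ x → [ P? x ] ℤ.* value (f x))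
    sum-filter P? f []       = value-0q
    sum-filter P? f (x ∷ xs) with does (P? x)
    ... | false = subst (value (List.foldr _+q_ 0q (List.map f (List.filter P? xs))) ≈_)
                    (sym (trans (cong (ℤ._+ ∑ₗ xs (λ x → [ P? x ] ℤ.* value (f x))) (ℤ.*-zeroˡ (value (f x))))
                        (ℤ.+-identityˡ (∑ₗ xs (λ x → [ P? x ] ℤ.* value (f x))))))
                    (sum-filter P? f xs)
    ... | true  = ≈-trans {value (f x +q r)} {value (f x) ℤ.+ value r} {1ℤ ℤ.* value (f x) ℤ.+ s}
                    (value-reduce (value (f x) ℤ.+ value r))
                    (+-cong {value (f x)} {1ℤ ℤ.* value (f x)} {value r} {s}
                        (≡⇒≈ {value (f x)} {1ℤ ℤ.* value (f x)} (sym (ℤ.*-identityˡ (value (f x)))))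
                            (sum-filter P? f xs))
      where
      r = List.foldr _+q_ 0q (List.map f (List.filter P? xs))
      s = ∑ₗ xs (λ x → [ P? x ] ℤ.* value (f x))

    ∂-difference : ∀ {n m} (G : Graph n m) x v →
      ∑ₗ (List.allFin m) (λ e → [ head G e Fin.≟ v ] ℤ.* x e)
        ℤ.- ∑ₗ (List.allFin m) (λ e → [ tail G e Fin.≟ v ] ℤ.* x e) ≡ ∂ G x v
    ∂-difference {m = m} G x v = begin
      ∑ₗ (List.allFin m) h ℤ.- ∑ₗ (List.allFin m) t
        ≡⟨ solve 2 (λ a b → a :- b := a :+ con -1ℤ :* b) refl (∑ₗ (List.allFin m) h) (∑ₗ (List.allFin m) t) ⟩
      ∑ₗ (List.allFin m) h ℤ.+ -1ℤ ℤ.* ∑ₗ (List.allFin m) t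
        ≡⟨ cong (ℤ._+_ (∑ₗ (List.allFin m) h)) (∑ₗ-* (List.allFin m) -1ℤ t) ⟨
      ∑ₗ (List.allFin m) h ℤ.+ ∑ₗ (List.allFin m) (λ e → -1ℤ ℤ.* t e)
        ≡⟨ ∑ₗ-+ (List.allFin m) h (λ e → -1ℤ ℤ.* t e) ⟨
      ∑ₗ (List.allFin m) (λ e → h e ℤ.+ -1ℤ ℤ.* t e)
        ≡⟨ ∑ₗ-cong (List.allFin m) (λ e → solve 3 (λ a b x → a :* x :+ con -1ℤ :* (b :* x) := (a :- b) :* x) refl
             [ head G e Fin.≟ v ] [ tail G e Fin.≟ v ] (x e)) ⟩
      ∑ₗ (List.allFin m) (λ e → incident (head G e) (tail G e) v ℤ.* x e)
        ≡⟨ ∑ₗ-tabulate (λ e → e) (λ e → incident (head G e) (tail G e) v ℤ.* x e) ⟩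
      ∂ G x v ∎
      where
      open ≡-Reasoning
      h t : Fin m → ℤ
      h e = [ head G e Fin.≟ v ] ℤ.* x e
      t e = [ tail G e Fin.≟ v ] ℤ.* x e

  -- Net inflow in `Fin q` becomes an integer boundary up to congruence. A loop occurs once in the
  -- inflow and once in the outflow, and its coefficient in `∂` is zero.
  isFlow⇔ : ∀ {n m} (G : Graph n m) (b : Fin n → ℤ) f →
            IsFlow G (λ v → reduce q (b v)) f ⇔ (∀ v → ∂ G (value ∘ f) v ≈ b v)
  isFlow⇔ {m = m} G b f = mk⇔
    (λ flow v → ≈-trans {∂ G (value ∘ f) v} {value (net v)} {b v}
        (≈-sym {value (net v)} {∂ G (value ∘ f) v} (value-net v))
      (Equivalence.from (value-reduce⇔ (net v) (b v)) (sym (flow v))))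
    (λ h v → sym (Equivalence.to (value-reduce⇔ (net v) (b v))
        (≈-trans {value (net v)} {∂ G (value ∘ f) v} {b v} (value-net v) (h v))))
    where
    in′ out : Fin _ → Fin q
    in′ v = inflow G (λ v → reduce q (b v)) f v
    out v = outflow G (λ v → reduce q (b v)) f v
    net : Fin _ → Fin q
    net v = in′ v -q out v
    value-net : ∀ v → value (net v) ≈ ∂ G (value ∘ f) v
    value-net v = subst (value (net v) ≈_) (∂-difference G (value ∘ f) v)
      (≈-trans {value (net v)} {value (in′ v) ℤ.- value (out v)} {i ℤ.- o}
          (value-reduce (value (in′ v) ℤ.- value (out v)))
        (+-cong {value (in′ v)} {i} {ℤ.- value (out v)} {ℤ.- o} (sum-filter (λ e → head G e Fin.≟ v) f (List.allFin m))
          (-‿cong {value (out v)} {o} (sum-filter (λ e → tail G e Fin.≟ v) f (List.allFin m)))))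
      where
      i = ∑ₗ (List.allFin m) (λ e → [ head G e Fin.≟ v ] ℤ.* value (f e))
      o = ∑ₗ (List.allFin m) (λ e → [ tail G e Fin.≟ v ] ℤ.* value (f e))

  #F*-inclusion–exclusion : ∀ {n m} (G : Graph n m) (b : Fin n → ℤ) →
    + #F* G (λ v → reduce q (b v)) ≡ Σ⊆ (λ S → sign S ℤ.* #solutions G S b)
  #F*-inclusion–exclusion {m = m} G b = begin
    + #F* G (λ v → reduce q (b v))
      ≡⟨ length-filter (λ f → nowhereZeroFlow? G (λ v → reduce q (b v)) (Vec.lookup f)) (Words m) ⟩
    ∑ₗ (Words m) (λ f → [ nowhereZeroFlow? G (λ v → reduce q (b v)) (Vec.lookup f) ])
      ≡⟨ ∑ₗ-cong (Words m) (λ f → trans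
           ([]-⇔ (mk⇔ (λ (p , z) → z , Equivalence.to (isFlow⇔ G b (Vec.lookup f)) p)
                      (λ (z , p) → Equivalence.from (isFlow⇔ G b (Vec.lookup f)) p , z))
                 (nowhereZeroFlow? G (λ v → reduce q (b v)) (Vec.lookup f))
                 (Fin.all? (λ e → ¬? (Vec.lookup f e Fin.≟ 0q)) ×-dec solves? G b f))
           (trans ([]-× (Fin.all? (λ e → ¬? (Vec.lookup f e Fin.≟ 0q))) (solves? G b f))
           (trans (cong (ℤ._* [ solves? G b f ]) (trans (nowhereVanishing-[] f) (sym (inclusion–exclusion f))))
           (trans (ℤ.*-comm (∑ₗ (subsets m) (λ S → sign S ℤ.* vanishing S f)) [ solves? G b f ])
           (trans (sym (∑ₗ-* (subsets m) [ solves? G b f ] (λ S → sign S ℤ.* vanishing S f)))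
                  (∑ₗ-cong (subsets m) (λ S → solve 3 (λ p s z → p :* (s :* z) := s :* (z :* p)) refl
                      [ solves? G b f ] (sign S) (vanishing S f)))))))) ⟩
    ∑ₗ (Words m) (λ f → ∑ₗ (subsets m) (λ S → sign S ℤ.* (vanishing S f ℤ.* [ solves? G b f ])))
      ≡⟨ ∑ₗ-swap (Words m) (subsets m) (λ f S → sign S ℤ.* (vanishing S f ℤ.* [ solves? G b f ])) ⟩
    ∑ₗ (subsets m) (λ S → ∑ₗ (Words m) (λ f → sign S ℤ.* (vanishing S f ℤ.* [ solves? G b f ])))
      ≡⟨ ∑ₗ-cong (subsets m) (λ S → ∑ₗ-* (Words m) (sign S) (λ f → vanishing S f ℤ.* [ solves? G b f ])) ⟩
    Σ⊆ (λ S → sign S ℤ.* #solutions G S b) ∎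
    where open ≡-Reasoning

-- The arrangement

if-elim : ∀ {a p r} {A : Set a} (P : A → Set p) {R : Set r} {x y : A} (R? : Dec R) →
          (R → P x) → (¬ R → P y) → P (if does R? then x else y)
if-elim P (yes r) f g = f r
if-elim P (no ¬r) f g = g ¬r

ℤ⇒ℝ-isRingHomomorphism : RingMorphisms.IsRingHomomorphism ℤ.+-*-rawRing (CommutativeRing.rawRing ℝ-commutativeRing) ℤ⇒ℝ
ℤ⇒ℝ-isRingHomomorphism = record
  { isSemiringHomomorphism = record
    { isNearSemiringHomomorphism = record
      { +-isMonoidHomomorphism = record
        { isMagmaHomomorphism = record
          { isRelHomomorphism = record { cong = λ e → pointwise (λ _ → cong fromℤ e) }
          ; homo = λ i j → pointwise (λ _ → +-homo i j)
          }
        ; ε-homo = pointwise (λ _ → refl)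
        }
      ; *-homo = λ i j → pointwise (λ _ → *-homo i j)
      }
    ; 1#-homo = pointwise (λ _ → refl)
    }
  ; -‿homo = λ i → pointwise (λ _ → -‿homo i)
  }
  where open RingMorphisms.IsRingHomomorphism fromℤ-isRingHomomorphism

-- A nonzero constant sequence is refuted at the tolerance `ε = ∣ a ∣`. This brings an equation
-- between integers inside ℝ back to ℤ.
constant-zero : ∀ {a} → constant a ≃ constant 0ℚ → a ≡ 0ℚ
constant-zero {a} e with ℚ.<-cmp 0ℚ ℚ.∣ a ∣
... | tri≈ _ 0≡∣a∣ _ = ℚ.∣p∣≡0⇒p≡0 a (sym 0≡∣a∣)
... | tri> _ _ ∣a∣<0 = contradiction (ℚ.<-≤-trans ∣a∣<0 (ℚ.0≤∣p∣ a)) (ℚ.<-irrefl refl)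
... | tri< 0<∣a∣ _ _ with _≃_.null e ℚ.∣ a ∣ 0<∣a∣
...   | N , close = contradiction (subst (λ z → ℚ.∣ z ∣ ℚ.< ℚ.∣ a ∣) (ℚ.+-identityʳ a) (close N ℕ.≤-refl))
    (ℚ.<-irrefl refl)

ℤ⇒ℝ-zero : ∀ {i} → ℤ⇒ℝ i ≃ ℤ⇒ℝ 0ℤ → i ≡ 0ℤ
ℤ⇒ℝ-zero e = fromℤ-injective (constant-zero e)

module ℝ-Boundary = Boundary ℝ-commutativeRing
module ℝ-Change = BaseChange ℝ-commutativeRing ℤ⇒ℝ ℤ⇒ℝ-isRingHomomorphism

-- The name b is avoided next to q, since q G b would parse as an application of the operator q_b.
module _ {n m} (G : Graph n m) (𝐛 : Fin n → ℤ) where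

  private
    open CommutativeRing ℝ-commutativeRing 
      using () renaming (sym to ≃-sym; trans to ≃-trans; *-congʳ to ⊗-congʳ)

    incidence-∂ : ∀ x v → ((λ v e → ℤ⇒ℝ (incidence G v e)) Real.∙ x) v ≃ ℝ-Boundary.∂ G x v
    incidence-∂ x v = Real.sum-cong (λ e → ⊗-congʳ (ℝ-Change.φ-incidence G v e))

  ⋂H⇔ : ∀ S x → ⋂H (𝒜 (incidence G) 𝐛) S x ⇔
        (ℝ-Boundary.Vanishes S x × (∀ v → ℝ-Boundary.∂ G x v ≃ ℤ⇒ℝ (𝐛 v)))
  ⋂H⇔ S x = mk⇔
    (λ (x∈V , x∈H) → (λ e e∈S → proj₂ (x∈H e e∈S)) , λ v → ≃-trans (≃-sym (incidence-∂ x v)) (x∈V v))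
    (λ (x≈0 , ∂x) → let x∈V = λ v → ≃-trans (incidence-∂ x v) (∂x v) in x∈V , λ e e∈S → x∈V , x≈0 e e∈S)

  -- Emptiness of a real intersection is read off the rank over ℚ, because equality in ℝ offers no
  -- decision.
  dimension : Subset m → Maybe ℕ
  dimension S = if does (rankCondition? G 𝐛 S) then just (nullity-after-removing G S) else nothing

  -- The rank condition means `β = 0`, which is solvability over ℝ as well. Translation by one
  -- solution then identifies the directions of the intersection with `Kernel G S`.
  isDimension : ∀ S → IsDimension (𝒜 (incidence G) 𝐛) S (dimension S)
  isDimension S = let _ , _ , _ , B = build G S in if-elim (IsDimension (𝒜 (incidence G) 𝐛) S) (rankCondition? G 𝐛 S)
    (λ r → let x , x≈0 , ∂x = ℝ-Change.solvable⇐ G 𝐛 S B (Equivalence.to (rankCondition⇔ B 𝐛) r) in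
      x , Equivalence.from (⋂H⇔ S x) (x≈0 , ∂x) ,
      subst (Real.HasDimension (λ z → ⋂H (𝒜 (incidence G) 𝐛) S (λ e → x e ⊕ z e))) (sym (nullity-build B))
        (ℝ-Boundary.dimension-⇔ (λ z → mk⇔
          (λ p → Equivalence.to (ℝ-Boundary.translate⇔ G x≈0 ∂x z) (Equivalence.to (⋂H⇔ S (λ e → x e ⊕ z e)) p))
          (λ p → Equivalence.from (⋂H⇔ S (λ e → x e ⊕ z e)) (Equivalence.from (ℝ-Boundary.translate⇔ G x≈0 ∂x z) p)))
          (ℝ-Boundary.kernel-dimension B)))
    (λ ¬r (x , x∈) → let x≈0 , ∂x = Equivalence.to (⋂H⇔ S x) x∈ in
      ¬r (Equivalence.from (rankCondition⇔ B 𝐛) (λ k → ℤ⇒ℝ-zero (ℝ-Change.solvable⇒ G 𝐛 S B x≈0 ∂x k))))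

  private
    filter-maybe : ∀ Ss →
                   Σₚ (List.map (λ S → sign S t^ nullity-after-removing G S) (List.filter (rankCondition? G 𝐛) Ss)) ≡
                   Σₚ (List.map (λ S → maybe (sign S t^_) [] (dimension S)) Ss)
    filter-maybe []       = refl
    filter-maybe (S ∷ Ss) with does (rankCondition? G 𝐛 S)
    ... | true  = cong ((sign S t^ nullity-after-removing G S) +ₚ_) (filter-maybe Ss)
    ... | false = filter-maybe Ss

  τ-sum-isCharacteristicPolynomial : IsCharacteristicPolynomial (𝒜 (incidence G) 𝐛) (τ-sum G 𝐛)
  τ-sum-isCharacteristicPolynomial = dimension , isDimension , λ i → cong (λ p → coefficient p i)
      (filter-maybe (subsets m))

  -- The two ways in which `d̃` can be 1 are the two ways in which `β` can vanish modulo `q`: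
  -- already over ℤ, or nonzero with `q` dividing every entry.
  d̃-indicator : ∀ S q .{{_ : NonZero q}} {c ν} {κ : Fin n → Fin c} → Build G S κ ν →
                + d̃ G 𝐛 S q ≡ [ Count.null? q (ℤ-Boundary.Σκ κ 𝐛) ]
  d̃-indicator S q {κ = κ} B = if-elim (λ t → + t ≡ [ β≈0? ]) (rankCondition? G 𝐛 S)
    (λ r → sym (cong (λ t → if t then 1ℤ else 0ℤ)
      (dec-true β≈0? (λ k → Modular.≡⇒≈ q (Equivalence.to (rankCondition⇔ B 𝐛) r k)))))
    (λ ¬r → let β≢0  = ¬r ∘ Equivalence.from (rankCondition⇔ B 𝐛)
                q∣d⇔ = exponent-∣ B 𝐛 (exponent B 𝐛 β≢0) β≢0 in
      trans (indicator q∣d?)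
        ([]-⇔ (mk⇔ (λ h k → Equivalence.from (Modular.≈0⇔∣ q) (Equivalence.to q∣d⇔ h k))
                   (λ h → Equivalence.from q∣d⇔ (λ k → Equivalence.to (Modular.≈0⇔∣ q) (h k)))) q∣d? β≈0?))
    where
    β≈0? = Count.null? q (ℤ-Boundary.Σκ κ 𝐛)
    q∣d? = q ℕ∣.∣? largestInvariantFactor (M̄ G 𝐛 S)
    indicator : ∀ {P : Set} (P? : Dec P) → + (if does P? then 1 else 0) ≡ [ P? ]
    indicator P? with does P?
    ... | true  = refl
    ... | false = refl

  #F*-formula : ∀ q .{{_ : NonZero q}} →
    + #F* G (λ v → reduce q (𝐛 v)) ≡ Σ⊆ (λ S → sign S ℤ.* + d̃ G 𝐛 S q ℤ.* + (q ℕ.^ nullity-after-removing G S))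
  #F*-formula q = trans (Count.#F*-inclusion–exclusion q G 𝐛) (∑ₗ-cong (subsets m) (λ S → term S))
    where
    term : ∀ S → sign S ℤ.* Count.#solutions q G S 𝐛 ≡ sign S ℤ.* + d̃ G 𝐛 S q ℤ.* + (q ℕ.^ nullity-after-removing G S)
    term S = let _ , κ , ν , B = build G S in begin
      sign S ℤ.* Count.#solutions q G S 𝐛
        ≡⟨ cong (sign S ℤ.*_) (Count.#solutions-formula q B 𝐛) ⟩
      sign S ℤ.* ([ Count.null? q (ℤ-Boundary.Σκ κ 𝐛) ] ℤ.* + (q ℕ.^ ν))
        ≡⟨ cong₂ (λ t μ → sign S ℤ.* (t ℤ.* + (q ℕ.^ μ))) (d̃-indicator S q B) (nullity-build B) ⟨
      sign S ℤ.* (+ d̃ G 𝐛 S q ℤ.* + (q ℕ.^ nullity-after-removing G S))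
        ≡⟨ ℤ.*-assoc (sign S) (+ d̃ G 𝐛 S q) (+ (q ℕ.^ nullity-after-removing G S)) ⟨
      sign S ℤ.* + d̃ G 𝐛 S q ℤ.* + (q ℕ.^ nullity-after-removing G S) ∎
      where open ≡-Reasoning

-- The polynomial τ

eval-+ₚ : ∀ p r x → eval (p +ₚ r) x ≡ eval p x ℤ.+ eval r x
eval-+ₚ []      r       x = sym (ℤ.+-identityˡ _)
eval-+ₚ (a ∷ p) []      x = sym (ℤ.+-identityʳ _)
eval-+ₚ (a ∷ p) (b ∷ r) x = trans (cong (λ y → a ℤ.+ b ℤ.+ x ℤ.* y) (eval-+ₚ p r x))
  (solve 5 (λ a b x p r → a :+ b :+ x :* (p :+ r) := (a :+ x :* p) :+ (b :+ x :* r)) refl a b x (eval p x) (eval r x))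

eval-t^ : ∀ a k q → eval (a t^ k) (+ q) ≡ a ℤ.* + (q ℕ.^ k)
eval-t^ a zero    q = trans (cong (ℤ._+_ a) (ℤ.*-zeroʳ (+ q))) (trans (ℤ.+-identityʳ a) (sym (ℤ.*-identityʳ a)))
eval-t^ a (suc k) q = trans (ℤ.+-identityˡ _) (trans (cong (+ q ℤ.*_) (eval-t^ a k q))
  (trans (solve 3 (λ q a p → q :* (a :* p) := a :* (q :* p)) refl (+ q) a (+ (q ℕ.^ k)))
    (cong (a ℤ.*_) (sym (ℤ.pos-* q (q ℕ.^ k))))))

eval-Σₚ : ∀ {A : Set} (f : A → Polynomial) xs x → eval (Σₚ (List.map f xs)) x ≡ ∑ₗ xs (λ a → eval (f a) x)
eval-Σₚ f []       x = refl
eval-Σₚ f (a ∷ xs) x = trans (eval-+ₚ (f a) _ x) (cong (ℤ._+_ (eval (f a) x)) (eval-Σₚ f xs x))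

-- Enumerations and comparison of list lengths

∈-words : ∀ {A : Set} {xs : List A} → (∀ x → x List.∈ xs) → ∀ {m} (w : Vec A m) → w List.∈ words xs m
∈-words         p []      = here refl
∈-words {xs = xs} p (x ∷ w) = List.∈-cartesianProductWith⁺ _∷_ {xs = xs} (p x) (∈-words p w)

words-unique : ∀ {A : Set} {xs : List A} → Unique xs → ∀ m → Unique (words xs m)
words-unique {xs = xs} xs! zero    = [] ∷ []
words-unique {xs = xs} xs! (suc m) = Unique.cartesianProductWith⁺ _∷_ Vec.∷-injective xs! (words-unique xs! m)

∈-subsets : ∀ {m} (S : Subset m) → S List.∈ subsets m
∈-subsets = ∈-words λ where
  true  → here refl
  false → there (here refl)

lookup-injective : ∀ {A : Set} {xs : List A} → Unique xs → ∀ {i j} → List.lookup xs i ≡ List.lookup xs j → i ≡ j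
lookup-injective (x∉xs ∷ xs!) {zero}  {zero}  e = refl
lookup-injective (x∉xs ∷ xs!) {zero}  {suc j} e = contradiction e (All.lookup x∉xs (List.∈-lookup j))
lookup-injective (x∉xs ∷ xs!) {suc i} {zero}  e = contradiction (sym e) (All.lookup x∉xs (List.∈-lookup i))
lookup-injective (x∉xs ∷ xs!) {suc i} {suc j} e = cong suc (lookup-injective xs! e)

unique-⊆-length : ∀ {A : Set} {xs ys : List A} → Unique xs →
    (∀ {x} → x List.∈ xs → x List.∈ ys) → length xs ℕ.≤ length ys
unique-⊆-length {A} {xs} {ys} xs! sub = Fin.injective⇒≤ {f = λ i → Any.index (sub (List.∈-lookup i))}
  (λ e → lookup-injective xs! (index-injective (≡.setoid A) (sub (List.∈-lookup _)) (sub (List.∈-lookup _)) e))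

module _ {n m} (G : Graph n m) (𝐛 : Fin n → ℤ) where

  -- A positive `d` bounded by `q_b` cannot be a multiple of a larger `q`. Positivity is essential,
  -- since every `q` divides the default value 0.
  d̃-large : ∀ S q .{{_ : NonZero q}} → q_b G 𝐛 ℕ.< q → + d̃ G 𝐛 S q ≡ [ rankCondition? G 𝐛 S ]
  d̃-large S q q_b<q = if-elim (λ t → + t ≡ [ rankCondition? G 𝐛 S ]) (rankCondition? G 𝐛 S)
    (λ r → sym (cong (λ t → if t then 1ℤ else 0ℤ) (dec-true (rankCondition? G 𝐛 S) r)))
    (λ ¬r → trans (cong (λ t → + (if t then 1 else 0)) (dec-false (q ℕ∣.∣? d) (∤ ¬r)))
      (sym (cong (λ t → if t then 1ℤ else 0ℤ) (dec-false (rankCondition? G 𝐛 S) ¬r))))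
    where
    d = largestInvariantFactor (M̄ G 𝐛 S)
    ∤ : ¬ RankCondition G 𝐛 S → ¬ (q ℕ∣.∣ d)
    ∤ ¬r q∣d = ℕ.<⇒≱ (ℕ.≤-<-trans d≤q_b q_b<q) (ℕ∣.∣⇒≤ {{ℕ.>-nonZero d>0}} q∣d)
      where
      B = proj₂ (proj₂ (proj₂ (build G S)))
      d>0 : 0 ℕ.< d
      d>0 = Exponent.positive (exponent B 𝐛 (¬r ∘ Equivalence.from (rankCondition⇔ B 𝐛)))
      d≤q_b : d ℕ.≤ q_b G 𝐛
      d≤q_b = All.lookup (xs≤max 0 (List.map (λ S → largestInvariantFactor (M̄ G 𝐛 S))
          (List.filter (λ S → ¬? (rankCondition? G 𝐛 S)) (subsets m))))
        (List.∈-map⁺ (λ S → largestInvariantFactor (M̄ G 𝐛 S))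
            (List.∈-filter⁺ (λ S → ¬? (rankCondition? G 𝐛 S)) (∈-subsets S) ¬r))

  τ-sum-counts : ∀ q .{{_ : NonZero q}} → q_b G 𝐛 ℕ.< q → + #F* G (λ v → reduce q (𝐛 v)) ≡ eval (τ-sum G 𝐛) (+ q)
  τ-sum-counts q q_b<q = begin
    + #F* G (λ v → reduce q (𝐛 v))
      ≡⟨ #F*-formula G 𝐛 q ⟩
    Σ⊆ (λ S → sign S ℤ.* + d̃ G 𝐛 S q ℤ.* + (q ℕ.^ ν S))
      ≡⟨ ∑ₗ-cong (subsets m) (λ S → trans (cong (λ t → sign S ℤ.* t ℤ.* + (q ℕ.^ ν S)) (d̃-large S q q_b<q))
           (trans (solve 3 (λ s t p → s :* t :* p := t :* (s :* p)) refl (sign S) [ rankCondition? G 𝐛 S ]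
               (+ (q ℕ.^ ν S)))
             (cong ([ rankCondition? G 𝐛 S ] ℤ.*_) (sym (eval-t^ (sign S) (ν S) q))))) ⟩
    Σ⊆ (λ S → [ rankCondition? G 𝐛 S ] ℤ.* eval (sign S t^ ν S) (+ q))
      ≡⟨ ∑ₗ-filter (rankCondition? G 𝐛) (subsets m) (λ S → eval (sign S t^ ν S) (+ q)) ⟨
    ∑ₗ (List.filter (rankCondition? G 𝐛) (subsets m)) (λ S → eval (sign S t^ ν S) (+ q))
      ≡⟨ eval-Σₚ (λ S → sign S t^ ν S) (List.filter (rankCondition? G 𝐛) (subsets m)) (+ q) ⟨
    eval (τ-sum G 𝐛) (+ q) ∎
    where
    open ≡-Reasoning
    ν : Subset m → ℕ
    ν = nullity-after-removing G

  private
    module _ {c ν} {κ : Fin n → Fin c} (B : Build G ⊥ κ ν) where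

      open ℤ-Boundary using (∂; ∂-+*; Σκ; Σκ-*; Σκ-∂-null; exact)

      -- The cokernel of `∂` is free: if `q y` is a boundary, its component sums vanish, hence so do
      -- those of `y`. Taking `S` to be `⊥` keeps all edges.
      exact-multiple : ∀ q .{{_ : NonZero q}} (z : Vector ℤ m) (y : Vector ℤ n) →
          (∀ v → ∂ G z v ≡ y v ℤ.* + q) → ∃[ x ] ∀ v → ∂ G x v ≡ y v
      exact-multiple q z y e =
        let x , _ , ∂x = exact B y (λ k → ℤ.*-cancelʳ-≡ (Σκ κ y k) 0ℤ (+ q) (begin
              Σκ κ y k ℤ.* + q              ≡⟨ ℤ.*-comm (Σκ κ y k) (+ q) ⟩
              + q ℤ.* Σκ κ y k              ≡⟨ Σκ-* κ (+ q) y k ⟨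
              Σκ κ (λ v → + q ℤ.* y v) k    ≡⟨ ℤ-Boundary.Σκ-cong κ (λ v → trans (e v) (ℤ.*-comm (y v) (+ q))) k ⟨
              Σκ κ (∂ G z) k                ≡⟨ Σκ-∂-null κ {G = G} (IsQuotient.compatible (isQuotient B))
                  (λ e e∈⊥ → contradiction e∈⊥ ∉⊥) k ⟩
              0ℤ                            ≡⟨ ℤ.*-zeroˡ (+ q) ⟨
              0ℤ ℤ.* + q                    ∎))
        in x , ∂x
        where open ≡-Reasoning

  -- Two integer vectors whose boundaries agree modulo q differ by a cycle modulo q, and cycles lift to ℤ.
  lift-modulo : ∀ q .{{_ : NonZero q}} (x y : Vector ℤ m) →
    (∀ v → Modular._≈_ q (ℤ-Boundary.∂ G x v) (ℤ-Boundary.∂ G y v)) →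
    ∃[ z ] ((∀ v → ℤ-Boundary.∂ G z v ≡ ℤ-Boundary.∂ G y v) × (∀ e → Modular._≈_ q (z e) (x e)))
  lift-modulo q x y x~y =
    let _ , _ , _ , B = build G ⊥
        u , ∂u = exact-multiple B q (λ e → x e ℤ.+ -1ℤ ℤ.* y e) (λ v → ℤ∣.quotient (x~y v)) (λ v →
          trans (∂-+* G x -1ℤ y v) (trans (solve 2 (λ a b → a :+ con -1ℤ :* b := a :- b) refl (∂ G x v) (∂ G y v))
              (ℤ∣._∣_.equality (x~y v))))
    -- The boundary of `u` is the difference of the boundaries of `x` and `y` divided by `q`, so
    -- subtracting `q u` corrects the boundary without changing residues modulo `q`.
    in (λ e → x e ℤ.+ (ℤ.- + q) ℤ.* u e) ,
       (λ v → trans (∂-+* G x (ℤ.- + q) u v) (trans (cong (λ t → ∂ G x v ℤ.+ (ℤ.- + q) ℤ.* t) (∂u v))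
         (trans (solve 3 (λ a q t → a :+ (:- q) :* t := a :- t :* q) refl (∂ G x v) (+ q) (ℤ∣.quotient (x~y v)))
           (trans (cong (ℤ._-_ (∂ G x v)) (sym (ℤ∣._∣_.equality (x~y v))))
             (solve 2 (λ a b → a :- (a :- b) := b) refl (∂ G x v) (∂ G y v)))))) ,
       (λ e → ℤ∣.divides (ℤ.- u e) (solve 3 (λ x q u → (x :+ (:- q) :* u) :- x := (:- u) :* q) refl (x e) (+ q) (u e)))
    where open ℤ-Boundary using (∂; ∂-+*)

-- Lifting flows to a multiple of the modulus

module _ {n m} (G : Graph n m) (𝐛 : Fin n → ℤ) where

  module _ {q r : ℕ} .{{_ : NonZero q}} .{{_ : NonZero r}} (q∣r : q ℕ∣.∣ r) where

    private
      module Q = Modular q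
      module R = Modular r

      weaken : ∀ {x y} → x R.≈ y → x Q.≈ y
      weaken = ℤ∣.∣-trans (ℤ∣.∣ᵤ⇒∣ {+ q} {+ r} q∣r)

      b-q : Fin n → ℤ/ q
      b-q v = reduce q (𝐛 v)

      b-r : Fin n → ℤ/ r
      b-r v = reduce r (𝐛 v)

      project : Vec (Fin r) m → Vec (Fin q) m
      project = Vec.map (λ x → reduce q (R.value x))

      nowhereZeroFlows : List (Vec (Fin q) m)
      nowhereZeroFlows = List.filter (λ f → nowhereZeroFlow? G b-q (Vec.lookup f)) (words (List.allFin q) m)

      nowhereZeroFlows′ : List (Vec (Fin r) m)
      nowhereZeroFlows′ = List.filter (λ f → nowhereZeroFlow? G b-r (Vec.lookup f)) (words (List.allFin r) m)

      lookup-ext : ∀ {A : Set} {k} {u w : Vec A k} → (∀ e → Vec.lookup u e ≡ Vec.lookup w e) → u ≡ w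
      lookup-ext {u = u} {w} h = trans (sym (Vec.tabulate∘lookup u))
          (trans (Vec.tabulate-cong h) (Vec.tabulate∘lookup w))

      ∂-values : ∀ z f v → (∀ e → R.value (Vec.lookup f e) R.≈ z e) →
                 ℤ-Boundary.∂ G (R.value ∘ Vec.lookup f) v R.≈ ℤ-Boundary.∂ G z v
      ∂-values z f v f≈z = Boundary.∂-cong R.commutativeRing G {R.value ∘ Vec.lookup f} {z} f≈z v

      -- An entry that vanishes modulo `r` also vanishes modulo its divisor `q`, so `f′` inherits
      -- nowhere-vanishing from `f`.
      reduce-flow : ∀ z f → (∀ v → ℤ-Boundary.∂ G z v R.≈ 𝐛 v) → (∀ e → z e Q.≈ Q.value (Vec.lookup f e)) →
                    NowhereZero G b-q (Vec.lookup f) →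
                    ∃[ f′ ] (IsFlow G b-r (Vec.lookup f′) × NowhereZero G b-r (Vec.lookup f′) × project f′ ≡ f)
      reduce-flow z f ∂z z≈f f≢0 = f′ ,
        Equivalence.from (Count.isFlow⇔ r G 𝐛 (Vec.lookup f′)) (λ v →
          R.≈-trans {ℤ-Boundary.∂ G (R.value ∘ Vec.lookup f′) v} {ℤ-Boundary.∂ G z v} {𝐛 v} (∂-values z f′ v f′≈z)
              (∂z v)) ,
        (λ e f′≡0 → f≢0 e (sym (Equivalence.to (Q.value-reduce⇔ (Vec.lookup f e) 0ℤ)
          (Q.≈-trans {Q.value (Vec.lookup f e)} {R.value (Vec.lookup f′ e)} {0ℤ}
            (Q.≈-sym {R.value (Vec.lookup f′ e)} {Q.value (Vec.lookup f e)} (f′≈f e))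
            (weaken {R.value (Vec.lookup f′ e)} {0ℤ} (subst (λ x → R.value x R.≈ 0ℤ) (sym f′≡0) R.value-0q)))))) ,
        lookup-ext (λ e → trans (Vec.lookup-map e (λ x → reduce q (R.value x)) f′)
          (Equivalence.to (Q.value-reduce⇔ (Vec.lookup f e) (R.value (Vec.lookup f′ e)))
            (Q.≈-sym {R.value (Vec.lookup f′ e)} {Q.value (Vec.lookup f e)} (f′≈f e))))
        where
        f′ : Vec (Fin r) m
        f′ = Vec.tabulate (λ e → reduce r (z e))
        f′≈z : ∀ e → R.value (Vec.lookup f′ e) R.≈ z e
        f′≈z e = subst (λ x → R.value x R.≈ z e) (sym (Vec.lookup∘tabulate (λ e → reduce r (z e)) e))
            (R.value-reduce (z e))
        f′≈f : ∀ e → R.value (Vec.lookup f′ e) Q.≈ Q.value (Vec.lookup f e)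
        f′≈f e = Q.≈-trans {R.value (Vec.lookup f′ e)} {z e} {Q.value (Vec.lookup f e)}
                   (weaken {R.value (Vec.lookup f′ e)} {z e} (f′≈z e)) (z≈f e)

      -- The given flow `g` modulo `r` fixes the boundary over ℤ, while `f` fixes the residues
      -- modulo `q`; `lift-modulo` produces integers that meet both demands.
      lift-flow : (∃[ g ] IsFlow G b-r g) → ∀ f → IsFlow G b-q (Vec.lookup f) × NowhereZero G b-q (Vec.lookup f) →
                  ∃[ f′ ] (IsFlow G b-r (Vec.lookup f′) × NowhereZero G b-r (Vec.lookup f′) × project f′ ≡ f)
      lift-flow (g , g-flow) f (f-flow , f≢0) = continue (lift-modulo G 𝐛 q x y x≈y)
        where
        open ℤ-Boundary using (∂)
        x y : Vector ℤ m
        x = Q.value ∘ Vec.lookup f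
        y = R.value ∘ g
        ∂g : ∀ v → ∂ G y v R.≈ 𝐛 v
        ∂g = Equivalence.to (Count.isFlow⇔ r G 𝐛 g) g-flow
        x≈y : ∀ v → ∂ G x v Q.≈ ∂ G y v
        x≈y v = Q.≈-trans {∂ G x v} {𝐛 v} {∂ G y v} (Equivalence.to (Count.isFlow⇔ q G 𝐛 (Vec.lookup f)) f-flow v)
          (Q.≈-sym {∂ G y v} {𝐛 v} (weaken {∂ G y v} {𝐛 v} (∂g v)))
        continue : ∃[ z ] ((∀ v → ∂ G z v ≡ ∂ G y v) × (∀ e → z e Q.≈ x e)) →
                   ∃[ f′ ] (IsFlow G b-r (Vec.lookup f′) × NowhereZero G b-r (Vec.lookup f′) × project f′ ≡ f)
        continue (z , ∂z , z≈x) = reduce-flow z f (λ v → subst (R._≈ 𝐛 v) (sym (∂z v)) (∂g v)) z≈x f≢0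

      project-onto : (∃[ g ] IsFlow G b-r g) → ∀ {f} → f List.∈ nowhereZeroFlows →
                     f List.∈ List.map project nowhereZeroFlows′
      project-onto flow {f} f∈ = found (lift-flow flow f
        (proj₂ (List.∈-filter⁻ (λ f → nowhereZeroFlow? G b-q (Vec.lookup f)) {xs = words (List.allFin q) m} f∈)))
        where
        found : ∃[ f′ ] (IsFlow G b-r (Vec.lookup f′) × NowhereZero G b-r (Vec.lookup f′) × project f′ ≡ f) →
                f List.∈ List.map project nowhereZeroFlows′
        found (f′ , f′-flow , f′≢0 , refl) =
          List.∈-map⁺ project (List.∈-filter⁺ (λ f → nowhereZeroFlow? G b-r (Vec.lookup f)) (∈-words List.∈-allFin f′)
              (f′-flow , f′≢0))

    -- `project` may send a nowhere-zero flow to one with zeros, so it is not a map between the two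
    -- sets of flows. It suffices that its image covers the duplicate-free list of flows modulo `q`.
    #F*-mono : (∃[ g ] IsFlow G b-r g) → #F* G b-q ℕ.≤ #F* G b-r
    #F*-mono flow = subst (length nowhereZeroFlows ℕ.≤_) (List.length-map project nowhereZeroFlows′)
      (unique-⊆-length (Unique.filter⁺ (λ f → nowhereZeroFlow? G b-q (Vec.lookup f))
          (words-unique (Unique.allFin⁺ q) m))
        (project-onto flow))

corollary4p2 : ∀ {n m : ℕ} (G : Graph n m) (b : Fin n → ℤ) →
    (∀ (q : ℕ) .{{_ : NonZero q}} →
    + #F* G (λ v → reduce q (b v))
    ≡ Σ⊆ (λ S → sign S ℤ.* + d̃ G b S q ℤ.* + (q ℕ.^ nullity-after-removing G S)))
    × (∃[ τ ] ((∀ (q : ℕ) .{{_ : NonZero q}} → q_b G b ℕ.< q →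
    + #F* G (λ v → reduce q (b v)) ≡ eval τ (+ q))
    × τ ≈ₚ τ-sum G b
    × IsCharacteristicPolynomial (𝒜 (incidence G) b) τ))
    × (∀ (p q : ℕ) .{{_ : NonZero p}} .{{_ : NonZero q}} →
    (∃[ f ] IsFlow {{m*n≢0 p q}} G (λ v → reduce (p ℕ.* q) {{m*n≢0 p q}} (b v)) f) →
    #F* G (λ v → reduce q (b v)) ℕ.≤ #F* G {{m*n≢0 p q}} (λ v → reduce (p ℕ.* q) {{m*n≢0 p q}} (b v)))
corollary4p2 G b =
  #F*-formula G b ,
  (τ-sum G b , τ-sum-counts G b , (λ _ → refl) , τ-sum-isCharacteristicPolynomial G b) ,
  λ p q → #F*-mono G b {{_}} {{m*n≢0 p q}} (ℕ∣.n∣m*n p)
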